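{- Let $\Sigma=(\mathrm{Fix},\mathrm{Free},\mathrm{Op},\mathrm{Const})$ be the structure with fixed spaces $\mathbb{R}$ (represented by $\rho$) and $\mathbb{N}$, with the single free space $C([-1,1])$, with constants all polytime computable real numbers and all polytime computable functions in Gevrey's hierarchy, and with the following operations (write $C=C([-1,1])$): 1. $\mathrm{const}\colon\mathbb{R}\to C$, $x\mapsto \lambda t.x$; 2. $+\colon C\times C\to C$; 3. $\times\colon C\times C\to C$ (pointwise product); 4. $-\colon C\to C$, $f\mapsto -f$; 5. $\mathrm{div}\colon\subseteq C\times C\to C$, $(f,g)\mapsto f/g$, with domain $\{(f,g) : g(x)\ge 1 \text{ for all } x\in[-1,1]\}$; 6. $C\to C$, $f\mapsto\sqrt{|f|}$; 7. $\circ\colon\subseteq C\times C\to C$, $(f,g)\mapsto f\circ g$, with domain $\{(f,g): g([-1,1])\subseteq[-1,1]\}$; 8. $\max\colon C\times C\to C$ (pointwise maximum); 9. $\mathrm{paramax}\colon C\to C$, $f\mapsto\lambda t.\max\{f(s): s\in[-1,t]\}$; 10. $\mathrm{join}\colon\subseteq[-1,1]\times C\times C\to C$, sending $(a,f,g)$ to the function equal to $f(x)$ for $x\le a$ and to $g(x)$ for $x\ge a$, with domain $\{(a,f,g): f(a)=g(a)\}$; 11. $\mathrm{primit}\colon C\to C$, $f\mapsto\lambda t.\int_{ -1}^t f(s)\,ds$; 12. $\mathrm{eval}\colon C\times[-1,1]\to\mathbb{R}$, $(f,x)\mapsto f(x)$. For each of the representations $\mathrm{Poly}$, $\mathrm{PAff}$,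 $\mathrm{Fun}$ of $C([-1,1])$, there is no compositional evaluation strategy for $\Sigma$ which uses that representation for $C([-1,1])$ and which evaluates $\Sigma$ in polynomial time.
   Context: Second-order complexity. $2^*$ is the set of finite binary strings. $\varphi\colon 2^*\to 2^*$ is length-monotone if $|u|\le|v|$ implies $|\varphi(u)|\le|\varphi(v)|$; $\mathcal{M}$ is the set of such functions, $|\varphi|(n)=|\varphi(0^n)|$. Second-order polynomials are built from the constant $1$ and the number variable $X$ by $+$, $\cdot$, and $P\mapsto\Phi(P)$, with $1(f,n)=1$, $X(f,n)=n$, pointwise $+,\cdot$, and $\Phi(P)(f,n)=f(P(f,n))$ for $f\in\mathbb{N}^{\mathbb{N}}$. A partial $F\colon\subseteq\mathcal{M}\to\mathcal{M}$ is polytime computable if an oracle Turing machine, given oracle $\varphi\in\mathrm{dom}(F)$ and input $u\in2^*$, outputs $F(\varphi)(u)$ within time $P(|\varphi|,|u|)$ for some second-order polynomial $P$. A representation of $X$ is a partial surjection $\delta_X\colon\subseteq\mathcal{M}\to X$; $\varphi$ is a name of $\delta_X(\varphi)$. A point is polytime computable if it has a polytime computable name. A realiser of a partial multi-valued $f\colon\subseteq X\rightrightarrows Y$ is $F\colon\subseteq\mathcal{M}\to\mathcal{M}$ with $\delta_Y(F(\varphi))\in f(\delta_X(\varphi))$ whenever $\delta_X(\varphi)\in\mathrm{dom}(f)$; $f$ is (polytime) computable if it has a (polytime) computable realiser. Finite products: $\langle\varphi_1,\dots,\varphi_n\rangle$ sends $\mathbf{i}\cdot u$ ($\mathbf{i}$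 a fixed-length binary code of $i\in\{1,\dots,n\}$) to $\varphi_i(u)\,1\,0^{l(|u|)-|\varphi_i|(|u|)}$ where $l(k)=\max_j|\varphi_j|(k)$, (and other strings to strings of zeros making it length-monotone, the empty string on inputs shorter than $|\mathbf{1}|$); it names the tuple of points named by the $\varphi_i$. Countable products carry their canonical product representation. $\rho$: $\varphi\in\mathcal{M}$ names $x\in\mathbb{R}$ iff $|\nu_{\mathbb{D}}(\varphi(0^n))-\nu_{\mathbb{D}}(\varphi(0^m))|\le2^{ -n}+2^{ -m}$ for all $n,m$ and $x=\lim_n\nu_{\mathbb{D}}(\varphi(0^n))$, with $\nu_{\mathbb{D}}$ the standard numbering of dyadic rationals $\mathbb{D}$ (finite binary notation). $[-1,1]$ is represented by the restriction of $\rho$. Representations of $C([-1,1])$ (sup metric $d$). The Cauchy representation induced by a numbering $\nu_A\colon 2^*\to A$ of a countable dense subset $A$: $\varphi\in\mathcal{M}$ names $f$ iff $d(\nu_A(\varphi(u)),f)<2^{ -|u|}$ for all $u\in2^*$. $\mathrm{Poly}$: Cauchy representation induced by polynomials with dyadic coefficients, encoded by the list of all monomial-basis coefficients in binary. $\mathrm{PAff}$: Cauchy representation induced by the continuous piecewise affine functions on $[-1,1]$ with dyadic breakpoints $-1=a_0<\dots<a_n=1$ and dyadic coefficients, encoded as lists of breakpoints and coefficients. (Padding of codes is allowed.) $\mathrm{Fun}$: $\varphi\in\mathcal{M}$ names $f$ iff $|\nu_{\mathbb{D}}(\varphi(\langle u,v\rangle))-f(\nu_{\mathbb{D}}(u))|\le2^{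 -|v|}$ for all $u,v\in2^*$ with $\nu_{\mathbb{D}}(u)\in[-1,1]$ (with $\langle\cdot,\cdot\rangle$ a standard pairing of strings), and for all $x,y\in[-1,1]$, $n\in\mathbb{N}$: $|x-y|<2^{ -|\varphi|(n)}$ implies $|f(x)-f(y)|<2^{ -n}$. Gevrey's hierarchy is the set of $f\in C^\infty[-1,1]$ for which there are $B,\ell,\gamma>0$ with $\sup_{[-1,1]}|f^{(n)}|\le B\,\ell^n n^{\gamma n}$ for all $n$ ($0^0=1$). A function $f\colon[-1,1]\to\mathbb{R}$ is polytime computable if it has a polytime computable realiser with respect to $\rho$. Compositional evaluation. A structure $\Sigma=(\mathrm{Fix},\mathrm{Free},\mathrm{Op},\mathrm{Const})$ consists of a set $\mathrm{Fix}$ of represented spaces (fixed spaces), a set $\mathrm{Free}$ of spaces (free spaces, whose representation is left open), a set $\mathrm{Op}$ of partial multi-valued operations between finite or countable products of spaces in $\mathrm{Fix}\cup\mathrm{Free}$, and a set $\mathrm{Const}$ of constants from such products. Terms over $\Sigma$: typed free variables; constants; pairs $(t_1,t_2)$; $\lambda n.t$ of type $X^{\mathbb{N}}$ for $t$ of type $X$ and $n$ a free variable of type $\mathbb{N}$; and $f(t)$ for $f\colon\subseteq X\rightrightarrows Y$ in $\mathrm{Op}$ and $t$ of type $X$. All terms are assumed well-defined. A term is semi-closed if it contains no free variables of free space type; a semi-closed term $t$ of type $Y$ with free variables of types $X_1,\dots,X_n$ defines a partial operation $X_1\times\dots\times X_n\rightrightarrows Y$. A compositional evaluation strategy $S$ for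 $\Sigma$ consists of: a representation of each free space; for each operation, an algorithm computing a realiser of it with respect to the representations; for each constant, an algorithm computing a name of it. Applying these algorithms compositionally along the structure of $t$, $S$ computes a realiser $\mathrm{eval}_S(t)$ of the operation defined by a semi-closed term $t$. $S$ is polytime (evaluates $\Sigma$ in polynomial time) if for every semi-closed term $t$ of fixed space type there is a second-order polynomial $P$ such that the computation of $\mathrm{eval}_S(t)(\varphi)(u)$ using $S$ takes time at most $P(|\varphi|,|u|)$. -}

module Defs where

open import Data.Bool.Base using (Bool; true; false; if_then_else_)
open import Data.Fin.Base using (Fin; zero; suc; toℕ; fromℕ<)
open import Data.Fin.Patterns using (0F; 1F; 2F; 3F)
open import Data.Integer.Base using (+_)
open import Data.List.Base using (List; []; _∷_; _++_; _∷ʳ_; length; map; foldl; foldr;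
  replicate; reverse; take; drop; allFin; upTo; applyUpTo; concatMap)
open import Data.List.Membership.Propositional using (_∈_)
open import Data.List.Relation.Unary.All using (All; []; _∷_; lookup)
open import Data.List.Relation.Unary.Any using (here; there; index)
open import Data.Maybe.Base as Maybe using (Maybe; just; nothing)
open import Data.Nat.Base as ℕ using (ℕ; zero; suc; _+_; _*_; _∸_; _⊔_; _≤_; _<_; ⌊_/2⌋)
open import Data.Nat.Logarithm using (⌈log₂_⌉)
import Data.Nat.Properties as ℕ
open import Data.Product.Base using (Σ; Σ-syntax; ∃; ∃₂; ∃-syntax; _×_; _,_; proj₁; proj₂)
open import Data.Rational.Base as ℚ using (ℚ; 0ℚ; 1ℚ; ½; ∣_∣)
import Data.Rational.Properties as ℚ
open import Data.Rational.Solver using (module +-*-Solver)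
open import Data.Sum.Base using (_⊎_; inj₁; inj₂)
open import Data.Unit.Base using (⊤)
open import Data.Vec.Base as Vec using (Vec; _[_]≔_)
open import Relation.Binary.PropositionalEquality
open import Relation.Nullary.Decidable using (yes; no)
open import Relation.Nullary.Negation using (¬_)

2^-_ : ℕ → ℚ
2^- zero  = 1ℚ
2^- suc n = ½ ℚ.* (2^- n)

fromℕℚ : ℕ → ℚ
fromℕℚ n = (+ n) ℚ./ 1

-- The reals, as Cauchy sequences of rationals considered up to _≈_.
module Real where

  Cauchy : (ℕ → ℚ) → Set
  Cauchy a = ∀ ε → 0ℚ ℚ.< ε → ∃[ N ] ∀ m n → N ℕ.≤ m → N ℕ.≤ n → ∣ a m ℚ.- a n ∣ ℚ.< ε

  private
    half : ∀ {ε} → 0ℚ ℚ.< ε → 0ℚ ℚ.< ½ ℚ.* ε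
    half {ε} p = subst (ℚ._< ½ ℚ.* ε) (ℚ.*-zeroʳ ½) (ℚ.*-monoʳ-<-pos ½ p)

    halves : ∀ ε → ½ ℚ.* ε ℚ.+ ½ ℚ.* ε ≡ ε
    halves ε = trans (sym (ℚ.*-distribʳ-+ ε ½ ½)) (ℚ.*-identityˡ ε)

    N⊔ˡ : ∀ {M N k} → M ℕ.⊔ N ℕ.≤ k → M ℕ.≤ k
    N⊔ˡ {M} {N} = ℕ.m⊔n≤o⇒m≤o M N

    N⊔ʳ : ∀ {M N k} → M ℕ.⊔ N ℕ.≤ k → N ℕ.≤ k
    N⊔ʳ {M} {N} = ℕ.m⊔n≤o⇒n≤o M N

    both : ∀ (a b : ℕ → ℚ) → Cauchy a → Cauchy b → ∀ {α β} → 0ℚ ℚ.< α → 0ℚ ℚ.< β →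
           ∃[ N ] ∀ m n → N ℕ.≤ m → N ℕ.≤ n → ∣ a m ℚ.- a n ∣ ℚ.< α × ∣ b m ℚ.- b n ∣ ℚ.< β
    both a b ca cb {α} {β} α>0 β>0 with ca α α>0 | cb β β>0
    ... | M , p | N , q = M ℕ.⊔ N , λ m n i j → p m n (N⊔ˡ i) (N⊔ˡ j) , q m n (N⊔ʳ {M} i) (N⊔ʳ {M} j)

    split : ∀ x y {ε} → ∣ x ∣ ℚ.< ½ ℚ.* ε → ∣ y ∣ ℚ.< ½ ℚ.* ε → ∣ x ℚ.+ y ∣ ℚ.< ε
    split x y {ε} p q = begin-strict
      ∣ x ℚ.+ y ∣          ≤⟨ ℚ.∣p+q∣≤∣p∣+∣q∣ x y ⟩
      ∣ x ∣ ℚ.+ ∣ y ∣      <⟨ ℚ.+-mono-< p q ⟩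
      ½ ℚ.* ε ℚ.+ ½ ℚ.* ε  ≡⟨ halves ε ⟩
      ε                    ∎
      where open ℚ.≤-Reasoning

    +-lemma : ∀ a b c d → (a ℚ.- c) ℚ.+ (b ℚ.- d) ≡ (a ℚ.+ b) ℚ.- (c ℚ.+ d)
    +-lemma = solve 4 (λ a b c d → (a :- c) :+ (b :- d) := (a :+ b) :- (c :+ d)) refl
      where open +-*-Solver

    neg-lemma : ∀ a c → ℚ.- (a ℚ.- c) ≡ (ℚ.- a) ℚ.- (ℚ.- c)
    neg-lemma = solve 2 (λ a c → :- (a :- c) := (:- a) :- (:- c)) refl
      where open +-*-Solver

    *-lemma : ∀ a b c d → (a ℚ.- c) ℚ.* b ℚ.+ c ℚ.* (b ℚ.- d) ≡ a ℚ.* b ℚ.- c ℚ.* d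
    *-lemma = solve 4 (λ a b c d → (a :- c) :* b :+ c :* (b :- d) := a :* b :- c :* d) refl
      where open +-*-Solver

    shift : ∀ p q → (p ℚ.- q) ℚ.+ q ≡ p
    shift = solve 2 (λ p q → (p :- q) :+ q := p) refl
      where open +-*-Solver

    flip : ∀ p q → ℚ.- (p ℚ.- q) ≡ q ℚ.- p
    flip = solve 2 (λ p q → :- (p :- q) := q :- p) refl
      where open +-*-Solver

    p≤∣p∣ : ∀ p → p ℚ.≤ ∣ p ∣
    p≤∣p∣ p with ℚ.≤-total 0ℚ p
    ... | inj₁ h = ℚ.≤-reflexive (sym (ℚ.0≤p⇒∣p∣≡p h))
    ... | inj₂ h = ℚ.≤-trans h (ℚ.0≤∣p∣ p)

    below : ∀ p q {ε} → ∣ p ℚ.- q ∣ ℚ.< ε → p ℚ.< ε ℚ.+ q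
    below p q {ε} h = subst (ℚ._< ε ℚ.+ q) (shift p q) (ℚ.+-monoˡ-< q (ℚ.≤-<-trans (p≤∣p∣ _) h))

    sym-dist : ∀ p q {ε} → ∣ p ℚ.- q ∣ ℚ.< ε → ∣ q ℚ.- p ∣ ℚ.< ε
    sym-dist p q = subst (ℚ._< _) (trans (sym (ℚ.∣-p∣≡∣p∣ (p ℚ.- q))) (cong ∣_∣ (flip p q)))

    above : ∀ p q {ε} → p ℚ.< ε ℚ.+ q → p ℚ.- q ℚ.< ε
    above p q {ε} h = subst (p ℚ.- q ℚ.<_) (trans (ℚ.+-assoc ε q (ℚ.- q)) (trans (cong (ε ℚ.+_) (ℚ.+-inverseʳ q)) (ℚ.+-identityʳ ε))) (ℚ.+-monoˡ-< (ℚ.- q) h)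

    close : ∀ p q {ε} → p ℚ.< ε ℚ.+ q → q ℚ.< ε ℚ.+ p → ∣ p ℚ.- q ∣ ℚ.< ε
    close p q {ε} h k with ℚ.∣p∣≡p∨∣p∣≡-p (p ℚ.- q)
    ... | inj₁ e = subst (ℚ._< ε) (sym e) (above p q h)
    ... | inj₂ e = subst (ℚ._< ε) (sym (trans e (flip p q))) (above q p k)

    ⊔-below : ∀ a b c d {ε} → a ℚ.< ε ℚ.+ c → b ℚ.< ε ℚ.+ d → a ℚ.⊔ b ℚ.< ε ℚ.+ (c ℚ.⊔ d)
    ⊔-below a b c d {ε} h k with ℚ.⊔-sel a b
    ... | inj₁ e = subst (ℚ._< _) (sym e) (ℚ.<-≤-trans h (ℚ.+-monoʳ-≤ ε (ℚ.p≤p⊔q c d)))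
    ... | inj₂ e = subst (ℚ._< _) (sym e) (ℚ.<-≤-trans k (ℚ.+-monoʳ-≤ ε (ℚ.p≤q⊔p c d)))

    bounded : ∀ a → Cauchy a → ∃[ B ] 0ℚ ℚ.< B × ∃[ N ] ∀ n → N ℕ.≤ n → ∣ a n ∣ ℚ.≤ B
    bounded a ca with ca 1ℚ (ℚ.positive⁻¹ 1ℚ)
    ... | N , h = 1ℚ ℚ.+ ∣ a N ∣ , pos , N , bound
      where
      open ℚ.≤-Reasoning
      pos : 0ℚ ℚ.< 1ℚ ℚ.+ ∣ a N ∣
      pos = ℚ.+-mono-<-≤ (ℚ.positive⁻¹ 1ℚ) (ℚ.0≤∣p∣ (a N))
      bound : ∀ n → N ℕ.≤ n → ∣ a n ∣ ℚ.≤ 1ℚ ℚ.+ ∣ a N ∣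
      bound n N≤n = begin
        ∣ a n ∣                          ≡⟨ cong ∣_∣ (shift (a n) (a N)) ⟨
        ∣ (a n ℚ.- a N) ℚ.+ a N ∣        ≤⟨ ℚ.∣p+q∣≤∣p∣+∣q∣ (a n ℚ.- a N) (a N) ⟩
        ∣ a n ℚ.- a N ∣ ℚ.+ ∣ a N ∣      ≤⟨ ℚ.+-monoˡ-≤ ∣ a N ∣ (ℚ.<⇒≤ (h n N N≤n ℕ.≤-refl)) ⟩
        1ℚ ℚ.+ ∣ a N ∣                   ∎

    scale : ∀ x y {η B ε} → η ℚ.* B ≡ ½ ℚ.* ε → 0ℚ ℚ.< B → ∣ x ∣ ℚ.< η → ∣ y ∣ ℚ.≤ B → ∣ x ℚ.* y ∣ ℚ.< ½ ℚ.* ε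
    scale x y {η} {B} {ε} e B>0 hx hy = begin-strict
      ∣ x ℚ.* y ∣      ≡⟨ ℚ.∣p*q∣≡∣p∣*∣q∣ x y ⟩
      ∣ x ∣ ℚ.* ∣ y ∣  ≤⟨ ℚ.*-monoˡ-≤-nonNeg ∣ x ∣ {{ℚ.nonNegative (ℚ.0≤∣p∣ x)}} hy ⟩
      ∣ x ∣ ℚ.* B      <⟨ ℚ.*-monoˡ-<-pos B {{ℚ.positive B>0}} hx ⟩
      η ℚ.* B          ≡⟨ e ⟩
      ½ ℚ.* ε          ∎
      where open ℚ.≤-Reasoning

    quotient : ∀ {ε B} → 0ℚ ℚ.< ε → 0ℚ ℚ.< B → ∃[ η ] 0ℚ ℚ.< η × η ℚ.* B ≡ ½ ℚ.* ε
    quotient {ε} {B} ε>0 B>0 = (½ ℚ.* ε) ℚ.* r , pos , eq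
      where
      instance
        B-pos : ℚ.Positive B
        B-pos = ℚ.positive B>0
        B-nz : ℚ.NonZero B
        B-nz = ℚ.pos⇒nonZero B
      r : ℚ
      r = ℚ.1/ B
      pos : 0ℚ ℚ.< (½ ℚ.* ε) ℚ.* r
      pos = subst (ℚ._< (½ ℚ.* ε) ℚ.* r) (ℚ.*-zeroˡ r) (ℚ.*-monoˡ-<-pos r {{ℚ.1/pos⇒pos B}} (half ε>0))
      eq : (½ ℚ.* ε) ℚ.* r ℚ.* B ≡ ½ ℚ.* ε
      eq = trans (ℚ.*-assoc (½ ℚ.* ε) r B) (trans (cong ((½ ℚ.* ε) ℚ.*_) (ℚ.*-inverseˡ B)) (ℚ.*-identityʳ (½ ℚ.* ε)))

    Cauchy-const : ∀ q → Cauchy (λ _ → q)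
    Cauchy-const q ε ε>0 = 0 , λ _ _ _ _ → subst (ℚ._< ε) (sym (cong ∣_∣ (ℚ.+-inverseʳ q))) ε>0

    Cauchy-+ : ∀ a b → Cauchy a → Cauchy b → Cauchy (λ n → a n ℚ.+ b n)
    Cauchy-+ a b ca cb ε ε>0 with both a b ca cb (half ε>0) (half ε>0)
    ... | N , h = N , λ m n i j →
      subst (λ z → ∣ z ∣ ℚ.< ε) (+-lemma (a m) (b m) (a n) (b n))
            (split (a m ℚ.- a n) (b m ℚ.- b n) (proj₁ (h m n i j)) (proj₂ (h m n i j)))

    Cauchy-neg : ∀ a → Cauchy a → Cauchy (λ n → ℚ.- a n)
    Cauchy-neg a ca ε ε>0 with ca ε ε>0
    ... | N , h = N , λ m n i j →
      subst (ℚ._< ε) (trans (sym (ℚ.∣-p∣≡∣p∣ (a m ℚ.- a n))) (cong ∣_∣ (neg-lemma (a m) (a n)))) (h m n i j)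

    product-close : ∀ a b c d {ε A B α β} → 0ℚ ℚ.< A → 0ℚ ℚ.< B → α ℚ.* A ≡ ½ ℚ.* ε → β ℚ.* B ≡ ½ ℚ.* ε →
                    ∣ c ∣ ℚ.≤ A → ∣ b ∣ ℚ.≤ B → ∣ a ℚ.- c ∣ ℚ.< β → ∣ b ℚ.- d ∣ ℚ.< α →
                    ∣ a ℚ.* b ℚ.- c ℚ.* d ∣ ℚ.< ε
    product-close a b c d {ε} A>0 B>0 eα eβ c≤A b≤B h₁ h₂ =
      subst (λ z → ∣ z ∣ ℚ.< ε) (*-lemma a b c d)
        (split ((a ℚ.- c) ℚ.* b) (c ℚ.* (b ℚ.- d))
          (scale (a ℚ.- c) b {ε = ε} eβ B>0 h₁ b≤B)
          (subst (λ z → ∣ z ∣ ℚ.< ½ ℚ.* ε) (ℚ.*-comm (b ℚ.- d) c)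
            (scale (b ℚ.- d) c {ε = ε} eα A>0 h₂ c≤A)))

    Cauchy-* : ∀ a b → Cauchy a → Cauchy b → Cauchy (λ n → a n ℚ.* b n)
    Cauchy-* a b ca cb ε ε>0 =
      let A , A>0 , M , ha = bounded a ca
          B , B>0 , N , hb = bounded b cb
          α , α>0 , eα     = quotient ε>0 A>0
          β , β>0 , eβ     = quotient ε>0 B>0
          K , h            = both a b ca cb β>0 α>0
      in (M ℕ.⊔ N) ℕ.⊔ K , λ m n i j →
      let h₁ , h₂ = h m n (N⊔ʳ {M ℕ.⊔ N} i) (N⊔ʳ {M ℕ.⊔ N} j)
      in product-close (a m) (b m) (a n) (b n) {ε} {A} {B} {α} {β} A>0 B>0 eα eβ
           (ha n (N⊔ˡ {M} {N} (N⊔ˡ {_} {K} j))) (hb m (N⊔ʳ {M} {N} (N⊔ˡ {_} {K} i))) h₁ h₂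

    Cauchy-⊔ : ∀ a b → Cauchy a → Cauchy b → Cauchy (λ n → a n ℚ.⊔ b n)
    Cauchy-⊔ a b ca cb ε ε>0 with both a b ca cb ε>0 ε>0
    ... | N , h = N , λ m n i j →
      let h₁ , h₂ = h m n i j in
      close (a m ℚ.⊔ b m) (a n ℚ.⊔ b n)
        (⊔-below (a m) (b m) (a n) (b n) {ε} (below (a m) (a n) h₁) (below (b m) (b n) h₂))
        (⊔-below (a n) (b n) (a m) (b m) {ε}
          (below (a n) (a m) (sym-dist (a m) (a n) h₁)) (below (b n) (b m) (sym-dist (b m) (b n) h₂)))

  record ℝ : Set where
    constructor mkℝ
    field
      seq    : ℕ → ℚ
      cauchy : Cauchy seq

  open ℝ public

  infixl 6 _+ᴿ_ _-ᴿ_ _⊔ᴿ_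
  infixl 7 _*ᴿ_
  infix  8 -ᴿ_
  infixr 8 _^ᴿ_
  infix  4 _<ᴿ_ _≤ᴿ_ _≈_ _⟶_

  fromℚ : ℚ → ℝ
  fromℚ q = mkℝ (λ _ → q) (Cauchy-const q)

  0ᴿ 1ᴿ -1ᴿ : ℝ
  0ᴿ  = fromℚ 0ℚ
  1ᴿ  = fromℚ 1ℚ
  -1ᴿ = fromℚ (ℚ.- 1ℚ)

  _+ᴿ_ _*ᴿ_ _⊔ᴿ_ : ℝ → ℝ → ℝ
  mkℝ a ca +ᴿ mkℝ b cb = mkℝ (λ n → a n ℚ.+ b n) (Cauchy-+ a b ca cb)
  mkℝ a ca *ᴿ mkℝ b cb = mkℝ (λ n → a n ℚ.* b n) (Cauchy-* a b ca cb)
  mkℝ a ca ⊔ᴿ mkℝ b cb = mkℝ (λ n → a n ℚ.⊔ b n) (Cauchy-⊔ a b ca cb)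

  -ᴿ_ : ℝ → ℝ
  -ᴿ mkℝ a ca = mkℝ (λ n → ℚ.- a n) (Cauchy-neg a ca)

  _-ᴿ_ : ℝ → ℝ → ℝ
  x -ᴿ y = x +ᴿ (-ᴿ y)

  ∣_∣ᴿ : ℝ → ℝ
  ∣ x ∣ᴿ = x ⊔ᴿ (-ᴿ x)

  _^ᴿ_ : ℝ → ℕ → ℝ
  x ^ᴿ zero  = 1ᴿ
  x ^ᴿ suc n = x *ᴿ (x ^ᴿ n)

  _<ᴿ_ _≤ᴿ_ _≈_ : ℝ → ℝ → Set
  x <ᴿ y = ∃[ ε ] 0ℚ ℚ.< ε × ∃[ N ] ∀ n → N ≤ n → seq x n ℚ.+ ε ℚ.≤ seq y n
  x ≤ᴿ y = ∀ ε → 0ℚ ℚ.< ε → ∃[ N ] ∀ n → N ≤ n → seq x n ℚ.≤ seq y n ℚ.+ ε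
  x ≈  y = ∀ ε → 0ℚ ℚ.< ε → ∃[ N ] ∀ n → N ≤ n → ∣ seq x n ℚ.- seq y n ∣ ℚ.< ε

  _⟶_ : (ℕ → ℝ) → ℝ → Set
  xs ⟶ x = ∀ ε → 0ℚ ℚ.< ε → ∃[ N ] ∀ n → N ≤ n → ∣ xs n -ᴿ x ∣ᴿ <ᴿ fromℚ ε

  -- w = bʳ for a natural number b ≥ 1 and a real r ≥ 0.
  RealPower : ℕ → ℝ → ℝ → Set
  RealPower b r w = 0ᴿ ≤ᴿ w × (∀ p q → let r′ = fromℚ ((+ p) ℚ./ suc q); bᵖ = fromℚ (fromℕℚ (b ℕ.^ p)) in
    (r′ ≤ᴿ r → bᵖ ≤ᴿ w ^ᴿ suc q) × (r ≤ᴿ r′ → w ^ᴿ suc q ≤ᴿ bᵖ))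

open Real

record I : Set where
  constructor mkI
  field
    val : ℝ
    -1≤ : -1ᴿ ≤ᴿ val
    ≤1  : val ≤ᴿ 1ᴿ

open I public

record C : Set where
  field
    fun        : I → ℝ
    continuous : ∀ x ε → 0ℚ ℚ.< ε → ∃[ δ ] 0ℚ ℚ.< δ ×
                 (∀ y → ∣ val x -ᴿ val y ∣ᴿ <ᴿ fromℚ δ → ∣ fun x -ᴿ fun y ∣ᴿ <ᴿ fromℚ ε)

open C public

infix 4 _≈C_
_≈C_ : C → C → Set
f ≈C g = ∀ x → fun f x ≈ fun g x

-- d(f,g) < ε for the sup metric: some r < ε is an upper bound of |f - g|.
Dist<_ : ℚ → C → C → Set
(Dist< ε) f g = ∃[ r ] r ℚ.< ε × (∀ x → ∣ fun f x -ᴿ fun g x ∣ᴿ ≤ᴿ fromℚ r)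

IsDerivative : C → C → Set
IsDerivative f f′ = ∀ x ε → 0ℚ ℚ.< ε → ∃[ δ ] 0ℚ ℚ.< δ ×
  (∀ y → ∣ val y -ᴿ val x ∣ᴿ <ᴿ fromℚ δ →
    ∣ (fun f y -ᴿ fun f x) -ᴿ fun f′ x *ᴿ (val y -ᴿ val x) ∣ᴿ ≤ᴿ fromℚ ε *ᴿ ∣ val y -ᴿ val x ∣ᴿ)

-- w = n^(γn), with 0^0 = 1.
GevreyGrowth : ℝ → ℕ → ℝ → Set
GevreyGrowth γ zero      w = w ≈ 1ᴿ
GevreyGrowth γ n@(suc _) w = RealPower n (γ *ᴿ fromℚ (fromℕℚ n)) w

record Gevrey (f : C) : Set where
  field
    D        : ℕ → C
    D-zero   : D 0 ≈C f
    D-suc    : ∀ n → IsDerivative (D n) (D (suc n))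
    B ℓ γ    : ℝ
    B>0      : 0ᴿ <ᴿ B
    ℓ>0      : 0ᴿ <ᴿ ℓ
    γ>0      : 0ᴿ <ᴿ γ
    growth   : ℕ → ℝ
    isGrowth : ∀ n → GevreyGrowth γ n (growth n)
    bound    : ∀ n x → ∣ fun (D n) x ∣ᴿ ≤ᴿ B *ᴿ (ℓ ^ᴿ n) *ᴿ growth n

-- Tagged partitions of [a,b].
data Partition : ℝ → ℝ → Set where
  done : ∀ {a b} → a ≈ b → Partition a b
  step : ∀ {a b} (tag : I) (p : ℝ) → a ≤ᴿ val tag → val tag ≤ᴿ p → Partition p b → Partition a b

Mesh< : ∀ {a b} → ℚ → Partition a b → Set
Mesh< δ (done _)               = ⊤
Mesh< δ (step {a} _ p _ _ rest) = (p -ᴿ a) <ᴿ fromℚ δ × Mesh< δ rest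

riemannSum : (I → ℝ) → ∀ {a b} → Partition a b → ℝ
riemannSum f (done _)                 = 0ᴿ
riemannSum f (step {a} tag p _ _ rest) = f tag *ᴿ (p -ᴿ a) +ᴿ riemannSum f rest

IsRiemannIntegral : (I → ℝ) → ℝ → ℝ → ℝ → Set
IsRiemannIntegral f a b v = ∀ ε → 0ℚ ℚ.< ε → ∃[ δ ] 0ℚ ℚ.< δ ×
  (∀ (π : Partition a b) → Mesh< δ π → ∣ riemannSum f π -ᴿ v ∣ᴿ <ᴿ fromℚ ε)

Str : Set
Str = List Bool

zeros : ℕ → Str
zeros n = replicate n false

record 𝓜 : Set where
  constructor mk𝓜
  field
    fn   : Str → Str
    mono : ∀ u v → length u ≤ length v → length (fn u) ≤ length (fn v)

open 𝓜 public

size : 𝓜 → ℕ → ℕ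
size φ n = length (fn φ (zeros n))

data Poly₂ : Set where
  𝟙 𝕏     : Poly₂
  _⊕_ _⊛_ : Poly₂ → Poly₂ → Poly₂
  Φ       : Poly₂ → Poly₂

⟦_⟧₂ : Poly₂ → (ℕ → ℕ) → ℕ → ℕ
⟦ 𝟙 ⟧₂     f n = 1
⟦ 𝕏 ⟧₂     f n = n
⟦ P ⊕ Q ⟧₂ f n = ⟦ P ⟧₂ f n + ⟦ Q ⟧₂ f n
⟦ P ⊛ Q ⟧₂ f n = ⟦ P ⟧₂ f n * ⟦ Q ⟧₂ f n
⟦ Φ P ⟧₂   f n = f (⟦ P ⟧₂ f n)

-- p u v k: on input u, the computation p halts with output v after k steps.
Process : Set₁
Process = Str → Str → ℕ → Set

-- An oracle that answers at once; the query step itself is charged by Exec.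
oracle : (Str → Str) → Process
oracle φ u v k = v ≡ φ u × k ≡ 0

-- Multi-tape oracle machines.  Tape 0 holds the input, tape 1 the output,
-- tape 2 the query and tape 3 the answer; there may be further work tapes.

Sym : Set
Sym = Maybe Bool

data Dir : Set where
  left stay right : Dir

-- The cells strictly left of the head (nearest first), and the cells from the head on;
-- all other cells are blank.
Tape : Set
Tape = List Sym × List Sym

load : Str → Tape
load u = [] , map just u

scan : Tape → Sym
scan (_ , [])    = nothing
scan (_ , s ∷ _) = s

write : Sym → Tape → Tape
write s (ls , [])     = ls , s ∷ []
write s (ls , _ ∷ rs) = ls , s ∷ rs

move : Dir → Tape → Tape
move stay  t            = t
move left  ([] , rs)     = [] , nothing ∷ rs
move left  (l ∷ ls , rs) = ls , l ∷ rs
move right (ls , [])     = nothing ∷ ls , []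
move right (ls , r ∷ rs) = r ∷ ls , rs

-- The string that starts at the head and ends before the first blank.
contents : Tape → Str
contents (_ , rs) = go rs
  where
  go : List Sym → Str
  go (just b ∷ ss) = b ∷ go ss
  go _             = []

data Instr (states tapes : ℕ) : Set where
  halt : Instr states tapes
  ask  : Fin states → Instr states tapes
  next : Fin states → Vec (Sym × Dir) tapes → Instr states tapes

record OTM : Set where
  field
    states work : ℕ
    start       : Fin states
    δ           : Fin states → Vec Sym (4 + work) → Instr states (4 + work)

module _ (M : OTM) (O : Process) where
  open OTM M

  act : Sym × Dir → Tape → Tape
  act (s , d) t = move d (write s t)

  -- A query is charged one step plus the cost of producing the answer.
  data Exec (q : Fin states) (ts : Vec Tape (4 + work)) : Str → ℕ → Set where
    halts : δ q (Vec.map scan ts) ≡ halt → Exec q ts (contents (Vec.lookup ts 1F)) 0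
    nexts : ∀ {q′ as v k} → δ q (Vec.map scan ts) ≡ next q′ as →
            Exec q′ (Vec.zipWith act as ts) v k → Exec q ts v (suc k)
    asks  : ∀ {q′ a j v k} → δ q (Vec.map scan ts) ≡ ask q′ →
            O (contents (Vec.lookup ts 2F)) a j →
            Exec q′ (ts [ 3F ]≔ load a) v k → Exec q ts v (suc (j + k))

  Run : Process
  Run u = Exec start (Vec.replicate (4 + work) (load []) [ 0F ]≔ load u)

Computes : OTM → (Str → Str) → (Str → Str) → Set
Computes M φ ψ = ∀ u → ∃[ k ] Run M (oracle φ) u (ψ u) k

PolyTimeComputes : OTM → Poly₂ → 𝓜 → (Str → Str) → Set
PolyTimeComputes M P φ ψ = ∀ u → ∃[ k ] Run M (oracle (fn φ)) u (ψ u) k × k ≤ ⟦ P ⟧₂ (size φ) (length u)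

-- The oracle given to machines that need none.
ε-oracle : 𝓜
ε-oracle = mk𝓜 (λ _ → []) λ _ _ _ → ℕ.z≤n

record Partial𝓜 : Set₁ where
  field
    Dom   : 𝓜 → Set
    apply : ∀ φ → .(Dom φ) → 𝓜

open Partial𝓜 public

ComputesPartial : OTM → Partial𝓜 → Set
ComputesPartial M F = ∀ φ (d : Dom F φ) → Computes M (fn φ) (fn (apply F φ d))

PolyTime : Partial𝓜 → Set
PolyTime F = ∃₂ λ M P → ∀ φ (d : Dom F φ) → PolyTimeComputes M P φ (fn (apply F φ d))

Representation : Set → Set₁
Representation A = 𝓜 → A → Set

infix 3 _⇉_
record _⇉_ (A B : Set) : Set₁ where
  field
    dom : A → Set
    rel : A → B → Set

open _⇉_ public

IsRealiser : ∀ {A B} → Representation A → Representation B → (A ⇉ B) → Partial𝓜 → Set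
IsRealiser δA δB f F = ∀ φ x → δA φ x → dom f x →
  Σ[ d ∈ Dom F φ ] ∃[ y ] δB (apply F φ d) y × rel f x y

-- Against the length 0 of ε-oracle, a second-order polynomial is an ordinary polynomial.
PolyTimeName : (Str → Str) → Set
PolyTimeName ψ = ∃₂ λ M P → PolyTimeComputes M P ε-oracle ψ

PolyTimePoint : ∀ {A} → Representation A → A → Set
PolyTimePoint δ x = ∃[ φ ] PolyTimeName (fn φ) × δ φ x

PolyTimeMap : ∀ {A B} → Representation A → Representation B → (A ⇉ B) → Set₁
PolyTimeMap δA δB f = ∃[ F ] PolyTime F × IsRealiser δA δB f F

-- A product representation answers a string by selecting a component i and a string u, and
-- pads the answer to the largest of the lengths |φⱼ|(m) over a list of pairs (j , m).
-- An address is nothing on strings that are too short; it has no component on strings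
-- whose prefix is not the code of one.
Address : Set → Set
Address J = Maybe (List (J × ℕ) × Maybe J × Str)

pack : ℕ → Maybe Str → Str
pack l nothing  = zeros (suc l)
pack l (just v) = v ++ true ∷ zeros (l ∸ length v)

unpack : Str → Str
unpack w = reverse (strip (reverse w))
  where
  strip : Str → Str
  strip []          = []
  strip (false ∷ v) = strip v
  strip (true ∷ v)  = v

maxLength : List Str → ℕ
maxLength = foldr (λ v l → length v ⊔ l) 0

bundle : ∀ {J} → (Str → Address J) → (J → Str → Str) → Str → Str
bundle address φs w with address w
... | nothing                = []
... | just (probes , mi , u) =
  pack (maxLength (map (λ (j , m) → φs j (zeros m)) probes)) (Maybe.map (λ i → φs i u) mi)

bit : Bool → ℕ
bit b = if b then 1 else 0

-- Codes of fixed length L, least significant bit first.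
encode : ℕ → ℕ → Str
encode zero    i = []
encode (suc L) i = odd i ∷ encode L ⌊ i /2⌋
  where
  odd : ℕ → Bool
  odd zero          = false
  odd (suc zero)    = true
  odd (suc (suc n)) = odd n

decode : Str → ℕ
decode []      = 0
decode (b ∷ w) = bit b + 2 * decode w

finite : ∀ n → Str → Address (Fin n)
finite n w with ⌈log₂ n ⌉ ℕ.≤? length w
... | no  _ = nothing
... | yes _ = just (map (_, length u) (allFin n) , component , u)
  where
  u = drop ⌈log₂ n ⌉ w
  component : Maybe (Fin n)
  component with decode (take ⌈log₂ n ⌉ w) ℕ.<? n
  ... | yes i<n = just (fromℕ< i<n)
  ... | no  _   = nothing

-- The j-th component is addressed by 0ʲ1u; the pairs (j , m) are those with j + 1 + m ≤ |w|.
countable : Str → Address ℕ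
countable []      = nothing
countable w@(_ ∷ _) = just (concatMap (λ d → applyUpTo (λ j → j , d ∸ j) (suc d)) (upTo (length w)) , go 0 w)
  where
  go : ℕ → Str → Maybe ℕ × Str
  go j []          = nothing , []
  go j (false ∷ v) = go (suc j) v
  go j (true ∷ u)  = just j , u

tuple : ∀ {n} → (Fin n → Str → Str) → Str → Str
tuple {n} = bundle (finite n)

sequence : (ℕ → Str → Str) → Str → Str
sequence = bundle countable

pair : ∀ {a} {A : Set a} → A → A → Fin 2 → A
pair a b 0F = a
pair a b 1F = b

-- Computing a bundle from computations of its components: the lengths for the padding
-- and the selected component are computed, the input read and the output written.

data Probe {J : Set} (ps : J → Process) : List (J × ℕ) → List Str → ℕ → Set where
  []  : Probe ps [] [] 0
  _∷_ : ∀ {j m js v vs k l} → ps j (zeros m) v k → Probe ps js vs l →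
        Probe ps ((j , m) ∷ js) (v ∷ vs) (k + l)

data Select {J : Set} (ps : J → Process) (u : Str) : Maybe J → Maybe Str → ℕ → Set where
  none : Select ps u nothing nothing 0
  some : ∀ {i v k} → ps i u v k → Select ps u (just i) (just v) k

data Bundle {J : Set} (address : Str → Address J) (ps : J → Process) (w : Str) : Str → ℕ → Set where
  short : address w ≡ nothing → Bundle address ps w [] (suc (length w))
  entry : ∀ {js mi u vs k mv l} → address w ≡ just (js , mi , u) →
          Probe ps js vs k → Select ps u mi mv l →
          let out = pack (maxLength vs) mv in
          Bundle address ps w out (suc (length w + (k + (l + length out))))

-- Access to the i-th component of an oracle ⟨φ₁,…,φₙ⟩.
projection : ∀ {n} → 𝓜 → Fin n → Process
projection {n} φ i u v k = let w = encode ⌈log₂ n ⌉ (toℕ i) ++ u in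
  v ≡ unpack (fn φ w) × k ≡ suc (length w + length (fn φ w))

-- The word s·1ᵏ·0·m denotes m/2ᵏ, with m in binary (leading zeros allowed), negated if s is 1.
dyadic : Str → ℚ
dyadic []      = 0ℚ
dyadic (s ∷ w) = if s then ℚ.- magnitude w else magnitude w
  where
  magnitude : Str → ℚ
  magnitude []          = 0ℚ
  magnitude (true ∷ w)  = ½ ℚ.* magnitude w
  magnitude (false ∷ m) = fromℕℚ (foldl (λ n b → bit b + 2 * n) 0 m)

block : Str → Str
block []      = false ∷ []
block (b ∷ u) = true ∷ b ∷ block u

⟨_,_⟩ : Str → Str → Str
⟨ u , v ⟩ = block u ++ v

-- Inverse of u₁,…,uₙ ↦ block u₁ ++ … ++ block uₙ; an unterminated last block is padding.
blocks : Str → List Str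
blocks = go []
  where
  go : Str → Str → List Str
  go acc []              = []
  go acc (false ∷ w)     = acc ∷ go [] w
  go acc (true ∷ [])     = []
  go acc (true ∷ b ∷ w)  = go (acc ∷ʳ b) w

dyadics : Str → List ℚ
dyadics w = map dyadic (blocks w)

ρ : Representation ℝ
ρ φ x = (∀ n m → ∣ q n ℚ.- q m ∣ ℚ.≤ 2^- n ℚ.+ 2^- m) × (λ n → fromℚ (q n)) ⟶ x
  where
  q : ℕ → ℚ
  q n = dyadic (fn φ (zeros n))

ρI : Representation I
ρI φ x = ρ φ (val x)

-- Numbers are given in unary.
ρℕ : Representation ℕ
ρℕ φ n = ∀ u → fn φ u ≡ zeros n

-- The Cauchy representation of a numbering, given by its graph.
CauchyRep : (Str → C → Set) → Representation C
CauchyRep ν φ f = ∀ u → ∃[ g ] ν (fn φ u) g × (Dist< (2^- length u)) g f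

horner : List ℚ → ℝ → ℝ
horner cs x = foldr (λ c y → fromℚ c +ᴿ x *ᴿ y) 0ᴿ cs

Poly : Representation C
Poly = CauchyRep λ w g → ∀ x → fun g x ≈ horner (dyadics w) (val x)

-- A list a₀, b₁, c₁, a₁, …, bₙ, cₙ, aₙ describes the function equal to bᵢ x + cᵢ on [aᵢ₋₁,aᵢ].
data Pieces (g : C) : ℚ → List ℚ → Set where
  end   : Pieces g 1ℚ []
  piece : ∀ {a a′ b c rest} → a ℚ.< a′ →
          (∀ x → fromℚ a ≤ᴿ val x → val x ≤ᴿ fromℚ a′ → fun g x ≈ fromℚ b *ᴿ val x +ᴿ fromℚ c) →
          Pieces g a′ rest → Pieces g a (b ∷ c ∷ a′ ∷ rest)

Describes : List ℚ → C → Set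
Describes qs g = ∃[ rest ] qs ≡ ℚ.- 1ℚ ∷ rest × Pieces g (ℚ.- 1ℚ) rest

-- Words that describe no continuous function denote zero.
PAff : Representation C
PAff = CauchyRep λ w g →
  Describes (dyadics w) g ⊎ (¬ (∃[ h ] Describes (dyadics w) h) × (∀ x → fun g x ≈ 0ᴿ))

Fun : Representation C
Fun φ f =
  (∀ u v x → val x ≈ fromℚ (dyadic u) →
    ∣ fromℚ (dyadic (fn φ ⟨ u , v ⟩)) -ᴿ fun f x ∣ᴿ ≤ᴿ fromℚ (2^- length v)) ×
  (∀ x y n → ∣ val x -ᴿ val y ∣ᴿ <ᴿ fromℚ (2^- size φ n) → ∣ fun f x -ᴿ fun f y ∣ᴿ <ᴿ fromℚ (2^- n))

infixr 5 _⊗_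
infix  6 _^ω

data Ty : Set where
  real nat cont : Ty
  _⊗_           : Ty → Ty → Ty
  _^ω           : Ty → Ty

-- Types built from the fixed spaces only.
data Fixed : Ty → Set where
  real : Fixed real
  nat  : Fixed nat
  _⊗_  : ∀ {X Y} → Fixed X → Fixed Y → Fixed (X ⊗ Y)
  _^ω  : ∀ {X} → Fixed X → Fixed (X ^ω)

⟦_⟧ : Ty → Set
⟦ real ⟧  = ℝ
⟦ nat ⟧   = ℕ
⟦ cont ⟧  = C
⟦ X ⊗ Y ⟧ = ⟦ X ⟧ × ⟦ Y ⟧
⟦ X ^ω ⟧  = ℕ → ⟦ X ⟧

Equal : ∀ X → ⟦ X ⟧ → ⟦ X ⟧ → Set
Equal real    x y               = x ≈ y
Equal nat     m n               = m ≡ n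
Equal cont    f g               = f ≈C g
Equal (X ⊗ Y) (x , y) (x′ , y′) = Equal X x x′ × Equal Y y y′
Equal (X ^ω)  xs ys             = ∀ n → Equal X (xs n) (ys n)

-- The representations of all types, given one of C([-1,1]).
names : Representation C → ∀ X → Representation ⟦ X ⟧
names δ real    = ρ
names δ nat     = ρℕ
names δ cont    = δ
names δ (X ⊗ Y) φ (x , y) = ∃₂ λ φ₁ φ₂ →
  names δ X φ₁ x × names δ Y φ₂ y × (∀ u → fn φ u ≡ tuple (pair (fn φ₁) (fn φ₂)) u)
names δ (X ^ω)  φ xs = Σ[ φs ∈ (ℕ → 𝓜) ]
  (∀ n → names δ X (φs n) (xs n)) × (∀ u → fn φ u ≡ sequence (λ n → fn (φs n)) u)

graph : (f : C) → I ⇉ ℝ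
graph f = record { dom = λ _ → ⊤ ; rel = λ x y → y ≈ fun f x }

data Const : Ty → Set₁ where
  number   : (x : ℝ) → PolyTimePoint ρ x → Const real
  function : (f : C) → PolyTimeMap ρI ρ (graph f) → Gevrey f → Const cont

value : ∀ {X} → Const X → ⟦ X ⟧
value (number x _)     = x
value (function f _ _) = f

-- A subset [-1,1] of the argument type is expressed by the domain of the operation.
data Op : Ty → Ty → Set where
  constant                  : Op real cont
  add multiply divide       : Op (cont ⊗ cont) cont
  negate root               : Op cont cont
  compose maximum           : Op (cont ⊗ cont) cont
  paramax primit            : Op cont cont
  join                      : Op (real ⊗ cont ⊗ cont) cont
  eval                      : Op (cont ⊗ real) real

InI : ℝ → Set
InI x = -1ᴿ ≤ᴿ x × x ≤ᴿ 1ᴿ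

toI : ∀ x → InI x → I
toI x (l , u) = mkI x l u

total : ∀ {A B : Set} → (A → B → Set) → A ⇉ B
total R = record { dom = λ _ → ⊤ ; rel = R }

⟦_⟧op : ∀ {X Y} → Op X Y → ⟦ X ⟧ ⇉ ⟦ Y ⟧
⟦ constant ⟧op = total λ x h → ∀ t → fun h t ≈ x
⟦ add ⟧op      = total λ (f , g) h → ∀ t → fun h t ≈ fun f t +ᴿ fun g t
⟦ multiply ⟧op = total λ (f , g) h → ∀ t → fun h t ≈ fun f t *ᴿ fun g t
⟦ negate ⟧op   = total λ f h → ∀ t → fun h t ≈ -ᴿ fun f t
⟦ divide ⟧op   = record
  { dom = λ (f , g) → ∀ x → 1ᴿ ≤ᴿ fun g x
  ; rel = λ (f , g) h → ∀ t → fun h t *ᴿ fun g t ≈ fun f t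
  }
⟦ root ⟧op     = total λ f h → ∀ t → 0ᴿ ≤ᴿ fun h t × fun h t *ᴿ fun h t ≈ ∣ fun f t ∣ᴿ
⟦ compose ⟧op  = record
  { dom = λ (f , g) → ∀ x → InI (fun g x)
  ; rel = λ (f , g) h → ∀ t (p : InI (fun g t)) → fun h t ≈ fun f (toI (fun g t) p)
  }
⟦ maximum ⟧op  = total λ (f , g) h → ∀ t → fun h t ≈ fun f t ⊔ᴿ fun g t
⟦ paramax ⟧op  = total λ f h → ∀ t →
  (∀ s → val s ≤ᴿ val t → fun f s ≤ᴿ fun h t) × (∃[ s ] val s ≤ᴿ val t × fun f s ≈ fun h t)
⟦ join ⟧op     = record
  { dom = λ (a , f , g) → Σ[ p ∈ InI a ] fun f (toI a p) ≈ fun g (toI a p)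
  ; rel = λ (a , f , g) h → ∀ x → (val x ≤ᴿ a → fun h x ≈ fun f x) × (a ≤ᴿ val x → fun h x ≈ fun g x)
  }
⟦ primit ⟧op   = total λ f h → ∀ t → IsRiemannIntegral (fun f) -1ᴿ (val t) (fun h t)
⟦ eval ⟧op     = record
  { dom = λ (f , x) → InI x
  ; rel = λ (f , x) y → ∀ (p : InI x) → y ≈ fun f (toI x p)
  }

-- Terms of type Y with free variables among those of a context Γ.
data Term (Γ : List Ty) : Ty → Set₁ where
  var   : ∀ {X} → X ∈ Γ → Term Γ X
  const : ∀ {X} → Const X → Term Γ X
  ⟪_,_⟫ : ∀ {X Y} → Term Γ X → Term Γ Y → Term Γ (X ⊗ Y)
  ƛ     : ∀ {X} → Term (nat ∷ Γ) X → Term Γ (X ^ω)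
  app   : ∀ {X Y} → Op X Y → Term Γ X → Term Γ Y

Values : List Ty → Set
Values = All ⟦_⟧

-- The partial multi-valued operation defined by a term: its values and its domain.

Value : ∀ {Γ Y} → Term Γ Y → Values Γ → ⟦ Y ⟧ → Set
Value {Y = Y} (var i)   vs y       = Equal Y y (lookup vs i)
Value {Y = Y} (const c) vs y       = Equal Y y (value c)
Value ⟪ s , t ⟫          vs (x , y) = Value s vs x × Value t vs y
Value (ƛ t)             vs xs      = ∀ n → Value t (n ∷ vs) (xs n)
Value (app o t)         vs y       = ∃[ x ] Value t vs x × rel ⟦ o ⟧op x y

Defined : ∀ {Γ Y} → Term Γ Y → Values Γ → Set
Defined (var _)   vs = ⊤
Defined (const _) vs = ⊤
Defined ⟪ s , t ⟫  vs = Defined s vs × Defined t vs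
Defined (ƛ t)     vs = ∀ n → Defined t (n ∷ vs)
Defined (app o t) vs = Defined t vs × (∀ x → Value t vs x → dom ⟦ o ⟧op x)

record Strategy (δ : Representation C) : Set₁ where
  field
    op-algorithm    : ∀ {X Y} → Op X Y → OTM
    op-realises     : ∀ {X Y} (o : Op X Y) → ∃[ F ] ComputesPartial (op-algorithm o) F ×
                      IsRealiser (names δ X) (names δ Y) ⟦ o ⟧op F
    const-algorithm : ∀ {X} → Const X → OTM
    const-names     : ∀ {X} (c : Const X) → ∃[ φ ]
                      Computes (const-algorithm c) (fn ε-oracle) (fn φ) × names δ X φ (value c)

module _ {δ : Representation C} (S : Strategy δ) where
  open Strategy S

  -- Each query of an algorithm to its argument is answered by running the computation
  -- of the argument, whose steps are charged to the computation of the whole term.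
  evaluate : ∀ {Γ Y} → Term Γ Y → (∀ {X} → X ∈ Γ → Process) → Process
  evaluate (var i)     env = env i
  evaluate (const c)   env = Run (const-algorithm c) (oracle (fn ε-oracle))
  evaluate ⟪ s , t ⟫    env = Bundle (finite 2) (pair (evaluate s env) (evaluate t env))
  evaluate {Γ} (ƛ t)   env = Bundle countable λ n → evaluate t (extend n)
    where
    extend : ℕ → ∀ {X} → X ∈ nat ∷ Γ → Process
    extend n (here _)  u v k = v ≡ zeros n × k ≡ suc n
    extend n (there i) = env i
  evaluate (app o t)   env = Run (op-algorithm o) (evaluate t env)

  evalₛ : ∀ {Γ Y} → Term Γ Y → 𝓜 → Process
  evalₛ t φ = evaluate t (λ i → projection φ (index i))

  NamesValues : ∀ {Γ} → 𝓜 → Values Γ → Set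
  NamesValues {Γ} φ vs = Σ[ φs ∈ (Fin (length Γ) → 𝓜) ]
    (∀ {X} (i : X ∈ Γ) → names δ X (φs (index i)) (lookup vs i)) ×
    (∀ u → fn φ u ≡ tuple (λ i → fn (φs i)) u)

  -- A term is semi-closed if the types of all its free variables are fixed.
  EvaluatesInPolynomialTime : Set₁
  EvaluatesInPolynomialTime = ∀ {Γ Y} (t : Term Γ Y) → All Fixed Γ → Fixed Y →
    ∃[ P ] ∀ φ vs → NamesValues φ vs → Defined t vs →
    ∀ u → ∃₂ λ v k → evalₛ t φ u v k × k ≤ ⟦ P ⟧₂ (size φ) (length u)

{-# OPTIONS --safe #-}

-- The terms have two real variables: b, which will be 2ᵏ and has a name of length about k,
-- and x.  From b one obtains the kink t ↦ max (b(t+1)) b and the parabola t ↦ (b(t+1))².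
--
-- A polynomial within distance 1 of the kink has degree exponential in k: sum the kink along
-- a grid with alternating signs and take N+2 differences, which annihilates polynomials of
-- degree at most N+1 and amplifies errors by at most 2^(N+2), whereas the second difference of
-- a kink is a spike, so that the alternating sum contributes 2^N.  A piecewise affine function
-- within distance 1 of the parabola has pieces of width at most 3/b.  Hence all answers of a
-- Poly or PAff name are too long to be read in time polynomial in k, even those of least
-- precision, and an evaluation that is polynomial in k gives the same result at x = 0 and x = 1.
--
-- For Fun, evaluate the running maximum of the kink at 0.  Few queries to the name of the
-- kink leave some interval of length about 1/b left of 0 unexamined, and there the kink can be
-- raised by a tent of slope b and height 16.  The name of the kink allows slope b, so
-- its answers can be changed to those of the raised function without changing any length.
module Submission where

-- The two test functions are complementary: the kink is piecewise affine with two pieces and the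
-- parabola is a polynomial of degree 2, so each is coded exactly by a short word in the other
-- Cauchy representation. Both rest on the line t ↦ b(t+1), taken as the primitive of a constant;
-- this is why an integral has to be evaluated. A strategy is specified through its behaviour on
-- oracles that answer at once, whereas in a term the answers are themselves computed. The bridge is
-- partial correctness: any answer that a computation gives is the right one. Halting of the whole
-- computation is supplied by the hypothesis of polynomial time. All evaluations are run on the
-- empty string. The result is then within 4 of the true value, so two situations that force the
-- same output contradict each other once their values lie more than 8 apart. The names of b and x
-- are constant functions, so the size of their pair is bounded independently of its argument and a
-- second-order polynomial in it grows like an ordinary polynomial in k.

open import Defs
open import Data.Bool.Base using (true; false)
open import Data.Empty using (⊥; ⊥-elim)
open import Data.Fin.Base using (Fin; toℕ)
open import Data.Fin.Patterns using (0F; 1F)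
import Data.Fin.Properties as Fin
open import Data.Integer.Base as ℤ using (ℤ)
import Data.Integer.Properties as ℤ
open import Data.List.Base as List using (List; []; _∷_; _∷ʳ_; _++_; length; map; foldr; foldl; replicate)
open import Data.List.Membership.Propositional using (_∈_)
import Data.List.Properties as List
open import Data.List.Relation.Unary.All as All using (All; []; _∷_)
import Data.List.Relation.Unary.All.Properties as All
open import Data.List.Relation.Unary.Any as Any using (Any; here; there; index)
import Data.List.Relation.Unary.Any.Properties as Any
open import Data.Maybe.Base as Maybe using (nothing; just)
open import Data.Nat.Base as ℕ using (ℕ; zero; suc; z≤n; s≤s)
open import Data.Nat.Logarithm using (⌈log₂_⌉)
import Data.Nat.Properties as ℕ
open import Data.Nat.Solver renaming (module +-*-Solver to ℕ-Solver)
open import Data.Product.Base using (Σ; Σ-syntax; ∃₂; ∃-syntax; _×_; _,_; proj₁; proj₂)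
open import Data.Rational.Base as ℚ hiding (truncate; floor; ceiling; round; NonZero)
open import Data.Rational.Properties
open import Data.Rational.Solver using (module +-*-Solver)
import Data.Rational.Unnormalised.Base as ℚᵘ
import Data.Rational.Unnormalised.Properties as ℚᵘ
open import Data.Sum.Base using (inj₁; inj₂; [_,_]′)
open import Data.Unit.Base using (tt)
open import Function.Base using (_∋_)
open import Relation.Binary.PropositionalEquality
open import Relation.Nullary.Decidable using (Dec; yes; no)
open import Relation.Nullary.Negation using (¬_)
open import Relation.Unary using (Decidable)
open +-*-Solver using (solve; _:+_; _:-_; _:*_; :-_; _:=_; con)
open ℕ-Solver using () renaming (solve to solveℕ; con to conℕ; _:+_ to _:+ℕ_; _:*_ to _:*ℕ_; _:=_ to _:=ℕ_)
open Real

-- Rational numbers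

-- p + b ≡ q + a says that b - a = q - p, so an inequality between linear combinations
-- of known quantities reduces to a ring identity.
≤-by : ∀ {a b p q} → p ≤ q → p + b ≡ q + a → a ≤ b
≤-by {a} {b} {p} {q} p≤q e = subst₂ _≤_ (cancel p a) (trans (cong ((- p) +_) (sym e)) (cancel p b))
    (+-monoʳ-≤ (- p) (+-monoˡ-≤ a p≤q))
  where
  cancel : ∀ x y → - x + (x + y) ≡ y
  cancel = solve 2 (λ x y → :- x :+ (x :+ y) := y) refl

<-by : ∀ {a b p q} → p < q → p + b ≡ q + a → a < b
<-by {a} {b} {p} {q} p<q e = subst₂ _<_ (cancel p a) (trans (cong ((- p) +_) (sym e)) (cancel p b))
    (+-monoʳ-< (- p) (+-monoˡ-< a p<q))
  where
  cancel : ∀ x y → - x + (x + y) ≡ y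
  cancel = solve 2 (λ x y → :- x :+ (x :+ y) := y) refl

p≤∣p∣ : ∀ p → p ≤ ∣ p ∣
p≤∣p∣ p with ≤-total 0ℚ p
... | inj₁ h = ≤-reflexive (sym (0≤p⇒∣p∣≡p h))
... | inj₂ h = ≤-trans h (0≤∣p∣ p)

-p≤∣p∣ : ∀ p → - p ≤ ∣ p ∣
-p≤∣p∣ p = subst (- p ≤_) (∣-p∣≡∣p∣ p) (p≤∣p∣ (- p))

∣∣≤ : ∀ {p r} → p ≤ r → - p ≤ r → ∣ p ∣ ≤ r
∣∣≤ {p} h k with ∣p∣≡p∨∣p∣≡-p p
... | inj₁ e = subst (_≤ _) (sym e) h
... | inj₂ e = subst (_≤ _) (sym e) k

-[p-q]≡q-p : ∀ p q → - (p - q) ≡ q - p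
-[p-q]≡q-p = solve 2 (λ p q → :- (p :- q) := q :- p) refl

∣p-q∣≡∣q-p∣ : ∀ p q → ∣ p - q ∣ ≡ ∣ q - p ∣
∣p-q∣≡∣q-p∣ p q = trans (sym (∣-p∣≡∣p∣ (p - q))) (cong ∣_∣ (-[p-q]≡q-p p q))

∣-∣-triangle : ∀ p q r → ∣ p - r ∣ ≤ ∣ p - q ∣ + ∣ q - r ∣
∣-∣-triangle p q r = subst (λ z → ∣ z ∣ ≤ ∣ p - q ∣ + ∣ q - r ∣) (mid p q r) (∣p+q∣≤∣p∣+∣q∣ (p - q) (q - r))
  where
  mid : ∀ p q r → (p - q) + (q - r) ≡ p - r
  mid = solve 3 (λ p q r → (p :- q) :+ (q :- r) := p :- r) refl

p⊔-p≡∣p∣ : ∀ p → p ⊔ (- p) ≡ ∣ p ∣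
p⊔-p≡∣p∣ p = ≤-antisym (⊔-lub (p≤∣p∣ p) (-p≤∣p∣ p)) (∣∣≤ (p≤p⊔q p (- p)) (p≤q⊔p p (- p)))

p≤q+∣p-q∣ : ∀ p q → p ≤ q + ∣ p - q ∣
p≤q+∣p-q∣ p q = ≤-by (p≤∣p∣ (p - q)) (lem p q ∣ p - q ∣)
  where
  lem : ∀ p q d → (p - q) + (q + d) ≡ d + p
  lem = solve 3 (λ p q d → (p :- q) :+ (q :+ d) := d :+ p) refl

∣-∣≤ : ∀ {p q r} → p ≤ q + r → q ≤ p + r → ∣ p - q ∣ ≤ r
∣-∣≤ {p} {q} {r} h k = ∣∣≤ (≤-by h (l₁ p q r)) (≤-by k (l₂ p q r))
  where
  l₁ : ∀ p q r → p + r ≡ (q + r) + (p - q)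
  l₁ = solve 3 (λ p q r → p :+ r := (q :+ r) :+ (p :- q)) refl
  l₂ : ∀ p q r → q + r ≡ (p + r) + - (p - q)
  l₂ = solve 3 (λ p q r → q :+ r := (p :+ r) :+ :- (p :- q)) refl

⊔-nonexpansive : ∀ a b c d {r} → ∣ a - c ∣ ≤ r → ∣ b - d ∣ ≤ r → ∣ (a ⊔ b) - (c ⊔ d) ∣ ≤ r
⊔-nonexpansive a b c d {r} h k = ∣-∣≤ (half a b c d h k)
  (half c d a b (subst (_≤ r) (∣p-q∣≡∣q-p∣ a c) h) (subst (_≤ r) (∣p-q∣≡∣q-p∣ b d) k))
  where
  half : ∀ a b c d → ∣ a - c ∣ ≤ r → ∣ b - d ∣ ≤ r → a ⊔ b ≤ (c ⊔ d) + r
  half a b c d h k = ⊔-lub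
    (≤-trans (p≤q+∣p-q∣ a c) (+-mono-≤ (p≤p⊔q c d) h))
    (≤-trans (p≤q+∣p-q∣ b d) (+-mono-≤ (p≤q⊔p c d) k))

≤-eps : ∀ {p q} → (∀ ε → 0ℚ < ε → p ≤ q + ε) → p ≤ q
≤-eps {p} {q} h = ≮⇒≥ λ q<p →
  let m , q<m , m<p = <-dense q<p
  in <-irrefl refl (<-≤-trans m<p (subst (p ≤_) (cancel q m) (h (m - q) (<-by q<m (shift q m)))))
  where
  cancel : ∀ q m → q + (m - q) ≡ m
  cancel = solve 2 (λ q m → q :+ (m :- q) := m) refl
  shift : ∀ q m → q + (m - q) ≡ m + 0ℚ
  shift = solve 2 (λ q m → q :+ (m :- q) := m :+ con 0ℚ) refl

half+half : ∀ ε → ½ * ε + ½ * ε ≡ ε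
half+half ε = trans (sym (*-distribʳ-+ ε ½ ½)) (*-identityˡ ε)

half-pos : ∀ {ε} → 0ℚ < ε → 0ℚ < ½ * ε
half-pos {ε} p = subst (_< ½ * ε) (*-zeroʳ ½) (*-monoʳ-<-pos ½ p)

fromℤ : ℤ → ℚ
fromℤ z = z / 1

toℚᵘ-fromℤ : ∀ z → toℚᵘ (fromℤ z) ℚᵘ.≃ ℚᵘ.mkℚᵘ z 0
toℚᵘ-fromℤ z = toℚᵘ-fromℚᵘ (ℚᵘ.mkℚᵘ z 0)

fromℤ-+ : ∀ y z → fromℤ y + fromℤ z ≡ fromℤ (y ℤ.+ z)
fromℤ-+ y z = toℚᵘ-injective (ℚᵘ.≃-trans (toℚᵘ-homo-+ (fromℤ y) (fromℤ z))
  (ℚᵘ.≃-trans (ℚᵘ.+-cong (toℚᵘ-fromℤ y) (toℚᵘ-fromℤ z))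
  (ℚᵘ.≃-trans (ℚᵘ.*≡* (cong (ℤ._* (ℤ.+ 1)) (cong₂ ℤ._+_ (ℤ.*-identityʳ y) (ℤ.*-identityʳ z))))
  (ℚᵘ.≃-sym (toℚᵘ-fromℤ (y ℤ.+ z))))))

fromℤ-* : ∀ y z → fromℤ y * fromℤ z ≡ fromℤ (y ℤ.* z)
fromℤ-* y z = toℚᵘ-injective (ℚᵘ.≃-trans (toℚᵘ-homo-* (fromℤ y) (fromℤ z))
  (ℚᵘ.≃-trans (ℚᵘ.*-cong (toℚᵘ-fromℤ y) (toℚᵘ-fromℤ z))
  (ℚᵘ.≃-trans (ℚᵘ.*≡* refl)
  (ℚᵘ.≃-sym (toℚᵘ-fromℤ (y ℤ.* z))))))

fromℤ-neg : ∀ z → - fromℤ z ≡ fromℤ (ℤ.- z)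
fromℤ-neg z = toℚᵘ-injective (ℚᵘ.≃-trans (toℚᵘ-homo‿- (fromℤ z))
  (ℚᵘ.≃-trans (ℚᵘ.-‿cong (toℚᵘ-fromℤ z)) (ℚᵘ.≃-sym (toℚᵘ-fromℤ (ℤ.- z)))))

fromℤ-≤ : ∀ {y z} → y ℤ.≤ z → fromℤ y ≤ fromℤ z
fromℤ-≤ {y} {z} h = toℚᵘ-cancel-≤ (ℚᵘ.≤-respˡ-≃ (ℚᵘ.≃-sym (toℚᵘ-fromℤ y)) (ℚᵘ.≤-respʳ-≃ (ℚᵘ.≃-sym (toℚᵘ-fromℤ z))
  (ℚᵘ.*≤* (subst₂ ℤ._≤_ (sym (ℤ.*-identityʳ y)) (sym (ℤ.*-identityʳ z)) h))))

fromℤ-< : ∀ {y z} → y ℤ.< z → fromℤ y < fromℤ z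
fromℤ-< {y} {z} h = toℚᵘ-cancel-< (ℚᵘ.<-respˡ-≃ (ℚᵘ.≃-sym (toℚᵘ-fromℤ y)) (ℚᵘ.<-respʳ-≃ (ℚᵘ.≃-sym (toℚᵘ-fromℤ z))
  (ℚᵘ.*<* (subst₂ ℤ._<_ (sym (ℤ.*-identityʳ y)) (sym (ℤ.*-identityʳ z)) h))))

fromℕℚ-+ : ∀ m n → fromℕℚ m + fromℕℚ n ≡ fromℕℚ (m ℕ.+ n)
fromℕℚ-+ m n = fromℤ-+ (ℤ.+ m) (ℤ.+ n)

fromℕℚ-* : ∀ m n → fromℕℚ m * fromℕℚ n ≡ fromℕℚ (m ℕ.* n)
fromℕℚ-* m n = trans (fromℤ-* (ℤ.+ m) (ℤ.+ n)) (cong fromℤ (sym (ℤ.pos-* m n)))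

fromℕℚ-≤ : ∀ {m n} → m ℕ.≤ n → fromℕℚ m ≤ fromℕℚ n
fromℕℚ-≤ h = fromℤ-≤ (ℤ.+≤+ h)

fromℕℚ-< : ∀ {m n} → m ℕ.< n → fromℕℚ m < fromℕℚ n
fromℕℚ-< h = fromℤ-< (ℤ.+<+ h)

fromℕℚ-suc : ∀ n → fromℕℚ (suc n) ≡ 1ℚ + fromℕℚ n
fromℕℚ-suc n = sym (fromℕℚ-+ 1 n)

fromℕℚ-cancel-≤ : ∀ {m n} → fromℕℚ m ≤ fromℕℚ n → m ℕ.≤ n
fromℕℚ-cancel-≤ {m} {n} h = ℕ.≮⇒≥ λ n<m → <-irrefl refl (<-≤-trans (fromℕℚ-< {n} {m} n<m) h)

0≤fromℕℚ : ∀ n → 0ℚ ≤ fromℕℚ n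
0≤fromℕℚ n = fromℕℚ-≤ {0} {n} z≤n

2^-pos : ∀ n → 0ℚ < 2^- n
2^-pos zero    = positive⁻¹ 1ℚ
2^-pos (suc n) = half-pos (2^-pos n)

2^n*2^-n : ∀ n → fromℕℚ (2 ℕ.^ n) * 2^- n ≡ 1ℚ
2^n*2^-n zero    = refl
2^n*2^-n (suc n) = trans (cong (_* (½ * 2^- n)) (sym (fromℕℚ-* 2 (2 ℕ.^ n))))
  (trans (swap (fromℕℚ (2 ℕ.^ n)) (2^- n)) (2^n*2^-n n))
  where
  swap : ∀ x y → (fromℕℚ 2 * x) * (½ * y) ≡ x * y
  swap = solve 2 (λ x y → (con (fromℕℚ 2) :* x) :* (con ½ :* y) := x :* y) refl

2^-≤1 : ∀ n → 2^- n ≤ 1ℚ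
2^-≤1 zero    = ≤-refl
2^-≤1 (suc n) = ≤-trans (≤-by (<⇒≤ (half-pos (2^-pos n))) (l (2^- n))) (2^-≤1 n)
  where
  l : ∀ p → 0ℚ + p ≡ ½ * p + ½ * p
  l p = trans (+-identityˡ p) (sym (half+half p))

-- Oracle machines and bundles

-- Partial correctness: nothing is said about halting or cost, so the notion passes through every
-- construction of processes without time bounds.
Sound : Process → (Str → Str) → Set
Sound p ψ = ∀ u v k → p u v k → v ≡ ψ u

-- Transitions are deterministic, so both runs apply the same rule at each configuration; at a
-- query, soundness forces the computed answer to be that of the oracle. The step counts may differ,
-- since answers are charged differently.
exec-unique : ∀ M {p ψ} → Sound p ψ → ∀ {q ts v v′ k k′} →
  Exec M p q ts v k → Exec M (oracle ψ) q ts v′ k′ → v ≡ v′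
exec-unique M s (halts e) (halts e′) = refl
exec-unique M s (nexts e r) (nexts e′ r′) with trans (sym e) e′
... | refl = exec-unique M s r r′
exec-unique M s (asks e o r) (asks e′ o′ r′) with trans (sym e) e′
exec-unique M s (asks {a = a} {j} e o r) (asks e′ (refl , _) r′) | refl with s _ a j o
... | refl = exec-unique M s r r′
exec-unique M s (halts e) (nexts e′ _) with () ← trans (sym e) e′
exec-unique M s (halts e) (asks e′ _ _) with () ← trans (sym e) e′
exec-unique M s (nexts e _) (halts e′) with () ← trans (sym e) e′
exec-unique M s (nexts e _) (asks e′ _ _) with () ← trans (sym e) e′
exec-unique M s (asks e _ _) (halts e′) with () ← trans (sym e) e′
exec-unique M s (asks e _ _) (nexts e′ _) with () ← trans (sym e) e′

-- The specification of an algorithm speaks of an oracle; comparison with that halting run fixes the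
-- output of every run whose queries are answered by a sound computation.
run-sound : ∀ M {p ψ ψ′} → Sound p ψ → Computes M ψ ψ′ → Sound (Run M p) ψ′
run-sound M s c u v k r = exec-unique M s r (proj₂ (c u))

-- The cost of each query is part of `k`, so every query falls under the hypothesis and was answered
-- by the empty string. The run can thus be repeated against an oracle that carries no information.
blind : ∀ M {p K} → (∀ w a j → p w a j → j ℕ.< K → a ≡ []) → ∀ {q ts v k} →
  Exec M p q ts v k → k ℕ.< K → ∃[ k′ ] Exec M (oracle (λ _ → [])) q ts v k′
blind M h (halts e) _ = _ , halts e
blind M h (nexts e r) lt = _ , nexts e (proj₂ (blind M h r (ℕ.<-trans (ℕ.n<1+n _) lt)))
blind M h (asks {a = a} {j} {k = k} e o r) lt =
  _ , asks e (h _ a j o (ℕ.≤-<-trans (ℕ.≤-trans (ℕ.m≤m+n j k) (ℕ.n≤1+n _)) lt) , refl)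
           (proj₂ (blind M h r (ℕ.≤-<-trans (ℕ.≤-trans (ℕ.m≤n+m k j) (ℕ.n≤1+n _)) lt)))

Agree : (Str → Str) → List Str → (Str → Str) → Set
Agree ψ Q ψ′ = All (λ w → ψ′ w ≡ ψ w) Q

-- p evaluates F at the oracle ψ, and each halting computation of k steps
-- depends on ψ only through its values at c + k strings.
Local : (Str → Str) → ℕ → Process → ((Str → Str) → Process) → Set
Local ψ c p F = ∀ u v k → p u v k →
  ∃[ Q ] length Q ℕ.≤ c ℕ.+ k × (∀ ψ′ → Agree ψ Q ψ′ → ∃[ k′ ] F ψ′ u v k′)

sound⇒local : ∀ {p ψ} → Sound p ψ → Local ψ 1 p oracle
sound⇒local s u v k r = u ∷ [] , s≤s z≤n , λ { ψ′ (e ∷ []) → 0 , trans (s u v k r) (sym e) , refl }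

unrelated-local : ∀ {p ψ} → Local ψ 0 p (λ _ → p)
unrelated-local u v k r = [] , z≤n , λ _ _ → k , r

-- A query whose answer costs `j` is charged `suc j` steps, exactly the allowance of a process that
-- is local with constant 1. This is why the constant drops to 0.
run-local : ∀ M {p ψ F} → Local ψ 1 p F → Local ψ 0 (Run M p) (λ ψ′ → Run M (F ψ′))
run-local M {p} {ψ} {F} loc u v k = go
  where
  go : ∀ {q ts k} → Exec M p q ts v k →
    ∃[ Q ] length Q ℕ.≤ k × (∀ ψ′ → Agree ψ Q ψ′ → ∃[ k′ ] Exec M (F ψ′) q ts v k′)
  go (halts e) = [] , z≤n , λ _ _ → _ , halts e
  go (nexts e r) with go r
  ... | Q , Q≤ , f = Q , ℕ.m≤n⇒m≤1+n Q≤ , λ ψ′ a → _ , nexts e (proj₂ (f ψ′ a))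
  go (asks {a = a} {j} e o r) with loc _ a j o | go r
  ... | Q , Q≤ , f | R , R≤ , g = Q ++ R ,
    subst (ℕ._≤ _) (sym (List.length-++ Q)) (ℕ.+-mono-≤ Q≤ R≤) ,
    λ ψ′ ag → _ , asks e (proj₂ (f ψ′ (All.++⁻ˡ Q ag))) (proj₂ (g ψ′ (All.++⁻ʳ Q ag)))

bundle-local : ∀ {J} (address : Str → Address J) {ps : J → Process} {ψ} {Fs : (Str → Str) → J → Process} →
  (∀ i → Local ψ 0 (ps i) (λ ψ′ → Fs ψ′ i)) → Local ψ 0 (Bundle address ps) (λ ψ′ → Bundle address (Fs ψ′))
bundle-local {J} address {ps} {ψ} {Fs} loc w = λ where
    _ _ (short e) → [] , z≤n , λ _ _ → _ , short e
    _ _ (entry {k = k} {l = l} e ps s) →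
      let Q , Q≤ , f = probes ps
          R , R≤ , g = select s
      in Q ++ R ,
         subst (ℕ._≤ _) (sym (List.length-++ Q)) (ℕ.≤-trans (ℕ.+-mono-≤ Q≤ (ℕ.≤-trans R≤ (ℕ.m≤m+n l _)))
           (ℕ.≤-trans (ℕ.m≤n+m _ (length w)) (ℕ.n≤1+n _))) ,
         λ ψ′ ag → _ , entry e (proj₂ (f ψ′ (All.++⁻ˡ Q ag))) (proj₂ (g ψ′ (All.++⁻ʳ Q ag)))
  where
  probes : ∀ {js vs k} → Probe ps js vs k →
    ∃[ Q ] length Q ℕ.≤ k × (∀ ψ′ → Agree ψ Q ψ′ → ∃[ k′ ] Probe (Fs ψ′) js vs k′)
  probes [] = [] , z≤n , λ _ _ → _ , []
  probes (_∷_ {j} {m} {v = v} {k = k} r rs) with loc j (zeros m) v k r | probes rs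
  ... | Q , Q≤ , f | R , R≤ , g = Q ++ R ,
    subst (ℕ._≤ _) (sym (List.length-++ Q)) (ℕ.+-mono-≤ Q≤ R≤) ,
    λ ψ′ ag → _ , proj₂ (f ψ′ (All.++⁻ˡ Q ag)) ∷ proj₂ (g ψ′ (All.++⁻ʳ Q ag))
  select : ∀ {u mi mv k} → Select ps u mi mv k →
    ∃[ Q ] length Q ℕ.≤ k × (∀ ψ′ → Agree ψ Q ψ′ → ∃[ k′ ] Select (Fs ψ′) u mi mv k′)
  select none = [] , z≤n , λ _ _ → _ , none
  select {u} (some {i} {v} {k} r) with loc i u v k r
  ... | Q , Q≤ , f = Q , Q≤ , λ ψ′ ag → _ , some (proj₂ (f ψ′ ag))

probe-sound : ∀ {J} {ps : J → Process} {φs : J → Str → Str} → (∀ i → Sound (ps i) (φs i)) → ∀ {js vs k} →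
  Probe ps js vs k → vs ≡ map (λ (j , m) → φs j (zeros m)) js
probe-sound s [] = refl
probe-sound s (_∷_ {j} {m} {v = v} {k = k} r rs) = cong₂ _∷_ (s j (zeros m) v k r) (probe-sound s rs)

select-sound : ∀ {J} {ps : J → Process} {φs : J → Str → Str} → (∀ i → Sound (ps i) (φs i)) → ∀ {u mi mv k} →
  Select ps u mi mv k → mv ≡ Maybe.map (λ i → φs i u) mi
select-sound s none = refl
select-sound s {u} (some {i} {v} {k} r) = cong just (s i u v k r)

bundle-sound : ∀ {J} (address : Str → Address J) {ps : J → Process} {φs : J → Str → Str} → (∀ i → Sound (ps i) (φs i)) →
  Sound (Bundle address ps) (bundle address φs)
bundle-sound address s w _ _ (short e) rewrite e = refl
bundle-sound address s w _ _ (entry e ps sel) rewrite e =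
  cong₂ (λ vs mv → pack (maxLength vs) mv) (probe-sound {φs = _} s ps) (select-sound s sel)

length-zeros : ∀ n → length (zeros n) ≡ n
length-zeros n = List.length-replicate n

pack-≥ : ∀ l mv → l ℕ.≤ length (pack l mv)
pack-≥ l nothing = subst (l ℕ.≤_) (sym (length-zeros (suc l))) (ℕ.n≤1+n l)
pack-≥ l (just v) = begin
  l                                               ≤⟨ ℕ.m≤n+m∸n l (length v) ⟩
  length v ℕ.+ (l ℕ.∸ length v)                   ≤⟨ ℕ.+-monoʳ-≤ (length v) (ℕ.n≤1+n _) ⟩
  length v ℕ.+ suc (l ℕ.∸ length v)               ≡⟨ cong (λ n → length v ℕ.+ suc n) (length-zeros _) ⟨
  length v ℕ.+ suc (length (zeros (l ℕ.∸ length v))) ≡⟨ List.length-++ v ⟨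
  length (pack l (just v)) ∎
  where open ℕ.≤-Reasoning

length-pack : ∀ l v → length v ℕ.≤ l → length (pack l (just v)) ≡ suc l
length-pack l v v≤l = begin
  length (pack l (just v)) ≡⟨ List.length-++ v ⟩
  length v ℕ.+ suc (length (zeros (l ℕ.∸ length v))) ≡⟨ cong (λ n → length v ℕ.+ suc n) (length-zeros _) ⟩
  length v ℕ.+ suc (l ℕ.∸ length v) ≡⟨ ℕ.+-suc (length v) _ ⟩
  suc (length v ℕ.+ (l ℕ.∸ length v)) ≡⟨ cong suc (ℕ.m+[n∸m]≡n v≤l) ⟩
  suc l ∎
  where open ≡-Reasoning

-- Any query other than the empty string makes the bundle compute φ (zeros m) for some m.
bundle-cost : ∀ {p q φ K} → Sound p φ → (∀ m → K ℕ.≤ length (φ (zeros m))) →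
  ∀ w a j → Bundle (finite 2) (pair p q) w a j → j ℕ.< K → a ≡ []
bundle-cost s big w _ _ (short e) j<K = refl
bundle-cost {p} {q} {φ} {K} s big w _ _ (entry {js} {mi} {u} {vs} {k} {mv} {l} e ps sel) j<K =
  ⊥-elim (ℕ.<-irrefl refl (ℕ.<-≤-trans j<K (ℕ.≤-trans (first (probed w e) ps) (ℕ.≤-trans (pack-≥ (maxLength vs) mv)
    (ℕ.≤-trans (ℕ.m≤n+m _ l) (ℕ.≤-trans (ℕ.m≤n+m _ k) (ℕ.≤-trans (ℕ.m≤n+m _ (length w)) (ℕ.n≤1+n _))))))))
  where
  probed : ∀ w {js mi u} → finite 2 w ≡ just (js , mi , u) → ∃₂ λ m js′ → js ≡ (0F , m) ∷ js′
  probed w e with ⌈log₂ 2 ⌉ ℕ.≤? length w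
  probed w refl | yes _ = _ , _ , refl
  first : ∀ {js vs k} → (∃₂ λ m js′ → js ≡ (0F , m) ∷ js′) → Probe (pair p q) js vs k → K ℕ.≤ maxLength vs
  first (m , _ , refl) (r ∷ _) with s _ _ _ r
  ... | refl = ℕ.≤-trans (big m) (ℕ.m≤m⊔n _ _)

unpack-pack : ∀ l v → l ≡ length v → unpack (pack l (just v)) ≡ v
unpack-pack _ v refl rewrite ℕ.n∸n≡0 (length v) | List.reverse-++ v (true ∷ []) = List.reverse-involutive v

fn-length : ∀ φ u → length (fn φ u) ≡ size φ (length u)
fn-length φ u = ℕ.≤-antisym (mono φ u (zeros (length u)) (ℕ.≤-reflexive (sym e)))
    (mono φ (zeros (length u)) u (ℕ.≤-reflexive e))
  where e = length-zeros (length u)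

size-mono : ∀ φ {m n} → m ℕ.≤ n → size φ m ℕ.≤ size φ n
size-mono φ {m} {n} m≤n = mono φ (zeros m) (zeros n) (subst₂ ℕ._≤_ (sym (length-zeros m)) (sym (length-zeros n)) m≤n)

tuple-length : ∀ φ ψ b u → length (tuple (pair (fn φ) (fn ψ)) (b ∷ u)) ≡ suc (size φ (length u) ℕ.⊔ size ψ (length u))
tuple-length φ ψ b u = go b
  where
  m = size φ (length u)
  n = size ψ (length u)
  l≡ : m ℕ.⊔ (n ℕ.⊔ 0) ≡ m ℕ.⊔ n
  l≡ = cong (m ℕ.⊔_) (ℕ.⊔-identityʳ n)
  go : ∀ b → length (tuple (pair (fn φ) (fn ψ)) (b ∷ u)) ≡ suc (m ℕ.⊔ n)
  go false = trans (length-pack (m ℕ.⊔ (n ℕ.⊔ 0)) (fn φ u)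
      (subst₂ ℕ._≤_ (sym (fn-length φ u)) (sym l≡) (ℕ.m≤m⊔n m n))) (cong suc l≡)
  go true  = trans (length-pack (m ℕ.⊔ (n ℕ.⊔ 0)) (fn ψ u)
      (subst₂ ℕ._≤_ (sym (fn-length ψ u)) (sym l≡) (ℕ.m≤n⊔m m n))) (cong suc l≡)

infixr 5 _⊗𝓜_
_⊗𝓜_ : 𝓜 → 𝓜 → 𝓜
φ ⊗𝓜 ψ = mk𝓜 (tuple (pair (fn φ) (fn ψ))) monotone
  where
  monotone : ∀ u v → length u ℕ.≤ length v →
    length (tuple (pair (fn φ) (fn ψ)) u) ℕ.≤ length (tuple (pair (fn φ) (fn ψ)) v)
  monotone [] v _ = z≤n
  monotone (b ∷ u) (c ∷ v) (s≤s h) = subst₂ ℕ._≤_ (sym (tuple-length φ ψ b u)) (sym (tuple-length φ ψ c v))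
    (s≤s (ℕ.⊔-mono-≤ (size-mono φ h) (size-mono ψ h)))

constant𝓜 : Str → 𝓜
constant𝓜 w = mk𝓜 (λ _ → w) λ _ _ _ → ℕ.≤-refl

constants-sound : ∀ v w → length v ≡ length w → (i : Fin 2) →
  Sound (projection {2} (constant𝓜 v ⊗𝓜 constant𝓜 w) i) (fn (pair (constant𝓜 v) (constant𝓜 w) i))
constants-sound v w e 0F u _ _ (refl , _) = unpack-pack _ v
  (trans (cong (length v ℕ.⊔_) (trans (ℕ.⊔-identityʳ (length w)) (sym e))) (ℕ.⊔-idem (length v)))
constants-sound v w e 1F u _ _ (refl , _) = unpack-pack _ w
  (trans (cong₂ ℕ._⊔_ e (ℕ.⊔-identityʳ (length w))) (ℕ.⊔-idem (length w)))

⊗𝓜-tuple : ∀ φ ψ u → fn (φ ⊗𝓜 ψ) u ≡ tuple (λ i → fn (pair φ ψ i)) u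
⊗𝓜-tuple φ ψ [] = refl
⊗𝓜-tuple φ ψ (false ∷ u) = refl
⊗𝓜-tuple φ ψ (true ∷ u) = refl

constants-size : ∀ v w → length v ≡ length w → ∀ n → size (constant𝓜 v ⊗𝓜 constant𝓜 w) n ℕ.≤ suc (length v)
constants-size v w e zero    = z≤n
constants-size v w e (suc n) = ℕ.≤-reflexive (trans (tuple-length (constant𝓜 v) (constant𝓜 w) false (zeros n))
  (cong suc (trans (cong (length v ℕ.⊔_) (sym e)) (ℕ.⊔-idem (length v)))))

-- Real numbers

Eventually : (ℕ → Set) → Set
Eventually P = ∃[ N ] ∀ n → N ℕ.≤ n → P n

always : ∀ {P : ℕ → Set} → (∀ n → P n) → Eventually P
always h = 0 , λ n _ → h n

ev-map : ∀ {P Q : ℕ → Set} → (∀ n → P n → Q n) → Eventually P → Eventually Q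
ev-map f (N , h) = N , λ n N≤n → f n (h n N≤n)

ev-zip : ∀ {P Q R : ℕ → Set} → (∀ n → P n → Q n → R n) → Eventually P → Eventually Q → Eventually R
ev-zip f (M , h) (N , k) = M ℕ.⊔ N , λ n l → f n (h n (ℕ.m⊔n≤o⇒m≤o M N l)) (k n (ℕ.m⊔n≤o⇒n≤o M N l))

ev-const : ∀ {A : Set} → Eventually (λ _ → A) → A
ev-const (N , h) = h N ℕ.≤-refl

≈-pointwise : ∀ x y → (∀ n → seq x n ≡ seq y n) → x ≈ y
≈-pointwise x y h ε ε>0 = always λ n →
    subst (_< ε) (sym (trans (cong (λ z → ∣ z - seq y n ∣) (h n)) (cong ∣_∣ (+-inverseʳ (seq y n))))) ε>0

≈-refl : ∀ x → x ≈ x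
≈-refl x = ≈-pointwise x x λ _ → refl

≈-sym : ∀ x y → x ≈ y → y ≈ x
≈-sym x y h ε ε>0 = ev-map (λ n → subst (_< ε) (∣p-q∣≡∣q-p∣ (seq x n) (seq y n))) (h ε ε>0)

≈-trans : ∀ x y z → x ≈ y → y ≈ z → x ≈ z
≈-trans x y z h k ε ε>0 = ev-zip (λ n a b → ≤-<-trans (∣-∣-triangle (seq x n) (seq y n) (seq z n))
    (subst (∣ seq x n - seq y n ∣ + ∣ seq y n - seq z n ∣ <_) (half+half ε) (+-mono-< a b)))
  (h (½ * ε) (half-pos ε>0)) (k (½ * ε) (half-pos ε>0))

≈-from-≤ : ∀ x y → (∀ ε → 0ℚ < ε → Eventually λ n → ∣ seq x n - seq y n ∣ ≤ ε) → x ≈ y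
≈-from-≤ x y h ε ε>0 = ev-map (λ n a → ≤-<-trans a half<) (h (½ * ε) (half-pos ε>0))
  where
  half< : ½ * ε < ε
  half< = <-by (half-pos ε>0) (trans (+-identityˡ ε) (sym (half+half ε)))

fromℚ-cong : ∀ {p q} → p ≡ q → fromℚ p ≈ fromℚ q
fromℚ-cong {p} refl = ≈-refl (fromℚ p)

+ᴿ-cong : ∀ x x′ y y′ → x ≈ x′ → y ≈ y′ → x +ᴿ y ≈ x′ +ᴿ y′
+ᴿ-cong x x′ y y′ h k ε ε>0 = ev-zip close (h (½ * ε) (half-pos ε>0)) (k (½ * ε) (half-pos ε>0))
  where
  regroup : ∀ a b c d → (a - c) + (b - d) ≡ (a + b) - (c + d)
  regroup = solve 4 (λ a b c d → (a :- c) :+ (b :- d) := (a :+ b) :- (c :+ d)) refl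
  close : ∀ n → ∣ seq x n - seq x′ n ∣ < ½ * ε → ∣ seq y n - seq y′ n ∣ < ½ * ε →
      ∣ (seq x n + seq y n) - (seq x′ n + seq y′ n) ∣ < ε
  close n a b = subst (λ z → ∣ z ∣ < ε) (regroup (seq x n) (seq y n) (seq x′ n) (seq y′ n))
    (≤-<-trans (∣p+q∣≤∣p∣+∣q∣ (seq x n - seq x′ n) (seq y n - seq y′ n))
      (subst (∣ seq x n - seq x′ n ∣ + ∣ seq y n - seq y′ n ∣ <_) (half+half ε) (+-mono-< a b)))

-ᴿ-cong : ∀ x x′ → x ≈ x′ → -ᴿ x ≈ -ᴿ x′
-ᴿ-cong x x′ h ε ε>0 = ev-map (λ n → subst (_< ε) (flip (seq x n) (seq x′ n))) (h ε ε>0)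
  where
  minus : ∀ a b → - (a - b) ≡ - a - - b
  minus = solve 2 (λ a b → :- (a :- b) := :- a :- :- b) refl
  flip : ∀ a b → ∣ a - b ∣ ≡ ∣ - a - - b ∣
  flip a b = trans (sym (∣-p∣≡∣p∣ (a - b))) (cong ∣_∣ (minus a b))

⊔ᴿ-cong : ∀ x x′ y y′ → x ≈ x′ → y ≈ y′ → x ⊔ᴿ y ≈ x′ ⊔ᴿ y′
⊔ᴿ-cong x x′ y y′ h k = ≈-from-≤ (x ⊔ᴿ y) (x′ ⊔ᴿ y′) λ ε ε>0 →
  ev-zip (λ n a b → ⊔-nonexpansive (seq x n) (seq y n) (seq x′ n) (seq y′ n) (<⇒≤ a) (<⇒≤ b)) (h ε ε>0) (k ε ε>0)

bounded : ∀ x → ∃[ B ] 0ℚ < B × Eventually λ n → ∣ seq x n ∣ ≤ B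
bounded x with cauchy x 1ℚ (positive⁻¹ 1ℚ)
... | N , h = 1ℚ + ∣ seq x N ∣ , +-mono-<-≤ (positive⁻¹ 1ℚ) (0≤∣p∣ (seq x N)) , N , λ n N≤n →
  ≤-trans (subst (λ z → ∣ z ∣ ≤ ∣ seq x n - seq x N ∣ + ∣ seq x N ∣) (back (seq x n) (seq x N))
      (∣p+q∣≤∣p∣+∣q∣ (seq x n - seq x N) (seq x N)))
    (+-monoˡ-≤ ∣ seq x N ∣ (<⇒≤ (h n N N≤n ℕ.≤-refl)))
  where
  back : ∀ p q → (p - q) + q ≡ p
  back = solve 2 (λ p q → (p :- q) :+ q := p) refl

*ᴿ-congʳ : ∀ x x′ y → x ≈ x′ → x *ᴿ y ≈ x′ *ᴿ y
*ᴿ-congʳ x x′ y h = ≈-from-≤ (x *ᴿ y) (x′ *ᴿ y) λ ε ε>0 →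
  let B , B>0 , bd = bounded y
      instance
        B-pos = positive B>0
        B-nz  = pos⇒nonZero B
      η   = ε * 1/ B
      η>0 = positive⁻¹ η {{pos*pos⇒pos ε {{positive ε>0}} (1/ B) {{1/pos⇒pos B}}}}
      η*B≡ε = trans (*-assoc ε (1/ B) B) (trans (cong (ε *_) (*-inverseˡ B)) (*-identityʳ ε))
  in ev-zip (λ n a b → subst₂ _≤_
          (sym (trans (cong ∣_∣ (factor (seq x n) (seq x′ n) (seq y n)))
          (∣p*q∣≡∣p∣*∣q∣ (seq x n - seq x′ n) (seq y n)))) η*B≡ε
       (≤-trans (*-monoˡ-≤-nonNeg ∣ seq x n - seq x′ n ∣ {{∣-∣-nonNeg (seq x n - seq x′ n)}} b)
                (*-monoʳ-≤-nonNeg B {{pos⇒nonNeg B}} (<⇒≤ a))))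
       (h η η>0) bd
  where
  factor : ∀ a b c → a * c - b * c ≡ (a - b) * c
  factor = solve 3 (λ a b c → a :* c :- b :* c := (a :- b) :* c) refl

*ᴿ-cong : ∀ x x′ y y′ → x ≈ x′ → y ≈ y′ → x *ᴿ y ≈ x′ *ᴿ y′
*ᴿ-cong x x′ y y′ h k = ≈-trans (x *ᴿ y) (x′ *ᴿ y) (x′ *ᴿ y′) (*ᴿ-congʳ x x′ y h)
  (≈-trans (x′ *ᴿ y) (y *ᴿ x′) (x′ *ᴿ y′) (≈-pointwise (x′ *ᴿ y) (y *ᴿ x′) λ n → *-comm (seq x′ n) (seq y n))
  (≈-trans (y *ᴿ x′) (y′ *ᴿ x′) (x′ *ᴿ y′) (*ᴿ-congʳ y y′ x′ k)
      (≈-pointwise (y′ *ᴿ x′) (x′ *ᴿ y′) λ n → *-comm (seq y′ n) (seq x′ n))))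

≤ᴿ-pointwise : ∀ x y → (∀ n → seq x n ≤ seq y n) → x ≤ᴿ y
≤ᴿ-pointwise x y h ε ε>0 = always λ n → ≤-trans (h n) (≤-by (<⇒≤ ε>0) (trans (+-identityˡ _) (+-comm (seq y n) ε)))

≤ᴿ-refl : ∀ x → x ≤ᴿ x
≤ᴿ-refl x = ≤ᴿ-pointwise x x λ _ → ≤-refl

≤ᴿ-trans : ∀ x y z → x ≤ᴿ y → y ≤ᴿ z → x ≤ᴿ z
≤ᴿ-trans x y z h k ε ε>0 = ev-zip (λ n a b → ≤-trans a (≤-trans (+-monoˡ-≤ (½ * ε) b) (≤-reflexive (join-halves n))))
  (h (½ * ε) (half-pos ε>0)) (k (½ * ε) (half-pos ε>0))
  where
  join-halves : ∀ n → seq z n + ½ * ε + ½ * ε ≡ seq z n + ε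
  join-halves n = trans (+-assoc (seq z n) (½ * ε) (½ * ε)) (cong (λ e → seq z n + e) (half+half ε))

≈⇒≤ᴿ : ∀ x y → x ≈ y → x ≤ᴿ y
≈⇒≤ᴿ x y h ε ε>0 = ev-map (λ n a → ≤-trans (p≤q+∣p-q∣ (seq x n) (seq y n)) (+-monoʳ-≤ (seq y n) (<⇒≤ a))) (h ε ε>0)

fromℚ-mono : ∀ {p q} → p ≤ q → fromℚ p ≤ᴿ fromℚ q
fromℚ-mono {p} {q} h = ≤ᴿ-pointwise (fromℚ p) (fromℚ q) λ _ → h

fromℚ-reflects-≤ : ∀ {p q} → fromℚ p ≤ᴿ fromℚ q → p ≤ q
fromℚ-reflects-≤ h = ≤-eps λ ε ε>0 → ev-const (h ε ε>0)

⊔ᴿ-absorb : ∀ x y → y ≤ᴿ x → x ⊔ᴿ y ≈ x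
⊔ᴿ-absorb x y h = ≈-from-≤ (x ⊔ᴿ y) x λ ε ε>0 → ev-map (λ n a → ∣-∣≤
    (⊔-lub (≤-trans (≤-reflexive (sym (+-identityʳ (seq x n)))) (+-monoʳ-≤ (seq x n) (<⇒≤ ε>0))) a)
    (≤-trans (p≤p⊔q (seq x n) (seq y n))
        (≤-trans (≤-reflexive (sym (+-identityʳ _))) (+-monoʳ-≤ (seq x n ⊔ seq y n) (<⇒≤ ε>0))))) (h ε ε>0)

-ᴿ-antimono : ∀ x y → x ≤ᴿ y → -ᴿ y ≤ᴿ -ᴿ x
-ᴿ-antimono x y h ε ε>0 = ev-map (λ n a → ≤-by a (l (seq x n) (seq y n) ε)) (h ε ε>0)
  where
  l : ∀ a b e → a + (- a + e) ≡ (b + e) + - b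
  l = solve 3 (λ a b e → a :+ (:- a :+ e) := (b :+ e) :+ :- b) refl

rational : (q : ℚ) → - 1ℚ ≤ q → q ≤ 1ℚ → I
rational q h k = mkI (fromℚ q) (fromℚ-mono h) (fromℚ-mono k)

∣-∣ᴿ-rational : ∀ x y {p q r} → x ≈ fromℚ p → y ≈ fromℚ q → ∣ x -ᴿ y ∣ᴿ ≤ᴿ fromℚ r → ∣ p - q ∣ ≤ r
∣-∣ᴿ-rational x y {p} {q} {r} h k l = fromℚ-reflects-≤
    (≤ᴿ-trans (fromℚ ∣ p - q ∣) (∣ x -ᴿ y ∣ᴿ) (fromℚ r) (≈⇒≤ᴿ (fromℚ ∣ p - q ∣) (∣ x -ᴿ y ∣ᴿ)
    (≈-sym (∣ x -ᴿ y ∣ᴿ) (fromℚ ∣ p - q ∣) (≈-trans (∣ x -ᴿ y ∣ᴿ) (∣ fromℚ p -ᴿ fromℚ q ∣ᴿ) (fromℚ ∣ p - q ∣)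
      (⊔ᴿ-cong (x -ᴿ y) pq (-ᴿ (x -ᴿ y)) (-ᴿ pq) d (-ᴿ-cong (x -ᴿ y) pq d))
      (≈-pointwise (∣ fromℚ p -ᴿ fromℚ q ∣ᴿ) (fromℚ ∣ p - q ∣) λ _ → p⊔-p≡∣p∣ (p - q))))) l)
  where
  pq = fromℚ p -ᴿ fromℚ q
  d : x -ᴿ y ≈ pq
  d = +ᴿ-cong x (fromℚ p) (-ᴿ y) (-ᴿ fromℚ q) h (-ᴿ-cong y (fromℚ q) k)

-- The zeroth approximation is within `1 + 2^- N`, hence within 2, of the `N`-th, and that one is
-- within 1 of the limit. The lemmas that follow lose one more unit when `y` is compared with a
-- rational, which makes 4.
ρ-near : ∀ φ y → ρ φ y → Eventually λ n → ∣ dyadic (fn φ []) - seq y n ∣ ≤ fromℕℚ 3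
ρ-near φ y (fast , lim) with lim 1ℚ (positive⁻¹ 1ℚ)
... | N , h with h N ℕ.≤-refl
... | ε , ε>0 , ev = ev-map (λ n a → ≤-trans (∣-∣-triangle (q 0) (q N) (seq y n))
    (+-mono-≤ (≤-trans (fast 0 N) (+-monoʳ-≤ 1ℚ (2^-≤1 N))) (near n a))) ev
  where
  q : ℕ → ℚ
  q n = dyadic (fn φ (zeros n))
  near : ∀ n → (q N - seq y n) ⊔ (- (q N - seq y n)) + ε ≤ 1ℚ → ∣ q N - seq y n ∣ ≤ 1ℚ
  near n a = ≤-trans (≤-trans (≤-reflexive (sym (trans (+-identityʳ _) (p⊔-p≡∣p∣ (q N - seq y n)))))
    (+-monoʳ-≤ ((q N - seq y n) ⊔ (- (q N - seq y n))) (<⇒≤ ε>0))) a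

ρ-value : ∀ φ y {r} → ρ φ y → y ≈ fromℚ r → ∣ dyadic (fn φ []) - r ∣ ≤ fromℕℚ 4
ρ-value φ y {r} h k = ev-const (ev-zip (λ n a b → ≤-trans (∣-∣-triangle (dyadic (fn φ [])) (seq y n) r) (+-mono-≤ a (<⇒≤ b)))
  (ρ-near φ y h) (k 1ℚ (positive⁻¹ 1ℚ)))

ρ-lower : ∀ φ y {r} → ρ φ y → fromℚ r ≤ᴿ y → r ≤ dyadic (fn φ []) + fromℕℚ 4
ρ-lower φ y {r} h k = ev-const (ev-zip (λ n a b → ≤-trans b (≤-by (≤-trans (-p≤∣p∣ _) a) (l (dyadic (fn φ [])) (seq y n))))
  (ρ-near φ y h) (k 1ℚ (positive⁻¹ 1ℚ)))
  where
  l : ∀ d y → - (d - y) + (d + fromℕℚ 4) ≡ fromℕℚ 3 + (y + 1ℚ)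
  l = solve 2 (λ d y → :- (d :- y) :+ (d :+ con (fromℕℚ 4)) := con (fromℕℚ 3) :+ (y :+ con 1ℚ)) refl

ρ-constant : ∀ w → ρ (constant𝓜 w) (fromℚ (dyadic w))
ρ-constant w = (λ n m → ≤-trans (≤-reflexive (cong ∣_∣ (+-inverseʳ (dyadic w)))) (<⇒≤ (+-mono-< (2^-pos n) (2^-pos m)))) ,
  λ ε ε>0 → 0 , λ _ _ → ε , ε>0 , always λ _ → ≤-reflexive
    (trans (cong (λ z → z ⊔ (- z) + ε) (+-inverseʳ (dyadic w))) (+-identityˡ ε))

-- The integral of a constant

n<2^n : ∀ n → n ℕ.< 2 ℕ.^ n
n<2^n zero    = s≤s z≤n
n<2^n (suc n) = ℕ.≤-trans (ℕ.+-mono-≤ (ℕ.m^n>0 2 n) (n<2^n n)) (ℕ.≤-reflexive (cong (2 ℕ.^ n ℕ.+_) (sym (ℕ.+-identityʳ _))))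

-- A positive rational times its denominator is its numerator, a positive integer.
1≤den*pos : ∀ δ → 0ℚ < δ → 1ℚ ≤ fromℕℚ (↧ₙ δ) * δ
1≤den*pos δ@(mkℚ (ℤ.+ zero) _ _) δ>0 with () ← positive {δ} δ>0
1≤den*pos δ@(mkℚ (ℤ.-[1+ _ ]) _ _) δ>0 with () ← positive {δ} δ>0
1≤den*pos δ@(mkℚ (ℤ.+ suc n) d-1 _) δ>0 = subst (1ℚ ≤_) (sym den*δ) (fromℕℚ-≤ {1} {suc n} (s≤s z≤n))
  where
  den*δ : fromℕℚ (suc d-1) * δ ≡ fromℕℚ (suc n)
  den*δ = toℚᵘ-injective (ℚᵘ.≃-trans (toℚᵘ-homo-* (fromℕℚ (suc d-1)) δ)
    (ℚᵘ.≃-trans (ℚᵘ.*-congʳ (toℚᵘ-fromℤ (ℤ.+ suc d-1)))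
    (ℚᵘ.≃-trans (ℚᵘ.*≡* (trans (ℤ.*-identityʳ _)
        (trans (ℤ.*-comm (ℤ.+ suc d-1) (ℤ.+ suc n)) (cong (λ k → ℤ.+ suc n ℤ.* ℤ.+ suc k) (sym (ℕ.+-identityʳ d-1))))))
    (ℚᵘ.≃-sym (toℚᵘ-fromℤ (ℤ.+ suc n))))))

2^-archimedean : ∀ δ → 0ℚ < δ → ∃[ n ] 2^- n < δ
2^-archimedean δ δ>0 = n , ≰⇒> λ δ≤ → <-irrefl refl (≤-<-trans (1≤den*pos δ δ>0)
    (<-≤-trans (*-monoˡ-<-pos δ {{positive δ>0}} (fromℕℚ-< {n} {2 ℕ.^ n} (n<2^n n)))
      (≤-trans (*-monoˡ-≤-nonNeg (fromℕℚ (2 ℕ.^ n)) {{nonNegative (0≤fromℕℚ (2 ℕ.^ n))}} δ≤) (≤-reflexive (2^n*2^-n n)))))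
  where
  -- With `n` the denominator of δ, 2^n·δ > n·δ ≥ 1.
  n = ↧ₙ δ

riemannSum-constant : ∀ (f : I → ℝ) c → (∀ s → f s ≈ c) → ∀ {a b} (π : Partition a b) → riemannSum f π ≈ c *ᴿ (b -ᴿ a)
riemannSum-constant f c h (done {a} {b} a≈b) = ≈-sym (c *ᴿ (b -ᴿ a)) 0ᴿ
  (≈-trans (c *ᴿ (b -ᴿ a)) (c *ᴿ (b -ᴿ b)) 0ᴿ
    (*ᴿ-cong c c (b -ᴿ a) (b -ᴿ b) (≈-refl c) (+ᴿ-cong b b (-ᴿ a) (-ᴿ b) (≈-refl b) (-ᴿ-cong a b a≈b)))
    (≈-pointwise (c *ᴿ (b -ᴿ b)) 0ᴿ λ n → trans (cong (seq c n *_) (+-inverseʳ (seq b n))) (*-zeroʳ (seq c n))))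
riemannSum-constant f c h (step {a} {b} tag p _ _ π) =
  ≈-trans (f tag *ᴿ (p -ᴿ a) +ᴿ riemannSum f π) (c *ᴿ (p -ᴿ a) +ᴿ c *ᴿ (b -ᴿ p)) (c *ᴿ (b -ᴿ a))
    (+ᴿ-cong (f tag *ᴿ (p -ᴿ a)) (c *ᴿ (p -ᴿ a)) (riemannSum f π) (c *ᴿ (b -ᴿ p))
      (*ᴿ-congʳ (f tag) c (p -ᴿ a) (h tag)) (riemannSum-constant f c h π))
    (≈-pointwise (c *ᴿ (p -ᴿ a) +ᴿ c *ᴿ (b -ᴿ p)) (c *ᴿ (b -ᴿ a)) λ n → telescope (seq c n) (seq a n) (seq p n) (seq b n))
  where
  telescope : ∀ c a p b → c * (p - a) + c * (b - p) ≡ c * (b - a)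
  telescope = solve 4 (λ c a p b → c :* (p :- a) :+ c :* (b :- p) := c :* (b :- a)) refl

-- This is min(max(x, -1), 1), with the minimum expressed through negation. An element of `I`
-- satisfies its bounds only up to every positive tolerance, so single entries of its sequence may
-- leave the interval.
clamp : ℝ → ℝ
clamp x = -ᴿ ((-ᴿ (x ⊔ᴿ -1ᴿ)) ⊔ᴿ -1ᴿ)

clamp≤1 : ∀ x n → seq (clamp x) n ≤ 1ℚ
clamp≤1 x n = neg-antimono-≤ (p≤q⊔p (- (seq x n ⊔ - 1ℚ)) (- 1ℚ))

-1≤clamp : ∀ x n → - 1ℚ ≤ seq (clamp x) n
-1≤clamp x n = neg-antimono-≤ (⊔-lub (neg-antimono-≤ (p≤q⊔p (seq x n) (- 1ℚ))) (≤ᵇ⇒≤ tt))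

clamp≈ : ∀ t → clamp (val t) ≈ val t
clamp≈ t = ≈-trans (clamp x) (-ᴿ (-ᴿ x)) x
  (-ᴿ-cong (m ⊔ᴿ -1ᴿ) (-ᴿ x) (≈-trans (m ⊔ᴿ -1ᴿ) ((-ᴿ x) ⊔ᴿ -1ᴿ) (-ᴿ x)
    (⊔ᴿ-cong m (-ᴿ x) -1ᴿ -1ᴿ (-ᴿ-cong (x ⊔ᴿ -1ᴿ) x (⊔ᴿ-absorb x -1ᴿ (-1≤ t))) (≈-refl -1ᴿ))
    (⊔ᴿ-absorb (-ᴿ x) -1ᴿ (-ᴿ-antimono x 1ᴿ (≤1 t)))))
  (≈-pointwise (-ᴿ (-ᴿ x)) x λ n → neg-involutive (seq x n))
  where
  x = val t
  m = -ᴿ (x ⊔ᴿ -1ᴿ)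
  neg-involutive : ∀ p → - (- p) ≡ p
  neg-involutive = solve 1 (λ p → :- (:- p) := p) refl

-- All entries of clamp (val t) lie in [-1,1], so the inequalities between the points of
-- the partition hold entrywise.
module Uniform (t : I) (m : ℕ) where

  N : ℕ
  N = 2 ℕ.^ m

  width : ℝ
  width = clamp (val t) +ᴿ 1ᴿ

  0≤width : ∀ n → 0ℚ ≤ seq width n
  0≤width n = ≤-by (-1≤clamp (val t) n) (l (seq (clamp (val t)) n))
    where
    l : ∀ x → - 1ℚ + (x + 1ℚ) ≡ x + 0ℚ
    l = solve 1 (λ x → con (- 1ℚ) :+ (x :+ con 1ℚ) := x :+ con 0ℚ) refl

  width≤2 : ∀ n → seq width n ≤ 1ℚ + 1ℚ
  width≤2 n = +-monoˡ-≤ 1ℚ (clamp≤1 (val t) n)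

  frac : ℕ → ℚ
  frac i = fromℕℚ i * 2^- m

  0≤2^-m : NonNegative (2^- m)
  0≤2^-m = nonNegative (<⇒≤ (2^-pos m))

  frac-mono : ∀ {i j} → i ℕ.≤ j → frac i ≤ frac j
  frac-mono {i} {j} i≤j = *-monoʳ-≤-nonNeg (2^- m) {{0≤2^-m}} (fromℕℚ-≤ {i} {j} i≤j)

  point : ℕ → ℝ
  point i = -1ᴿ +ᴿ fromℚ (frac i) *ᴿ width

  point-mono : ∀ {i j} → i ℕ.≤ j → ∀ n → seq (point i) n ≤ seq (point j) n
  point-mono i≤j n = +-monoʳ-≤ (- 1ℚ) (*-monoʳ-≤-nonNeg (seq width n) {{nonNegative (0≤width n)}} (frac-mono i≤j))

  point-0 : ∀ n → seq (point 0) n ≡ - 1ℚ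
  point-0 n = trans (cong (λ z → - 1ℚ + z * seq width n) (*-zeroˡ (2^- m)))
    (trans (cong (λ z → - 1ℚ + z) (*-zeroˡ (seq width n))) (+-identityʳ (- 1ℚ)))

  point-N : ∀ n → seq (point N) n ≡ seq (clamp (val t)) n
  point-N n = trans (cong (λ z → - 1ℚ + z * seq width n) (2^n*2^-n m)) (l (seq (clamp (val t)) n))
    where
    l : ∀ x → - 1ℚ + 1ℚ * (x + 1ℚ) ≡ x
    l = solve 1 (λ x → con (- 1ℚ) :+ con 1ℚ :* (x :+ con 1ℚ) := x) refl

  tag : ∀ i → i ℕ.≤ N → I
  tag i i≤N = mkI (point i)
    (≤ᴿ-pointwise -1ᴿ (point i) λ n → subst (_≤ seq (point i) n) (point-0 n) (point-mono (z≤n {i}) n))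
    (≤ᴿ-pointwise (point i) 1ᴿ λ n → ≤-trans (point-mono i≤N n) (subst (_≤ 1ℚ) (sym (point-N n)) (clamp≤1 (val t) n)))

  from : ∀ j i → i ℕ.+ j ≡ N → Partition (point i) (val t)
  from zero i e = done (≈-trans (point i) (clamp (val t)) (val t)
    (≈-pointwise (point i) (clamp (val t)) λ n →
        trans (cong (λ k → seq (point k) n) (trans (sym (ℕ.+-identityʳ i)) e)) (point-N n)) (clamp≈ t))
  from (suc j) i e = step (tag i (ℕ.m+n≤o⇒m≤o i (ℕ.≤-reflexive e))) (point (suc i)) (≤ᴿ-refl (point i))
    (≤ᴿ-pointwise (point i) (point (suc i)) (point-mono (ℕ.n≤1+n i))) (from j (suc i) (trans (sym (ℕ.+-suc i j)) e))

  gap : ∀ i n → seq (point (suc i)) n - seq (point i) n ≤ 2^- m * (1ℚ + 1ℚ)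
  gap i n = ≤-trans (≤-reflexive (trans
      (cong (λ z → - 1ℚ + z * 2^- m * w - (- 1ℚ + fromℕℚ i * 2^- m * w)) (fromℕℚ-suc i)) (l (fromℕℚ i) (2^- m) w)))
    (*-monoˡ-≤-nonNeg (2^- m) {{0≤2^-m}} (width≤2 n))
    where
    w = seq width n
    l : ∀ i h w → - 1ℚ + (1ℚ + i) * h * w - (- 1ℚ + i * h * w) ≡ h * w
    l = solve 3 (λ i h w → con (- 1ℚ) :+ (con 1ℚ :+ i) :* h :* w :- (con (- 1ℚ) :+ i :* h :* w) := h :* w) refl

  module _ {δ} (small : 2^- m * (1ℚ + 1ℚ) < δ) where

    narrow : ∀ i → (point (suc i) -ᴿ point i) <ᴿ fromℚ δ
    narrow i = δ - w , <-by small (l₁ w δ) , always λ n → ≤-by (gap i n) (l₂ w δ (seq (point (suc i)) n - seq (point i) n))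
      where
      w = 2^- m * (1ℚ + 1ℚ)
      l₁ : ∀ w δ → w + (δ - w) ≡ δ + 0ℚ
      l₁ = solve 2 (λ w δ → w :+ (δ :- w) := δ :+ con 0ℚ) refl
      l₂ : ∀ w δ g → g + δ ≡ w + (g + (δ - w))
      l₂ = solve 3 (λ w δ g → g :+ δ := w :+ (g :+ (δ :- w))) refl

    from-mesh : ∀ j i e → Mesh< δ (from j i e)
    from-mesh zero    i e = tt
    from-mesh (suc j) i e = narrow i , from-mesh j (suc i) (trans (sym (ℕ.+-suc i j)) e)

-- A partition carries its left end as an index, and `point 0` is a real whose entries equal -1
-- without being the term `-1ᴿ`.
relabel : ∀ {a a′ b} → (∀ n → seq a n ≡ seq a′ n) → Partition a b → Partition a′ b
relabel {a} {a′} {b} e (done h) = done (≈-trans a′ a b (≈-pointwise a′ a λ n → sym (e n)) h)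
relabel {a} {a′} e (step tag p h k π) = step tag p
    (≤ᴿ-trans a′ a (val tag) (≤ᴿ-pointwise a′ a λ n → ≤-reflexive (sym (e n))) h) k π

relabel-mesh : ∀ {a} a′ {b δ} (e : ∀ n → seq a n ≡ seq a′ n) (π : Partition a b) → Mesh< δ π → Mesh< δ (relabel {a} {a′} e π)
relabel-mesh a′ e (done _) _ = tt
relabel-mesh a′ {δ = δ} e (step tag p _ _ π) ((ε , ε>0 , N , h) , mesh) =
  (ε , ε>0 , N , λ n l → subst (λ z → seq p n - z + ε ≤ δ) (e n) (h n l)) , mesh

-- `IsRiemannIntegral` constrains the value only through partitions of small mesh, so an integral
-- can be computed only once such a partition is exhibited.
fine-partition : ∀ t δ → 0ℚ < δ → Σ[ π ∈ Partition -1ᴿ (val t) ] Mesh< δ π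
fine-partition t δ δ>0 =
  let n , 2^-n<δ = 2^-archimedean δ δ>0
      -- One halving more than `2^- n` requires, because the interval may have width 2.
      open Uniform t (suc n)
      small = subst (_< δ) (sym (double (2^- n))) 2^-n<δ
  in relabel {point 0} { -1ᴿ} point-0 (from N 0 refl) , relabel-mesh -1ᴿ point-0 (from N 0 refl) (from-mesh small N 0 refl)
  where
  double : ∀ x → ½ * x * (1ℚ + 1ℚ) ≡ x
  double = solve 1 (λ x → con ½ :* x :* (con 1ℚ :+ con 1ℚ) := x) refl

∣p∣<⇒∣p-q∣ : ∀ (x y : ℝ) {ε} → ∣ x -ᴿ y ∣ᴿ <ᴿ fromℚ ε → Eventually λ n → ∣ seq x n - seq y n ∣ < ε
∣p∣<⇒∣p-q∣ x y {ε} (η , η>0 , ev) = ev-map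
    (λ n a → <-≤-trans (subst (_< (d n ⊔ (- d n)) + η) (trans (+-identityʳ _) (p⊔-p≡∣p∣ (d n)))
    (+-monoʳ-< (d n ⊔ (- d n)) η>0)) a) ev
  where
  d : ℕ → ℚ
  d n = seq x n - seq y n

integral-constant : ∀ (f : I → ℝ) c → (∀ s → f s ≈ c) → ∀ t v → IsRiemannIntegral f -1ᴿ (val t) v → v ≈ c *ᴿ (val t -ᴿ -1ᴿ)
integral-constant f c h t v int = ≈-sym s v λ ε ε>0 →
  let δ , δ>0 , close = int (½ * ε) (half-pos ε>0)
      π , mesh = fine-partition t δ δ>0
      r = riemannSum f π
  in ev-zip (λ n a b → ≤-<-trans (∣-∣-triangle (seq s n) (seq r n) (seq v n))
       (subst (∣ seq s n - seq r n ∣ + ∣ seq r n - seq v n ∣ <_) (half+half ε) (+-mono-< a b)))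
     (≈-sym r s (riemannSum-constant f c h π) (½ * ε) (half-pos ε>0)) (∣p∣<⇒∣p-q∣ r v (close π mesh))
  where
  s = c *ᴿ (val t -ᴿ -1ᴿ)

-- The metavariable is solved by the local function of blocks, which has no name outside Defs.
mutual
  blocksFrom : Str → Str → List Str
  blocksFrom = _

  blocks-blocksFrom : ∀ w → blocks w ≡ blocksFrom [] w
  blocks-blocksFrom w with Str ∋ []
  ... | acc = refl

length-blocksFrom : ∀ a w → length (blocksFrom a w) ℕ.≤ length w
length-blocksFrom a []              = z≤n
length-blocksFrom a (false ∷ w)     = s≤s (length-blocksFrom [] w)
length-blocksFrom a (true ∷ [])     = z≤n
length-blocksFrom a (true ∷ b ∷ w)  = ℕ.m≤n⇒m≤1+n (ℕ.m≤n⇒m≤1+n (length-blocksFrom (a ∷ʳ b) w))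

length-dyadics : ∀ w → length (dyadics w) ℕ.≤ length w
length-dyadics w = subst (ℕ._≤ length w) (sym (List.length-map dyadic (blocks w))) (length-blocksFrom [] w)

-- Polynomials near a kink

Δ : (ℕ → ℚ) → ℕ → ℚ
Δ a j = a (suc j) - a j

Δ^ : ℕ → (ℕ → ℚ) → ℕ → ℚ
Δ^ zero    a = a
Δ^ (suc n) a = Δ^ n (Δ a)

-- T n a j = a j - a (j+1) + a (j+2) - ... with n terms.
T : ℕ → (ℕ → ℚ) → ℕ → ℚ
T zero    a j = 0ℚ
T (suc n) a j = a j - T n a (suc j)

-- This is 2ⁿ·q. The factor is never evaluated: it stands on both sides of the inequality behind
-- `spike-bound` and is cancelled there.
double : ℕ → ℚ → ℚ
double zero    q = q
double (suc n) q = double n (q + q)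

double-cancel-≤ : ∀ n {p q} → double n p ≤ double n q → p ≤ q
double-cancel-≤ n {p} {q} h = ≮⇒≥ λ q<p → <-irrefl refl (<-≤-trans (strict n q<p) h)
  where
  strict : ∀ n {p q} → p < q → double n p < double n q
  strict zero    h = h
  strict (suc n) h = strict n (+-mono-< h h)

interchange : ∀ a b c d → (a - b) - (c - d) ≡ (a - c) - (b - d)
interchange = solve 4 (λ a b c d → (a :- b) :- (c :- d) := (a :- c) :- (b :- d)) refl

Δ^-cong : ∀ n {a b} → (∀ j → a j ≡ b j) → ∀ j → Δ^ n a j ≡ Δ^ n b j
Δ^-cong zero    e = e
Δ^-cong (suc n) e = Δ^-cong n λ j → cong₂ _-_ (e (suc j)) (e j)

Δ^-sub : ∀ n a b j → Δ^ n (λ i → a i - b i) j ≡ Δ^ n a j - Δ^ n b j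
Δ^-sub zero    a b j = refl
Δ^-sub (suc n) a b j = trans (Δ^-cong n (λ i → interchange (a (suc i)) (b (suc i)) (a i) (b i)) j) (Δ^-sub n (Δ a) (Δ b) j)

T-sub : ∀ n a b j → T n (λ i → a i - b i) j ≡ T n a j - T n b j
T-sub zero    a b j = refl
T-sub (suc n) a b j = trans (cong (λ z → (a j - b j) - z) (T-sub n a b (suc j)))
    (interchange (a j) (b j) (T n a (suc j)) (T n b (suc j)))

ΔT : ∀ n a j → Δ (T n a) j ≡ T n (Δ a) j
ΔT zero    a j = refl
ΔT (suc n) a j = trans (interchange (a (suc j)) (T n a (suc (suc j))) (a j) (T n a (suc j)))
    (cong (λ z → (a (suc j) - a j) - z) (ΔT n a (suc j)))

Δ^-bound : ∀ n a B → (∀ j → j ℕ.≤ n → ∣ a j ∣ ≤ B) → ∣ Δ^ n a 0 ∣ ≤ double n B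
Δ^-bound zero    a B h = h 0 z≤n
Δ^-bound (suc n) a B h = Δ^-bound n (Δ a) (B + B) λ j j≤n →
  ≤-trans (∣p-q∣≤∣p∣+∣q∣ (a (suc j)) (a j)) (+-mono-≤ (h (suc j) (s≤s j≤n)) (h j (ℕ.m≤n⇒m≤1+n j≤n)))

-- For an alternating sequence `Δ a j` is -2 times `a j`, which alternates again with doubled size.
-- So the growth allowed by `Δ^-bound` is attained.
Δ^-alternating : ∀ n a → (∀ j → j ℕ.< n → a (suc j) ≡ - a j) → ∣ Δ^ n a 0 ∣ ≡ double n ∣ a 0 ∣
Δ^-alternating zero    a h = refl
Δ^-alternating (suc n) a h = trans (Δ^-alternating n (Δ a) Δ-alternating) (cong (double n) first)
  where
  Δ-alternating : ∀ j → j ℕ.< n → Δ a (suc j) ≡ - Δ a j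
  Δ-alternating j j<n = trans (cong₂ _-_ (h (suc j) (s≤s j<n)) (h j (ℕ.m<n⇒m<1+n j<n)))
    (trans (cong (λ z → - z - - a j) (h j (ℕ.m<n⇒m<1+n j<n)))
        (trans (l (a j)) (cong (λ z → - (z - a j)) (sym (h j (ℕ.m<n⇒m<1+n j<n))))))
    where
    l : ∀ x → - (- x) - - x ≡ - (- x - x)
    l = solve 1 (λ x → :- (:- x) :- :- x := :- (:- x :- x)) refl
  first : ∣ Δ a 0 ∣ ≡ ∣ a 0 ∣ + ∣ a 0 ∣
  first = trans (cong (λ z → ∣ z - a 0 ∣) (h 0 (s≤s z≤n)))
      (trans (cong ∣_∣ (l (a 0))) (trans (∣p*q∣≡∣p∣*∣q∣ (- 1ℚ - 1ℚ) (a 0)) (l′ ∣ a 0 ∣)))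
    where
    l : ∀ x → - x - x ≡ (- 1ℚ - 1ℚ) * x
    l = solve 1 (λ x → :- x :- x := (con (- 1ℚ) :- con 1ℚ) :* x) refl
    l′ : ∀ x → (1ℚ + 1ℚ) * x ≡ x + x
    l′ = solve 1 (λ x → (con 1ℚ :+ con 1ℚ) :* x := x :+ x) refl

T-bound : ∀ n a K B → (∀ j → j ℕ.< K → ∣ a j ∣ ≤ B) → ∀ j → j ℕ.+ n ℕ.≤ K → ∣ T n a j ∣ ≤ fromℕℚ n * B
T-bound zero    a K B h j _ = ≤-reflexive (sym (*-zeroˡ B))
T-bound (suc n) a K B h j le = ≤-trans (∣p-q∣≤∣p∣+∣q∣ (a j) (T n a (suc j)))
  (≤-trans (+-mono-≤ (h j (ℕ.≤-trans (s≤s (ℕ.m≤m+n j n)) le′)) (T-bound n a K B h (suc j) le′))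
    (≤-reflexive (trans (l (fromℕℚ n) B) (cong (_* B) (sym (fromℕℚ-suc n))))))
  where
  le′ = subst (ℕ._≤ K) (ℕ.+-suc j n) le
  l : ∀ n B → B + n * B ≡ (1ℚ + n) * B
  l = solve 2 (λ n B → B :+ n :* B := (con 1ℚ :+ n) :* B) refl

-- Degree is expressed by vanishing differences, so that closure under the operations of Horner's
-- scheme replaces an algebra of coefficients.
Degree< : ℕ → (ℕ → ℚ) → Set
Degree< zero    a = ∀ j → a j ≡ 0ℚ
Degree< (suc n) a = Degree< n (Δ a)

degree⇒Δ^≡0 : ∀ n a → Degree< n a → ∀ j → Δ^ n a j ≡ 0ℚ
degree⇒Δ^≡0 zero    a d = d
degree⇒Δ^≡0 (suc n) a d = degree⇒Δ^≡0 n (Δ a) d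

degree-cong : ∀ n {a b} → (∀ j → a j ≡ b j) → Degree< n a → Degree< n b
degree-cong zero    e d j = trans (sym (e j)) (d j)
degree-cong (suc n) e d = degree-cong n (λ j → cong₂ _-_ (e (suc j)) (e j)) d

degree-zero : ∀ n → Degree< n (λ _ → 0ℚ)
degree-zero zero    j = refl
degree-zero (suc n) = degree-cong n (λ _ → sym (+-inverseʳ 0ℚ)) (degree-zero n)

degree-suc : ∀ n {a} → Degree< n a → Degree< (suc n) a
degree-suc zero    d j = cong₂ _-_ (d (suc j)) (d j)
degree-suc (suc n) d = degree-suc n d

degree-≤ : ∀ {m n} a → m ℕ.≤ n → Degree< m a → Degree< n a
degree-≤ a m≤n d = go (ℕ.≤⇒≤′ m≤n)
  where
  go : ∀ {n} → _ ℕ.≤′ n → Degree< n a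
  go (ℕ.≤′-reflexive refl) = d
  go (ℕ.≤′-step {n} h)     = degree-suc n (go h)

degree-+ : ∀ n {a b} → Degree< n a → Degree< n b → Degree< n (λ j → a j + b j)
degree-+ zero    d e j = cong₂ _+_ (d j) (e j)
degree-+ (suc n) {a} {b} d e = degree-cong n (λ j → l (a (suc j)) (a j) (b (suc j)) (b j)) (degree-+ n d e)
  where
  l : ∀ a b c d → (a - b) + (c - d) ≡ (a + c) - (b + d)
  l = solve 4 (λ a b c d → (a :- b) :+ (c :- d) := (a :+ c) :- (b :+ d)) refl

degree-scale : ∀ n c {a} → Degree< n a → Degree< n (λ j → c * a j)
degree-scale zero    c d j = trans (cong (c *_) (d j)) (*-zeroʳ c)
degree-scale (suc n) c {a} d = degree-cong n (λ j → l c (a (suc j)) (a j)) (degree-scale n c d)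
  where
  l : ∀ c a b → c * (a - b) ≡ c * a - c * b
  l = solve 3 (λ c a b → c :* (a :- b) := c :* a :- c :* b) refl

degree-shift : ∀ n {a} → Degree< n a → Degree< n (λ j → a (suc j))
degree-shift zero    d j = d (suc j)
degree-shift (suc n) d = degree-shift n d

degree-T : ∀ n m {a} → Degree< n a → Degree< n (T m a)
degree-T n zero d = degree-zero n
degree-T n (suc m) {a} d = degree-cong n (λ j → l (a j) (T m a (suc j)))
  (degree-+ n d (degree-scale n (- 1ℚ) (degree-shift n (degree-T n m d))))
  where
  l : ∀ a b → a + - 1ℚ * b ≡ a - b
  l = solve 2 (λ a b → a :+ con (- 1ℚ) :* b := a :- b) refl

module _ (x : ℕ → ℚ) (h : ℚ) (x-step : ∀ j → x (suc j) ≡ x j + h) where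

  -- Leibniz rule for differences along an arithmetic progression: the difference of x·a at `j` is
  -- `x j * Δ a j + h * a (suc j)`, and both summands have the lower degree that one difference of
  -- the product must have.
  degree-x* : ∀ n {a} → Degree< n a → Degree< (suc n) (λ j → x j * a j)
  degree-x* zero {a} d j = cong₂ _-_ (zeroAt (suc j)) (zeroAt j)
    where
    zeroAt : ∀ j → x j * a j ≡ 0ℚ
    zeroAt j = trans (cong (x j *_) (d j)) (*-zeroʳ (x j))
  degree-x* (suc n) {a} d = degree-cong (suc n) leibniz
      (degree-+ (suc n) {λ j → x j * Δ a j} {λ j → h * a (suc j)} (degree-x* n d)
      (degree-scale (suc n) h {λ j → a (suc j)} (degree-shift (suc n) {a} d)))
    where
    l : ∀ x h a b → x * (a - b) + h * a ≡ (x + h) * a - x * b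
    l = solve 4 (λ x h a b → x :* (a :- b) :+ h :* a := (x :+ h) :* a :- x :* b) refl
    leibniz : ∀ j → x j * Δ a j + h * a (suc j) ≡ Δ (λ j → x j * a j) j
    leibniz j = trans (l (x j) h (a (suc j)) (a j)) (cong (λ z → z * a (suc j) - x j * a j) (sym (x-step j)))

  degree-horner : ∀ cs → Degree< (length cs) (λ j → foldr (λ c z → c + x j * z) 0ℚ cs)
  degree-horner []       = λ _ → refl
  degree-horner (c ∷ cs) = degree-+ (suc n) {λ _ → c} {λ j → x j * a j} (degree-constant n)
      (degree-x* n {a} (degree-horner cs))
    where
    n = length cs
    a : ℕ → ℚ
    a j = foldr (λ c z → c + x j * z) 0ℚ cs
    degree-constant : ∀ n → Degree< (suc n) (λ _ → c)
    degree-constant n = degree-cong n (λ _ → sym (+-inverseʳ c)) (degree-zero n)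

horner-rational : ∀ cs (x : I) {q} → val x ≈ fromℚ q → horner cs (val x) ≈ fromℚ (foldr (λ c z → c + q * z) 0ℚ cs)
horner-rational []       x e = ≈-refl 0ᴿ
horner-rational (c ∷ cs) x {q} e = +ᴿ-cong (fromℚ c) (fromℚ c) (val x *ᴿ horner cs (val x)) (fromℚ q *ᴿ fromℚ r)
    (≈-refl (fromℚ c))
  (*ᴿ-cong (val x) (fromℚ q) (horner cs (val x)) (fromℚ r) e (horner-rational cs x e))
  where
  r = foldr (λ c z → c + q * z) 0ℚ cs

-- The second difference of a kink is a spike; T spreads it into an alternating sequence,
-- on which Δ^ N is as large as possible.
module Spike (N : ℕ) (c : ℕ → ℚ) (below : ∀ j → j ℕ.< N → c j ≡ 0ℚ) (above : ∀ j → N ℕ.< j → c j ≡ 0ℚ) where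

  T-longer : ∀ n j → N ℕ.< j ℕ.+ n → T (suc n) c j ≡ T n c j
  T-longer zero    j l = cong (_- 0ℚ) (above j (subst (N ℕ.<_) (ℕ.+-identityʳ j) l))
  T-longer (suc n) j l = cong (λ z → c j - z) (T-longer n (suc j) (subst (N ℕ.<_) (ℕ.+-suc j n) l))

  T-above : ∀ n j → N ℕ.< j → T n c j ≡ 0ℚ
  T-above zero    j _   = refl
  T-above (suc n) j N<j = cong₂ _-_ (above j N<j) (T-above n (suc j) (ℕ.m<n⇒m<1+n N<j))

  -- Left of the spike the sum from `j` loses its first term, and the sum from `suc j` loses its
  -- last term, which lies beyond `N`. The same terms remain, with opposite signs.
  alternating : ∀ j → j ℕ.< N → T (suc N) c (suc j) ≡ - T (suc N) c j
  alternating j j<N = trans (T-longer N (suc j) (s≤s (ℕ.m≤n+m N j)))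
    (sym (trans (cong (λ z → - (z - T N c (suc j))) (below j j<N)) (l (T N c (suc j)))))
    where
    l : ∀ x → - (0ℚ - x) ≡ x
    l = solve 1 (λ x → :- (con 0ℚ :- x) := x) refl

  T-peak : ∣ T (suc N) c 0 ∣ ≡ ∣ c N ∣
  T-peak = trans (climb N ℕ.≤-refl)
      (cong ∣_∣ (trans (cong (λ z → c N - z) (T-above N (suc N) ℕ.≤-refl)) (+-identityʳ (c N))))
    where
    climb : ∀ j → j ℕ.≤ N → ∣ T (suc N) c 0 ∣ ≡ ∣ T (suc N) c j ∣
    climb zero    _   = refl
    climb (suc j) j<N = trans (climb j (ℕ.<⇒≤ j<N))
        (trans (sym (∣-p∣≡∣p∣ (T (suc N) c j))) (cong ∣_∣ (sym (alternating j j<N))))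

  peak : ∣ Δ^ N (T (suc N) c) 0 ∣ ≡ double N ∣ c N ∣
  peak = trans (Δ^-alternating N (T (suc N) c) alternating) (cong (double N) T-peak)

-- The form `q - - 1ℚ` copies the `val t -ᴿ -1ᴿ` of the integral, so that at rational points the
-- real version agrees with this one entrywise by computation.
ramp : ℚ → ℚ → ℚ
ramp β q = β * (q - - 1ℚ) ⊔ β

-- The grid has step `2^- suc r` and its zero at index `M`; it stays in [-1,1] up to index 2M
-- because M = 2^r + 1 is at most 2^(r+1). A second difference at `j` looks at `j`, j+1 and j+2, so
-- the kink at `M` shows up as a spike at `N`.
module Kink (r : ℕ) (β : ℚ) (0≤β : 0ℚ ≤ β) (cs : List ℚ) (short : length cs ℕ.≤ 2 ℕ.^ r) where

  N M : ℕ
  N = 2 ℕ.^ r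
  M = suc N

  h : ℚ
  h = 2^- suc r

  0≤h : NonNegative h
  0≤h = nonNegative (<⇒≤ (2^-pos (suc r)))

  x : ℕ → ℚ
  x j = (fromℕℚ j - fromℕℚ M) * h

  x-step : ∀ j → x (suc j) ≡ x j + h
  x-step j = trans (cong (λ z → (z - fromℕℚ M) * h) (fromℕℚ-suc j)) (l (fromℕℚ j) (fromℕℚ M) h)
    where
    l : ∀ j m h → (1ℚ + j - m) * h ≡ (j - m) * h + h
    l = solve 3 (λ j m h → (con 1ℚ :+ j :- m) :* h := (j :- m) :* h :+ h) refl

  x-M : x M ≡ 0ℚ
  x-M = trans (cong (_* h) (+-inverseʳ (fromℕℚ M))) (*-zeroˡ h)

  x≤0 : ∀ j → j ℕ.≤ M → x j ≤ 0ℚ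
  x≤0 j j≤M = subst (x j ≤_) x-M (*-monoʳ-≤-nonNeg h {{0≤h}} (+-monoˡ-≤ (- fromℕℚ M) (fromℕℚ-≤ {j} {M} j≤M)))

  0≤x : ∀ j → M ℕ.≤ j → 0ℚ ≤ x j
  0≤x j M≤j = subst (_≤ x j) x-M (*-monoʳ-≤-nonNeg h {{0≤h}} (+-monoˡ-≤ (- fromℕℚ M) (fromℕℚ-≤ {M} {j} M≤j)))

  M*h≤1 : fromℕℚ M * h ≤ 1ℚ
  M*h≤1 = ≤-trans (*-monoʳ-≤-nonNeg h {{0≤h}} (fromℕℚ-≤ {M} {2 ℕ.^ suc r}
    (ℕ.+-mono-≤ (ℕ.m^n>0 2 r) (ℕ.m≤m+n N 0)))) (≤-reflexive (2^n*2^-n (suc r)))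

  -1≤x : ∀ j → - 1ℚ ≤ x j
  -1≤x j = ≤-by (+-mono-≤ M*h≤1 0≤jh) (l (fromℕℚ j) (fromℕℚ M) h)
    where
    0≤jh : 0ℚ ≤ fromℕℚ j * h
    0≤jh = subst (_≤ fromℕℚ j * h) (*-zeroˡ h) (*-monoʳ-≤-nonNeg h {{0≤h}} (0≤fromℕℚ j))
    l : ∀ j m h → (m * h + 0ℚ) + (j - m) * h ≡ (1ℚ + j * h) + - 1ℚ
    l = solve 3 (λ j m h → (m :* h :+ con 0ℚ) :+ (j :- m) :* h := (con 1ℚ :+ j :* h) :+ con (- 1ℚ)) refl

  x≤1 : ∀ j → j ℕ.≤ M ℕ.+ M → x j ≤ 1ℚ
  x≤1 j j≤ = ≤-trans (*-monoʳ-≤-nonNeg h {{0≤h}} (+-monoˡ-≤ (- fromℕℚ M) (fromℕℚ-≤ {j} {M ℕ.+ M} j≤)))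
    (≤-trans (≤-reflexive (trans (cong (λ z → (z - fromℕℚ M) * h) (sym (fromℕℚ-+ M M))) (l (fromℕℚ M) h))) M*h≤1)
    where
    l : ∀ m h → (m + m - m) * h ≡ m * h
    l = solve 2 (λ m h → (m :+ m :- m) :* h := m :* h) refl

  F P E c : ℕ → ℚ
  F j = ramp β (x j)
  P j = foldr (λ c z → c + x j * z) 0ℚ cs
  E j = F j - P j
  c   = Δ (Δ F)

  flat : ∀ j → j ℕ.≤ M → F j ≡ β
  flat j j≤M = p≤q⇒p⊔q≡q (≤-by (*-monoˡ-≤-nonNeg β {{nonNegative 0≤β}} (x≤0 j j≤M)) (l β (x j)))
    where
    l : ∀ β x → β * x + β ≡ β * 0ℚ + β * (x - - 1ℚ)
    l = solve 2 (λ β x → β :* x :+ β := β :* con 0ℚ :+ β :* (x :- con (- 1ℚ))) refl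

  linear : ∀ j → M ℕ.≤ j → F j ≡ β * (x j - - 1ℚ)
  linear j M≤j = p≥q⇒p⊔q≡p (≤-by (*-monoˡ-≤-nonNeg β {{nonNegative 0≤β}} (0≤x j M≤j)) (l β (x j)))
    where
    l : ∀ β x → β * 0ℚ + β * (x - - 1ℚ) ≡ β * x + β
    l = solve 2 (λ β x → β :* con 0ℚ :+ β :* (x :- con (- 1ℚ)) := β :* x :+ β) refl

  second : ∀ j {a b d} → F (suc (suc j)) ≡ a → F (suc j) ≡ b → F j ≡ d → c j ≡ (a - b) - (b - d)
  second j refl refl refl = refl

  below : ∀ j → j ℕ.< N → c j ≡ 0ℚ
  below j j<N = trans (second j (flat (2 ℕ.+ j) (s≤s j<N)) (flat (suc j) (ℕ.m≤n⇒m≤1+n j<N))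
      (flat j (ℕ.m≤n⇒m≤1+n (ℕ.<⇒≤ j<N)))) (+-inverseʳ (β - β))

  above : ∀ j → N ℕ.< j → c j ≡ 0ℚ
  above j N<j = trans (second j
    (trans (linear (2 ℕ.+ j) (ℕ.m≤n⇒m≤1+n (ℕ.m≤n⇒m≤1+n N<j)))
        (cong (λ z → β * (z - - 1ℚ)) (trans (x-step (suc j)) (cong (_+ h) (x-step j)))))
    (trans (linear (suc j) (ℕ.m≤n⇒m≤1+n N<j)) (cong (λ z → β * (z - - 1ℚ)) (x-step j)))
    (linear j N<j)) (l β (x j) h)
    where
    l : ∀ β x h → (β * (x + h + h - - 1ℚ) - β * (x + h - - 1ℚ)) - (β * (x + h - - 1ℚ) - β * (x - - 1ℚ)) ≡ 0ℚ
    l = solve 3 (λ β x h → (β :* (x :+ h :+ h :- con (- 1ℚ)) :- β :* (x :+ h :- con (- 1ℚ))) :-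
        (β :* (x :+ h :- con (- 1ℚ)) :- β :* (x :- con (- 1ℚ))) := con 0ℚ) refl

  at : c N ≡ β * h
  at = trans (second N (trans (linear (suc M) (ℕ.n≤1+n M))
      (cong (λ z → β * (z - - 1ℚ)) (trans (x-step M) (cong (_+ h) x-M))))
    (flat M ℕ.≤-refl) (flat N (ℕ.n≤1+n N))) (l β h)
    where
    l : ∀ β h → (β * (0ℚ + h - - 1ℚ) - β) - (β - β) ≡ β * h
    l = solve 2 (λ β h → (β :* (con 0ℚ :+ h :- con (- 1ℚ)) :- β) :- (β :- β) := β :* h) refl

  open Spike N c below above

  Δ²T : ∀ a j → Δ (Δ (T M a)) j ≡ T M (Δ (Δ a)) j
  Δ²T a j = trans (cong₂ _-_ (ΔT M a (suc j)) (ΔT M a j)) (ΔT M (Δ a) j)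

  Δ^TE : Δ^ (2 ℕ.+ N) (T M E) 0 ≡ Δ^ N (T M c) 0
  Δ^TE = begin
    Δ^ (2 ℕ.+ N) (T M E) 0                                     ≡⟨ Δ^-cong (2 ℕ.+ N) (T-sub M F P) 0 ⟩
    Δ^ (2 ℕ.+ N) (λ j → T M F j - T M P j) 0                   ≡⟨ Δ^-sub (2 ℕ.+ N) (T M F) (T M P) 0 ⟩
    Δ^ (2 ℕ.+ N) (T M F) 0 - Δ^ (2 ℕ.+ N) (T M P) 0
        ≡⟨ cong₂ _-_ (Δ^-cong N (Δ²T F) 0) (degree⇒Δ^≡0 (2 ℕ.+ N) (T M P) (degree-T (2 ℕ.+ N) M {P} degree-P) 0) ⟩
    Δ^ N (T M c) 0 - 0ℚ                                        ≡⟨ +-identityʳ _ ⟩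
    Δ^ N (T M c) 0                                             ∎
    where
    open ≡-Reasoning
    degree-P : Degree< (2 ℕ.+ N) P
    degree-P = degree-≤ P (ℕ.≤-trans short (ℕ.m≤n+m N 2)) (degree-horner x h x-step cs)

  module _ (near : ∀ q → - 1ℚ ≤ q → q ≤ 1ℚ → ∣ ramp β q - foldr (λ c z → c + q * z) 0ℚ cs ∣ ≤ 1ℚ) where

    -- The spike contributes 2^N·βh, while errors of at most 1, summed over `M` terms and
    -- differenced N+2 times, contribute at most 2^(N+2)·M.
    spike-bound : β * h ≤ fromℕℚ 4 * fromℕℚ M
    spike-bound = double-cancel-≤ N (begin
      double N (β * h)               ≡⟨ cong (double N) (trans (cong ∣_∣ at) (0≤p⇒∣p∣≡p 0≤βh)) ⟨
      double N ∣ c N ∣               ≡⟨ peak ⟨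
      ∣ Δ^ N (T M c) 0 ∣             ≡⟨ cong ∣_∣ Δ^TE ⟨
      ∣ Δ^ (2 ℕ.+ N) (T M E) 0 ∣     ≤⟨ Δ^-bound (2 ℕ.+ N) (T M E) (fromℕℚ M * 1ℚ) T-small ⟩
      double (2 ℕ.+ N) (fromℕℚ M * 1ℚ) ≡⟨ cong (double N) (l (fromℕℚ M)) ⟩
      double N (fromℕℚ 4 * fromℕℚ M) ∎)
      where
      open ≤-Reasoning
      0≤βh : 0ℚ ≤ β * h
      0≤βh = subst (_≤ β * h) (*-zeroˡ h) (*-monoʳ-≤-nonNeg h {{0≤h}} 0≤β)
      l : ∀ m → (m * 1ℚ + m * 1ℚ) + (m * 1ℚ + m * 1ℚ) ≡ fromℕℚ 4 * m
      l = solve 1 (λ m → (m :* con 1ℚ :+ m :* con 1ℚ) :+ (m :* con 1ℚ :+ m :* con 1ℚ) := con (fromℕℚ 4) :* m) refl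
      T-small : ∀ j → j ℕ.≤ 2 ℕ.+ N → ∣ T M E j ∣ ≤ fromℕℚ M * 1ℚ
      -- The sums start at N+2 = M+1 at the latest and have `M` terms, so they read no index beyond
      -- 2M, the last one to which `x≤1` applies.
      T-small j j≤ = T-bound M E (suc (M ℕ.+ M)) 1ℚ (λ { i (s≤s i≤) → near (x i) (-1≤x i) (x≤1 i i≤) }) j (ℕ.+-monoˡ-≤ M j≤)

    kink-bound : β ≤ fromℕℚ (2 ℕ.^ (2 ℕ.* r ℕ.+ 4))
    kink-bound = begin
      β                                              ≡⟨ *-identityʳ β ⟨
      β * 1ℚ                                         ≡⟨ cong (β *_) (2^n*2^-n (suc r)) ⟨
      β * (fromℕℚ (2 ℕ.^ suc r) * h)                 ≡⟨ l₂ β (fromℕℚ (2 ℕ.^ suc r)) h ⟩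
      fromℕℚ (2 ℕ.^ suc r) * (β * h)
          ≤⟨ *-monoˡ-≤-nonNeg (fromℕℚ (2 ℕ.^ suc r)) {{nonNegative (0≤fromℕℚ (2 ℕ.^ suc r))}} spike-bound ⟩
      fromℕℚ (2 ℕ.^ suc r) * (fromℕℚ 4 * fromℕℚ M)   ≡⟨ cong (fromℕℚ (2 ℕ.^ suc r) *_) (fromℕℚ-* 4 M) ⟩
      fromℕℚ (2 ℕ.^ suc r) * fromℕℚ (4 ℕ.* M)        ≡⟨ fromℕℚ-* (2 ℕ.^ suc r) (4 ℕ.* M) ⟩
      fromℕℚ (2 ℕ.^ suc r ℕ.* (4 ℕ.* M))             ≤⟨ fromℕℚ-≤ {2 ℕ.^ suc r ℕ.* (4 ℕ.* M)} bound ⟩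
      fromℕℚ (2 ℕ.^ (2 ℕ.* r ℕ.+ 4))                 ∎
      where
      open ≤-Reasoning
      l₂ : ∀ β n h → β * (n * h) ≡ n * (β * h)
      l₂ = solve 3 (λ β n h → β :* (n :* h) := n :* (β :* h)) refl
      bound : 2 ℕ.^ suc r ℕ.* (4 ℕ.* M) ℕ.≤ 2 ℕ.^ (2 ℕ.* r ℕ.+ 4)
      bound = ℕ.≤-trans (ℕ.*-monoʳ-≤ (2 ℕ.^ suc r) (ℕ.*-monoʳ-≤ 4 (ℕ.+-mono-≤ (ℕ.m^n>0 2 r) (ℕ.m≤m+n N 0))))
        (ℕ.≤-reflexive (trans (cong (2 ℕ.^ suc r ℕ.*_) (sym (ℕ.^-distribˡ-+-* 2 2 (suc r))))
          (trans (sym (ℕ.^-distribˡ-+-* 2 (suc r) (2 ℕ.+ suc r))) (cong (2 ℕ.^_) exponent))))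
        where
        exponent : suc r ℕ.+ (2 ℕ.+ suc r) ≡ 2 ℕ.* r ℕ.+ 4
        exponent = solveℕ 1 (λ r → (conℕ 1 :+ℕ r) :+ℕ (conℕ 2 :+ℕ (conℕ 1 :+ℕ r)) :=ℕ conℕ 2 :*ℕ r :+ℕ conℕ 4) refl r

Matches : C → (ℚ → ℚ) → Set
Matches f F = ∀ q (l : - 1ℚ ≤ q) (u : q ≤ 1ℚ) → fun f (rational q l u) ≈ fromℚ (F q)

parabola : ℚ → ℚ → ℚ
parabola β q = (β * (q - - 1ℚ)) * (β * (q - - 1ℚ))

-- Piecewise affine functions near a parabola

-- Here `p`, `q`, `s` will be the values of the parabola at the left end, middle and right end of a
-- piece of scaled width `v`. The second difference is v²/2 for the parabola and 0 for an affine
-- function; errors of at most 1, with the middle counted twice, account for at most 4. So v² ≤ 8 <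
-- 9.
width-bound : ∀ p q s v → p + s - (q + q) ≡ ½ * (v * v) → ∀ P Q S → P + S ≡ Q + Q →
  ∣ P - p ∣ ≤ 1ℚ → ∣ Q - q ∣ ≤ 1ℚ → ∣ S - s ∣ ≤ 1ℚ → v ≤ fromℕℚ 3
width-bound p q s v e P Q S E hp hq hs = ≮⇒≥ λ 3<v → <-irrefl refl (<-≤-trans (9<v² 3<v) (≤-trans v²≤8 (≤ᵇ⇒≤ tt)))
  where
  combine : ∀ P Q S p q s → ((p - P) + ((Q - q) + (Q - q)) + (s - S)) ≡ (p + s - (q + q)) - ((P + S) - (Q + Q))
  combine = solve 6 (λ P Q S p q s →
      ((p :- P) :+ ((Q :- q) :+ (Q :- q)) :+ (s :- S)) := (p :+ s :- (q :+ q)) :- ((P :+ S) :- (Q :+ Q))) refl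
  p-P≤ : p - P ≤ 1ℚ
  p-P≤ = ≤-trans (p≤∣p∣ _) (subst (_≤ 1ℚ) (∣p-q∣≡∣q-p∣ P p) hp)
  s-S≤ : s - S ≤ 1ℚ
  s-S≤ = ≤-trans (p≤∣p∣ _) (subst (_≤ 1ℚ) (∣p-q∣≡∣q-p∣ S s) hs)
  Q-q≤ : Q - q ≤ 1ℚ
  Q-q≤ = ≤-trans (p≤∣p∣ _) hq
  sum-value : (p + s - (q + q)) - ((P + S) - (Q + Q)) ≡ ½ * (v * v)
  sum-value = trans (cong₂ _-_ e (trans (cong (_- (Q + Q)) E) (+-inverseʳ (Q + Q)))) (+-identityʳ _)
  half≤4 : ½ * (v * v) ≤ 1ℚ + (1ℚ + 1ℚ) + 1ℚ
  half≤4 = subst (_≤ 1ℚ + (1ℚ + 1ℚ) + 1ℚ) (trans (combine P Q S p q s) sum-value)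
    (+-mono-≤ (+-mono-≤ p-P≤ (+-mono-≤ Q-q≤ Q-q≤)) s-S≤)
  v²≤8 : v * v ≤ fromℕℚ 8
  v²≤8 = subst (_≤ fromℕℚ 8) (half+half (v * v)) (+-mono-≤ half≤4 half≤4)
  9<v² : fromℕℚ 3 < v → fromℕℚ 9 < v * v
  9<v² 3<v = <-trans (*-monoʳ-<-pos (fromℕℚ 3) 3<v) (*-monoˡ-<-pos v {{positive (<-trans (positive⁻¹ (fromℕℚ 3)) 3<v)}} 3<v)

module Curved (β : ℚ) (f : C) (f≈ : Matches f (parabola β)) (g : C)
              (near : ∀ x → ∣ fun g x -ᴿ fun f x ∣ᴿ ≤ᴿ fromℚ 1ℚ) where

  pieces≤1 : ∀ {a qs} → Pieces g a qs → a ≤ 1ℚ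
  pieces≤1 end             = ≤-refl
  pieces≤1 (piece a<a′ _ π) = ≤-trans (<⇒≤ a<a′) (pieces≤1 π)

  -- A piece has scaled width at most 3 and occupies exactly three entries of the list, so the two
  -- sides can be compared piece by piece.
  pieces-length : ∀ {a qs} → - 1ℚ ≤ a → Pieces g a qs → β * (1ℚ - a) ≤ fromℕℚ (length qs)
  pieces-length -1≤a end = ≤-reflexive (*-zeroʳ β)
  pieces-length -1≤a (piece {a} {a′} {b} {c} {rest} a<a′ affine π) =
    subst₂ _≤_ (split β a a′) (fromℕℚ-+ 3 (length rest)) (+-mono-≤ width≤3 (pieces-length (≤-trans -1≤a (<⇒≤ a<a′)) π))
    where
    split : ∀ β a a′ → β * (a′ - a) + β * (1ℚ - a′) ≡ β * (1ℚ - a)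
    split = solve 3 (λ β a a′ → β :* (a′ :- a) :+ β :* (con 1ℚ :- a′) := β :* (con 1ℚ :- a)) refl
    m = ½ * a + ½ * a′
    a≤m : a ≤ m
    a≤m = subst (_≤ m) (half+half a) (+-monoʳ-≤ (½ * a) (*-monoˡ-≤-nonNeg ½ (<⇒≤ a<a′)))
    m≤a′ : m ≤ a′
    m≤a′ = subst (m ≤_) (half+half a′) (+-monoˡ-≤ (½ * a′) (*-monoˡ-≤-nonNeg ½ (<⇒≤ a<a′)))
    close : ∀ q → a ≤ q → q ≤ a′ → ∣ (b * q + c) - parabola β q ∣ ≤ 1ℚ
    close q l u = ∣-∣ᴿ-rational (fun g x) (fun f x) {b * q + c} {parabola β q}
        (affine x (fromℚ-mono l) (fromℚ-mono u)) (f≈ q l′ u′) (near x)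
      where
      l′ = ≤-trans -1≤a l
      u′ = ≤-trans u (pieces≤1 π)
      x = rational q l′ u′
    width≤3 : β * (a′ - a) ≤ fromℕℚ 3
    width≤3 = width-bound (parabola β a) (parabola β m) (parabola β a′) (β * (a′ - a)) (second β a a′)
      (b * a + c) (b * m + c) (b * a′ + c) (affine-second b c a a′)
      (close a ≤-refl (<⇒≤ a<a′)) (close m a≤m m≤a′) (close a′ (<⇒≤ a<a′) ≤-refl)
      where
      shifted : ∀ β a a′ → β * (½ * a + ½ * a′ - - 1ℚ) ≡ ½ * (β * (a - - 1ℚ)) + ½ * (β * (a′ - - 1ℚ))
      shifted = solve 3 (λ β a a′ → β :* (con ½ :* a :+ con ½ :* a′ :- con (- 1ℚ)) := con ½ :*
          (β :* (a :- con (- 1ℚ))) :+ con ½ :* (β :* (a′ :- con (- 1ℚ)))) refl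
      difference : ∀ β a a′ → β * (a′ - - 1ℚ) - β * (a - - 1ℚ) ≡ β * (a′ - a)
      difference = solve 3 (λ β a a′ → β :* (a′ :- con (- 1ℚ)) :- β :* (a :- con (- 1ℚ)) := β :* (a′ :- a)) refl
      squares : ∀ p s → p * p + s * s - ((½ * p + ½ * s) * (½ * p + ½ * s) + (½ * p + ½ * s) * (½ * p + ½ * s)) ≡ ½
          * ((s - p) * (s - p))
      squares = solve 2 (λ p s → p :* p :+ s :* s :-
          ((con ½ :* p :+ con ½ :* s) :* (con ½ :* p :+ con ½ :* s) :+ (con ½ :* p :+ con ½ :* s) :*
          (con ½ :* p :+ con ½ :* s)) := con ½ :* ((s :- p) :* (s :- p))) refl
      second : ∀ β a a′ → parabola β a + parabola β a′ -
          (parabola β (½ * a + ½ * a′) + parabola β (½ * a + ½ * a′)) ≡ ½ * (β * (a′ - a) * (β * (a′ - a)))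
      second β a a′ = trans (cong (λ z → parabola β a + parabola β a′ - (z * z + z * z)) (shifted β a a′))
        (trans (squares (β * (a - - 1ℚ)) (β * (a′ - - 1ℚ))) (cong (λ z → ½ * (z * z)) (difference β a a′)))
      affine-second : ∀ b c a a′ → (b * a + c) + (b * a′ + c) ≡ (b * (½ * a + ½ * a′) + c) + (b * (½ * a + ½ * a′) + c)
      affine-second = solve 4 (λ b c a a′ →
          (b :* a :+ c) :+ (b :* a′ :+ c) := (b :* (con ½ :* a :+ con ½ :* a′) :+ c) :+
          (b :* (con ½ :* a :+ con ½ :* a′) :+ c)) refl

  described-length : ∀ {qs} → Describes qs g → β ≤ fromℕℚ (length qs)
  described-length {qs} (rest , refl , π) = ≤-trans β≤
      (fromℕℚ-≤ {length rest} {length (- 1ℚ ∷ rest)} (ℕ.n≤1+n (length rest)))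
    where
    β≤ : β ≤ fromℕℚ (length rest)
    β≤ = [ (λ 0≤β → ≤-trans (≤-by 0≤β (l β)) (pieces-length ≤-refl π)) ,
        (λ β≤0 → ≤-trans β≤0 (0≤fromℕℚ (length rest))) ]′ (≤-total 0ℚ β)
      where
      l : ∀ β → 0ℚ + β * (1ℚ - - 1ℚ) ≡ β + β
      l = solve 1 (λ β → con 0ℚ :+ β :* (con 1ℚ :- con (- 1ℚ)) := β :+ β) refl

  -- Words that describe no function denote zero, so zero has to be excluded as an approximation. At
  -- 1 the parabola takes the value (2β)² ≥ 4.
  nonzero : 1ℚ ≤ β → ¬ (∀ x → fun g x ≈ 0ᴿ)
  nonzero 1≤β g≈0 = <-irrefl refl
      (<-≤-trans (<-≤-trans 1<4 4≤) (∣-∣ᴿ-rational (fun g x) (fun f x) {0ℚ} {parabola β 1ℚ} (g≈0 x)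
      (f≈ 1ℚ -1≤1 ≤-refl) (near x)))
    where
    -1≤1 : - 1ℚ ≤ 1ℚ
    -1≤1 = ≤ᵇ⇒≤ tt
    x = rational 1ℚ -1≤1 ≤-refl
    u = β * (1ℚ - - 1ℚ)
    2≤u : fromℕℚ 2 ≤ u
    2≤u = *-monoʳ-≤-nonNeg (fromℕℚ 2) 1≤β
    1<4 : 1ℚ < fromℕℚ 2 * fromℕℚ 2
    1<4 = fromℕℚ-< {1} {4} (s≤s (s≤s z≤n))
    4≤ : fromℕℚ 2 * fromℕℚ 2 ≤ ∣ 0ℚ - u * u ∣
    4≤ = ≤-trans (*-monoˡ-≤-nonNeg (fromℕℚ 2) 2≤u)
        (≤-trans (*-monoʳ-≤-nonNeg u {{nonNegative (≤-trans (0≤fromℕℚ 2) 2≤u)}} 2≤u)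
      (subst (u * u ≤_) (trans (sym (∣-p∣≡∣p∣ (u * u))) (cong ∣_∣ (sym (+-identityˡ (- (u * u)))))) (p≤∣p∣ (u * u))))

-- Lengths of Cauchy names of steep functions

sup<2^-⇒≤1 : ∀ m g f → (Dist< (2^- m)) g f → ∀ x → ∣ fun g x -ᴿ fun f x ∣ᴿ ≤ᴿ fromℚ 1ℚ
sup<2^-⇒≤1 m g f (r , r< , h) x = ≤ᴿ-trans (∣ fun g x -ᴿ fun f x ∣ᴿ) (fromℚ r) (fromℚ 1ℚ) (h x)
    (fromℚ-mono (≤-trans (<⇒≤ r<) (2^-≤1 m)))

-- `B` is the steepness beyond which every answer has length at least `K`. The precision does not
-- matter, since an approximation within `2^- m` is in any case within 1.
LongNames : Representation C → (ℚ → ℚ → ℚ) → ℕ → ℕ → Set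
LongNames δ F K B = ∀ β f φ → fromℕℚ B < β → Matches f (F β) → δ φ f → ∀ m → K ℕ.≤ length (fn φ (zeros m))

Poly-long : ∀ r → LongNames Poly ramp (2 ℕ.^ r) (2 ℕ.^ (2 ℕ.* r ℕ.+ 4))
Poly-long r β f φ B<β f≈ name m = ℕ.≮⇒≥ λ short → <-irrefl refl (<-≤-trans B<β
    (Kink.kink-bound r β (≤-trans (0≤fromℕℚ (2 ℕ.^ (2 ℕ.* r ℕ.+ 4))) (<⇒≤ B<β)) cs
        (ℕ.≤-trans (length-dyadics w) (ℕ.<⇒≤ short)) near))
  where
  w = fn φ (zeros m)
  cs = dyadics w
  g = proj₁ (name (zeros m))
  near : ∀ q → - 1ℚ ≤ q → q ≤ 1ℚ → ∣ ramp β q - foldr (λ c z → c + q * z) 0ℚ cs ∣ ≤ 1ℚ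
  near q l u = subst (_≤ 1ℚ) (∣p-q∣≡∣q-p∣ (foldr (λ c z → c + q * z) 0ℚ cs) (ramp β q))
    (∣-∣ᴿ-rational (fun g x) (fun f x) {foldr (λ c z → c + q * z) 0ℚ cs} {ramp β q}
      (≈-trans (fun g x) (horner cs (val x)) (fromℚ (foldr (λ c z → c + q * z) 0ℚ cs))
          (proj₁ (proj₂ (name (zeros m))) x) (horner-rational cs x (≈-refl (fromℚ q))))
      (f≈ q l u) (sup<2^-⇒≤1 (length (zeros m)) g f (proj₂ (proj₂ (name (zeros m)))) x))
    where x = rational q l u

PAff-long : ∀ K → LongNames PAff parabola K (suc K)
PAff-long K β f φ B<β f≈ name m = [ described , (λ (_ , g≈0) → ⊥-elim (nonzero 1≤β g≈0)) ]′ (proj₁ (proj₂ (name (zeros m))))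
  where
  w = fn φ (zeros m)
  g = proj₁ (name (zeros m))
  open Curved β f f≈ g (sup<2^-⇒≤1 (length (zeros m)) g f (proj₂ (proj₂ (name (zeros m)))))
  1≤β : 1ℚ ≤ β
  1≤β = ≤-trans (fromℕℚ-≤ {1} {suc K} (s≤s z≤n)) (<⇒≤ B<β)
  described : Describes (dyadics w) g → K ℕ.≤ length w
  described d = ℕ.≤-trans (ℕ.n≤1+n K)
      (ℕ.≤-trans (fromℕℚ-cancel-≤ {suc K} {length (dyadics w)} (≤-trans (<⇒≤ B<β) (described-length d))) (length-dyadics w))

-- Words and running times

binary : Str → ℕ
binary = foldl (λ n b → bit b ℕ.+ 2 ℕ.* n) 0

halve : ∀ n → ∃₂ λ b m → n ≡ bit b ℕ.+ 2 ℕ.* m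
halve zero    = false , 0 , refl
halve (suc n) with halve n
... | false , m , refl = true , m , refl
... | true  , m , refl = false , suc m , cong suc (sym (ℕ.+-suc m (m ℕ.+ 0)))

binary-onto : ∀ L A → A ℕ.< 2 ℕ.^ L → ∃[ w ] length w ≡ L × binary w ≡ A
binary-onto zero    zero    _         = [] , refl , refl
binary-onto zero    (suc A) (s≤s ())
binary-onto (suc L) A       A<2^L with halve A
... | b , m , refl =
  let w , ∣w∣ , val = binary-onto L m (ℕ.*-cancelˡ-< 2 m (2 ℕ.^ L) (ℕ.≤-<-trans (ℕ.m≤n+m (2 ℕ.* m) (bit b)) A<2^L))
  in w ∷ʳ b , trans (List.length-++ w) (trans (ℕ.+-comm (length w) 1) (cong suc ∣w∣)) ,
     trans (List.foldl-∷ʳ (λ n b → bit b ℕ.+ 2 ℕ.* n) 0 b w) (cong (λ n → bit b ℕ.+ 2 ℕ.* n) val)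

dyadic-word : ∀ J w → dyadic (false ∷ replicate J true ++ false ∷ w) ≡ 2^- J * fromℕℚ (binary w)
dyadic-word zero    w = sym (*-identityˡ (fromℕℚ (binary w)))
dyadic-word (suc J) w = trans (cong (½ *_) (dyadic-word J w)) (sym (*-assoc ½ (2^- J) (fromℕℚ (binary w))))

-- Leading zeros bring the word to any prescribed length.
represent : ∀ n J A → 2 ℕ.+ J ℕ.≤ n → A ℕ.< 2 ℕ.^ (n ℕ.∸ (2 ℕ.+ J)) → ∃[ w ] length w ≡ n × dyadic w ≡ 2^- J * fromℕℚ A
represent n J A J≤n A< =
  let w , ∣w∣ , val = binary-onto (n ℕ.∸ (2 ℕ.+ J)) A A<
  in false ∷ replicate J true ++ false ∷ w ,
     trans (cong suc (trans (List.length-++ (replicate J true))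
         (trans (cong₂ (λ a b → a ℕ.+ suc b) (List.length-replicate J) ∣w∣) (ℕ.+-suc J _))))
       (ℕ.m+[n∸m]≡n J≤n) ,
     trans (dyadic-word J w) (cong (λ a → 2^- J * fromℕℚ a) val)

-- The bound 2^J on `f` holds at every argument, so nested applications of Φ do not compound, and
-- what remains is a fixed power of 2^(J+1).
poly₂-bound : ∀ P → ∃[ e ] ∀ J f n → (∀ m → f m ℕ.≤ 2 ℕ.^ J) → n ℕ.≤ 2 ℕ.^ J → ⟦ P ⟧₂ f n ℕ.≤ 2 ℕ.^ (e ℕ.* suc J)
poly₂-bound 𝟙 = 0 , λ J f n _ _ → ℕ.≤-refl
poly₂-bound 𝕏 = 1 , λ J f n _ n≤ →
    ℕ.≤-trans n≤ (ℕ.^-monoʳ-≤ 2 (ℕ.≤-trans (ℕ.n≤1+n J) (ℕ.≤-reflexive (sym (ℕ.*-identityˡ (suc J))))))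
poly₂-bound (Φ P) = 1 , λ J f n f≤ _ →
    ℕ.≤-trans (f≤ _) (ℕ.^-monoʳ-≤ 2 (ℕ.≤-trans (ℕ.n≤1+n J) (ℕ.≤-reflexive (sym (ℕ.*-identityˡ (suc J))))))
poly₂-bound (P ⊛ Q) with poly₂-bound P | poly₂-bound Q
... | d , hP | e , hQ = d ℕ.+ e , λ J f n f≤ n≤ → ℕ.≤-trans (ℕ.*-mono-≤ (hP J f n f≤ n≤) (hQ J f n f≤ n≤))
  (ℕ.≤-reflexive (trans (sym (ℕ.^-distribˡ-+-* 2 (d ℕ.* suc J) (e ℕ.* suc J)))
      (cong (2 ℕ.^_) (sym (ℕ.*-distribʳ-+ (suc J) d e)))))
poly₂-bound (P ⊕ Q) with poly₂-bound P | poly₂-bound Q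
... | d , hP | e , hQ = suc (d ℕ.+ e) , λ J f n f≤ n≤ →
  let p = d ℕ.* suc J ; q = e ℕ.* suc J in begin
  ⟦ P ⟧₂ f n ℕ.+ ⟦ Q ⟧₂ f n                       ≤⟨ ℕ.+-mono-≤ (hP J f n f≤ n≤) (hQ J f n f≤ n≤) ⟩
  2 ℕ.^ p ℕ.+ 2 ℕ.^ q                             ≤⟨ ℕ.+-mono-≤ (ℕ.^-monoʳ-≤ 2 (ℕ.m≤m+n p q)) (ℕ.^-monoʳ-≤ 2 (ℕ.m≤n+m q p)) ⟩
  2 ℕ.^ (p ℕ.+ q) ℕ.+ 2 ℕ.^ (p ℕ.+ q)             ≡⟨ cong (2 ℕ.^ (p ℕ.+ q) ℕ.+_) (sym (ℕ.+-identityʳ _)) ⟩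
  2 ℕ.^ suc (p ℕ.+ q)
      ≤⟨ ℕ.^-monoʳ-≤ 2 (ℕ.≤-trans (s≤s (ℕ.m≤n+m (p ℕ.+ q) J))
      (ℕ.≤-reflexive (cong (suc J ℕ.+_) (sym (ℕ.*-distribʳ-+ (suc J) d e))))) ⟩
  2 ℕ.^ (suc (d ℕ.+ e) ℕ.* suc J)                 ∎
  where open ℕ.≤-Reasoning

2^-dominates : ∀ A B → ∃[ j ] A ℕ.* j ℕ.+ B ℕ.< 2 ℕ.^ j
-- The witness is 2r for r = 2A + B: then 2rA + B ≤ r² + 2r < (r+1)² ≤ 2^(2r).
2^-dominates A B = r ℕ.+ r , (begin-strict
  A ℕ.* (r ℕ.+ r) ℕ.+ B          ≤⟨ ℕ.m≤m+n _ (B ℕ.* r) ⟩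
  A ℕ.* (r ℕ.+ r) ℕ.+ B ℕ.+ B ℕ.* r ≡⟨ l A B r ⟩
  r ℕ.* r ℕ.+ B                  ≤⟨ ℕ.+-monoʳ-≤ (r ℕ.* r) (ℕ.≤-trans (ℕ.m≤n+m B (A ℕ.+ A)) (ℕ.m≤m+n r (r ℕ.+ 0))) ⟩
  r ℕ.* r ℕ.+ 2 ℕ.* r            <⟨ ℕ.≤-reflexive (l′ r) ⟩
  suc r ℕ.* suc r                ≤⟨ ℕ.*-mono-≤ (n<2^n r) (n<2^n r) ⟩
  2 ℕ.^ r ℕ.* 2 ℕ.^ r            ≡⟨ ℕ.^-distribˡ-+-* 2 r r ⟨
  2 ℕ.^ (r ℕ.+ r)                ∎)
  where
  open ℕ.≤-Reasoning
  r = A ℕ.+ A ℕ.+ B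
  l : ∀ A B r → A ℕ.* (r ℕ.+ r) ℕ.+ B ℕ.+ B ℕ.* r ≡ (A ℕ.+ A ℕ.+ B) ℕ.* r ℕ.+ B
  l = solveℕ 3 (λ A B r → A :*ℕ (r :+ℕ r) :+ℕ B :+ℕ B :*ℕ r :=ℕ (A :+ℕ A :+ℕ B) :*ℕ r :+ℕ B) refl
  l′ : ∀ r → suc (r ℕ.* r ℕ.+ 2 ℕ.* r) ≡ suc r ℕ.* suc r
  l′ = solveℕ 1 (λ r → conℕ 1 :+ℕ (r :*ℕ r :+ℕ conℕ 2 :*ℕ r) :=ℕ (conℕ 1 :+ℕ r) :*ℕ (conℕ 1 :+ℕ r)) refl

-- Evaluation of terms

-- The invariant of evaluation: all answers of `p` are those of one fixed name of `x`. The existence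
-- of the name comes from the specification of the strategy, and `p` need not be known to halt.
record Good (δ : Representation C) (p : Process) (X : Ty) (x : ⟦ X ⟧) : Set where
  constructor good
  field
    name  : 𝓜
    valid : names δ X name x
    sound : Sound p (fn name)

Γ₂ : List Ty
Γ₂ = real ∷ real ∷ []

line kink square : Term Γ₂ cont
line   = app primit (app constant (var (here refl)))
kink   = app maximum ⟪ line , app constant (var (here refl)) ⟫
square = app multiply ⟪ line , line ⟫

rampᴿ parabolaᴿ : ℝ → ℝ → ℝ
rampᴿ b x     = b *ᴿ (x -ᴿ -1ᴿ) ⊔ᴿ b
parabolaᴿ b x = (b *ᴿ (x -ᴿ -1ᴿ)) *ᴿ (b *ᴿ (x -ᴿ -1ᴿ))

module Evaluation {δ : Representation C} (S : Strategy δ) where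
  open Strategy S

  apply-good : ∀ {X Y p} (o : Op X Y) {x} → Good δ p X x → dom ⟦ o ⟧op x →
    Σ[ y ∈ ⟦ Y ⟧ ] rel ⟦ o ⟧op x y × Good δ (Run (op-algorithm o) p) Y y
  apply-good o {x} (good ψ name sound) defined =
    let F , computes , realises = op-realises o
        d , y , name′ , r = realises ψ x name defined
    in y , r , good (apply F ψ d) name′ (run-sound (op-algorithm o) sound (computes ψ d))

  pair-good : ∀ {X Y p q x y} → Good δ p X x → Good δ q Y y → Good δ (Bundle (finite 2) (pair p q)) (X ⊗ Y) (x , y)
  pair-good {p = p} {q} (good φ name sound) (good ψ name′ sound′) =
    good (φ ⊗𝓜 ψ) (φ , ψ , name , name′ , λ _ → refl)
        (bundle-sound (finite 2) {ps = pair p q} {φs = pair (fn φ) (fn ψ)} λ { 0F → sound ; 1F → sound′ })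

  module _ {env : ∀ {X} → X ∈ Γ₂ → Process} {b} (b-good : Good δ (env (here refl)) real b) where

    constant-good : Σ[ f ∈ C ] (∀ t → fun f t ≈ b) × Good δ (evaluate S (app constant (var (here refl))) env) cont f
    constant-good = apply-good constant b-good tt

    line-good : Σ[ f ∈ C ] (∀ t → fun f t ≈ b *ᴿ (val t -ᴿ -1ᴿ)) × Good δ (evaluate S line env) cont f
    line-good =
      let c , c≈ , c-good = constant-good
          f , f∫ , f-good = apply-good primit c-good tt
      in f , (λ t → integral-constant (fun c) b c≈ t (fun f t) (f∫ t)) , f-good

    kink-good : Σ[ f ∈ C ] (∀ t → fun f t ≈ rampᴿ b (val t)) × Good δ (evaluate S kink env) cont f
    kink-good =
      let c , c≈ , c-good = constant-good
          l , l≈ , l-good = line-good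
          f , f≈ , f-good = apply-good maximum (pair-good l-good c-good) tt
      in f , (λ t → let m = b *ᴿ (val t -ᴿ -1ᴿ) in ≈-trans (fun f t) (fun l t ⊔ᴿ fun c t) (m ⊔ᴿ b) (f≈ t)
                      (⊔ᴿ-cong (fun l t) m (fun c t) b (l≈ t) (c≈ t))) , f-good

    square-good : Σ[ f ∈ C ] (∀ t → fun f t ≈ parabolaᴿ b (val t)) × Good δ (evaluate S square env) cont f
    square-good =
      let l , l≈ , l-good = line-good
          f , f≈ , f-good = apply-good multiply (pair-good l-good l-good) tt
      in f , (λ t → let m = b *ᴿ (val t -ᴿ -1ᴿ) in ≈-trans (fun f t) (fun l t *ᴿ fun l t) (m *ᴿ m) (f≈ t)
                      (*ᴿ-cong (fun l t) m (fun l t) m (l≈ t) (l≈ t))) , f-good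

-- Names of equal length are bundled without padding, so that unpack reverses pack at once.
module Inputs (δ : Representation C) (wb wx : Str) (same : length wb ≡ length wx) where

  φ : 𝓜
  φ = constant𝓜 wb ⊗𝓜 constant𝓜 wx

  vs : Values Γ₂
  vs = fromℚ (dyadic wb) ∷ fromℚ (dyadic wx) ∷ []

  env : ∀ {X} → X ∈ Γ₂ → Process
  env i = projection {2} φ (index i)

  b-good : Good δ (env (here refl)) real (fromℚ (dyadic wb))
  b-good = good (constant𝓜 wb) (ρ-constant wb) (constants-sound wb wx same 0F)

  x-good : Good δ (env (there (here refl))) real (fromℚ (dyadic wx))
  x-good = good (constant𝓜 wx) (ρ-constant wx) (constants-sound wb wx same 1F)

  names-values : (S : Strategy δ) → NamesValues S φ vs
  names-values S = pair (constant𝓜 wb) (constant𝓜 wx) ,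
    (λ { (here refl) → ρ-constant wb ; (there (here refl)) → ρ-constant wx }) , ⊗𝓜-tuple (constant𝓜 wb) (constant𝓜 wx)

  x-InI : - 1ℚ ≤ dyadic wx → dyadic wx ≤ 1ℚ → ∀ x → x ≈ fromℚ (dyadic wx) → InI x
  x-InI l u x x≈ = ≤ᴿ-trans -1ᴿ d x (fromℚ-mono l) (≈⇒≤ᴿ d x (≈-sym x d x≈)) , ≤ᴿ-trans x d 1ᴿ (≈⇒≤ᴿ x d x≈) (fromℚ-mono u)
    where d = fromℚ (dyadic wx)

-- Evaluation at a point and the choice of the exponent

evalAt : Term Γ₂ cont → Term Γ₂ real
evalAt f = app eval ⟪ f , var (there (here refl)) ⟫

-- `k` is the exponent of b, and 2^r exceeds the time allowed on names of length 3 + k. The exponent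
-- `r` can be chosen logarithmic in `k`, so that even the threshold 2^(2r+8) for long names stays
-- below 2^k.
record Scale (P : Poly₂) : Set where
  field
    k r   : ℕ
    large : r ℕ.+ r ℕ.+ 8 ℕ.< k
    cheap : ∀ v w → length v ≡ 3 ℕ.+ k → length w ≡ 3 ℕ.+ k → ⟦ P ⟧₂ (size (constant𝓜 v ⊗𝓜 constant𝓜 w)) 0 ℕ.< 2 ℕ.^ r

scale : ∀ P → Scale P
scale P = record { k = k ; r = r ; large = large ; cheap = cheap }
  where
  e = proj₁ (poly₂-bound P)
  -- With k = 2^j and r = e(j+4) + 1, the requirement 2r + 8 < k reads 2ej + 8e + 10 < 2^j.
  choice = 2^-dominates (e ℕ.+ e) ((e ℕ.+ e) ℕ.* 4 ℕ.+ 10)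
  j = proj₁ choice
  k = 2 ℕ.^ j
  r = suc (e ℕ.* suc (3 ℕ.+ j))
  large : r ℕ.+ r ℕ.+ 8 ℕ.< k
  large = subst (ℕ._< k) (l e j) (proj₂ choice)
    where
    l : ∀ e j → (e ℕ.+ e) ℕ.* j ℕ.+ ((e ℕ.+ e) ℕ.* 4 ℕ.+ 10) ≡ suc (e ℕ.* suc (3 ℕ.+ j)) ℕ.+ suc (e ℕ.* suc (3 ℕ.+ j)) ℕ.+ 8
    l = solveℕ 2 (λ e j → (e :+ℕ e) :*ℕ j :+ℕ ((e :+ℕ e) :*ℕ conℕ 4 :+ℕ conℕ 10) :=ℕ
      (conℕ 1 :+ℕ e :*ℕ (conℕ 4 :+ℕ j)) :+ℕ (conℕ 1 :+ℕ e :*ℕ (conℕ 4 :+ℕ j)) :+ℕ conℕ 8) refl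
  4+k≤ : 4 ℕ.+ k ℕ.≤ 2 ℕ.^ (3 ℕ.+ j)
  4+k≤ = ℕ.≤-trans (ℕ.+-mono-≤ (ℕ.*-monoʳ-≤ 4 (ℕ.m^n>0 2 j)) (ℕ.m≤m+n k (3 ℕ.* k))) (ℕ.≤-reflexive (l k))
    where
    l : ∀ k → 4 ℕ.* k ℕ.+ (k ℕ.+ 3 ℕ.* k) ≡ 2 ℕ.* (2 ℕ.* (2 ℕ.* k))
    l = solveℕ 1 (λ k → conℕ 4 :*ℕ k :+ℕ (k :+ℕ conℕ 3 :*ℕ k) :=ℕ conℕ 2 :*ℕ (conℕ 2 :*ℕ (conℕ 2 :*ℕ k))) refl
  cheap : ∀ v w → length v ≡ 3 ℕ.+ k → length w ≡ 3 ℕ.+ k → ⟦ P ⟧₂ (size (constant𝓜 v ⊗𝓜 constant𝓜 w)) 0 ℕ.< 2 ℕ.^ r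
  cheap v w ∣v∣ ∣w∣ = ℕ.≤-<-trans
    (proj₂ (poly₂-bound P) (3 ℕ.+ j) (size (constant𝓜 v ⊗𝓜 constant𝓜 w)) 0
      (λ m → ℕ.≤-trans (constants-size v w (trans ∣v∣ (sym ∣w∣)) m)
          (subst (λ n → suc n ℕ.≤ 2 ℕ.^ (3 ℕ.+ j)) (sym ∣v∣) 4+k≤)) z≤n)
    (ℕ.^-monoʳ-< 2 (s≤s (s≤s z≤n)) (ℕ.n<1+n (e ℕ.* suc (3 ℕ.+ j))))

pow : ℕ → ℚ
pow n = fromℕℚ (2 ℕ.^ n)

-- The length 3 + k is what 2^k takes: a sign, the terminator of the empty unary exponent and k + 1
-- binary digits. The words for 0 and 1 are padded to it by leading zeros.
module Words (k : ℕ) where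

  2^k-word : ∃[ w ] length w ≡ 3 ℕ.+ k × dyadic w ≡ pow k
  2^k-word = let w , ∣w∣ , e = represent (3 ℕ.+ k) 0 (2 ℕ.^ k) (s≤s (s≤s z≤n)) (ℕ.^-monoʳ-< 2 (s≤s (s≤s z≤n)) (ℕ.n<1+n k))
             in w , ∣w∣ , trans e (*-identityˡ (fromℕℚ (2 ℕ.^ k)))

  0-word : ∃[ w ] length w ≡ 3 ℕ.+ k × dyadic w ≡ 0ℚ
  0-word = let w , ∣w∣ , e = represent (3 ℕ.+ k) 0 0 (s≤s (s≤s z≤n)) (ℕ.m^n>0 2 (suc k)) in w , ∣w∣ , trans e refl

  1-word : ∃[ w ] length w ≡ 3 ℕ.+ k × dyadic w ≡ 1ℚ
  1-word = let w , ∣w∣ , e = represent (3 ℕ.+ k) 0 1 (s≤s (s≤s z≤n)) (ℕ.^-monoʳ-< 2 (s≤s (s≤s z≤n)) (s≤s (z≤n {k}))) in w , ∣w∣ , trans e refl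

-- Evaluations too short to read a name

Evaluates : ∀ {δ} → Strategy δ → (ℚ → ℚ → ℚ) → Term Γ₂ cont → Set₁
Evaluates {δ} S F t = (env : ∀ {X} → X ∈ Γ₂ → Process) (β : ℚ) → Good δ (env (here refl)) real (fromℚ β) →
  Σ[ f ∈ C ] Matches f (F β) × Good δ (evaluate S t env) cont f

rampᴿ-rational : ∀ β q → rampᴿ (fromℚ β) (fromℚ q) ≈ fromℚ (ramp β q)
rampᴿ-rational β q = ≈-pointwise (rampᴿ (fromℚ β) (fromℚ q)) (fromℚ (ramp β q)) λ _ → refl

parabolaᴿ-rational : ∀ β q → parabolaᴿ (fromℚ β) (fromℚ q) ≈ fromℚ (parabola β q)
parabolaᴿ-rational β q = ≈-pointwise (parabolaᴿ (fromℚ β) (fromℚ q)) (fromℚ (parabola β q)) λ _ → refl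

ramp-matches : ∀ β f → (∀ t → fun f t ≈ rampᴿ (fromℚ β) (val t)) → Matches f (ramp β)
ramp-matches β f h q l u = ≈-trans (fun f (rational q l u)) (rampᴿ (fromℚ β) (val (rational q l u))) (fromℚ (ramp β q))
  (h (rational q l u)) (rampᴿ-rational β q)

parabola-matches : ∀ β f → (∀ t → fun f t ≈ parabolaᴿ (fromℚ β) (val t)) → Matches f (parabola β)
parabola-matches β f h q l u = ≈-trans (fun f (rational q l u)) (parabolaᴿ (fromℚ β) (val (rational q l u)))
    (fromℚ (parabola β q))
  (h (rational q l u)) (parabolaᴿ-rational β q)

kink-evaluates : ∀ {δ} (S : Strategy δ) → Evaluates S ramp kink
kink-evaluates S env β b-good = let f , f≈ , f-good = Evaluation.kink-good S {env} {fromℚ β} b-good in f , ramp-matches β f f≈ , f-good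

square-evaluates : ∀ {δ} (S : Strategy δ) → Evaluates S parabola square
square-evaluates S env β b-good = let f , f≈ , f-good = Evaluation.square-good S {env} {fromℚ β} b-good in f , parabola-matches β f f≈ , f-good

kink-defined : ∀ vs → Defined kink vs
kink-defined vs = (((tt , λ _ _ → tt) , λ _ _ → tt) , (tt , λ _ _ → tt)) , λ _ _ → tt

square-defined : ∀ vs → Defined square vs
square-defined vs = (((tt , λ _ _ → tt) , λ _ _ → tt) , ((tt , λ _ _ → tt) , λ _ _ → tt)) , λ _ _ → tt

module EvalAt {δ} (S : Strategy δ) {F t} (evaluates : Evaluates S F t)
              (wb wx : Str) (same : length wb ≡ length wx) (l : - 1ℚ ≤ dyadic wx) (u : dyadic wx ≤ 1ℚ) where
  open Strategy S
  open Inputs δ wb wx same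
  open Evaluation S

  f : C
  f = proj₁ (evaluates env (dyadic wb) b-good)

  f-matches : Matches f (F (dyadic wb))
  f-matches = proj₁ (proj₂ (evaluates env (dyadic wb) b-good))

  f-good : Good δ (evaluate S t env) cont f
  f-good = proj₂ (proj₂ (evaluates env (dyadic wb) b-good))

  InI-x : InI (fromℚ (dyadic wx))
  InI-x = fromℚ-mono l , fromℚ-mono u

  evalAt-defined : Defined t vs → Defined (evalAt t) vs
  evalAt-defined d = (d , tt) , λ (_ , x) (_ , x≈) → x-InI l u x x≈

  evalAt-value : ∀ {v k} → evalₛ S (evalAt t) φ [] v k → ∣ dyadic v - F (dyadic wb) (dyadic wx) ∣ ≤ fromℕℚ 4
  evalAt-value {v} {k} run =
    let y , y≈ , good ψ name sound = apply-good eval {f , fromℚ (dyadic wx)} (pair-good f-good x-good) InI-x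
        r = F (dyadic wb) (dyadic wx)
    in subst (λ w → ∣ dyadic w - r ∣ ≤ fromℕℚ 4) (sym (sound [] v k run))
         (ρ-value ψ y name (≈-trans y (fun f (toI (fromℚ (dyadic wx)) InI-x)) (fromℚ r) (y≈ InI-x)
             (f-matches (dyadic wx) l u)))

  module _ {K} (long : ∀ m → K ℕ.≤ length (fn (Good.name f-good) (zeros m))) where

    -- A run too short to read any name of f answers without knowing f and x.
    blind-run : ∀ {v k} → evalₛ S (evalAt t) φ [] v k → k ℕ.< K → ∃[ k′ ] Run (op-algorithm eval) (oracle (λ _ → [])) [] v k′
    blind-run = blind (op-algorithm eval) (bundle-cost (Good.sound f-good) long)

module _ {δ} (S : Strategy δ) {F t} (defined : ∀ vs → Defined t vs) (evaluates : Evaluates S F t)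
         (varies : ∀ β → fromℕℚ 9 ≤ β → fromℕℚ 8 < ∣ F β 0ℚ - F β 1ℚ ∣) where

  -- Within the time bound, the evaluations at 0 and at 1 both become runs of one machine on one
  -- input against the oracle that always answers with the empty string, so they share their output.
  -- It would be within 4 of two values more than 8 apart.
  blind-contradiction : (∀ r → LongNames δ F (2 ℕ.^ r) (2 ℕ.^ (r ℕ.+ r ℕ.+ 8))) → ¬ EvaluatesInPolynomialTime S
  blind-contradiction long poly = <-irrefl refl (<-≤-trans (varies β 9≤β) apart≤8)
    where
    P = proj₁ (poly (evalAt t) (real ∷ real ∷ []) real)
    open Scale (scale P)
    open Words k
    wb = proj₁ 2^k-word
    w₀ = proj₁ 0-word
    w₁ = proj₁ 1-word
    β = dyadic wb
    β≡ : β ≡ pow k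
    β≡ = proj₂ (proj₂ 2^k-word)
    w₀≡ : dyadic w₀ ≡ 0ℚ
    w₀≡ = proj₂ (proj₂ 0-word)
    w₁≡ : dyadic w₁ ≡ 1ℚ
    w₁≡ = proj₂ (proj₂ 1-word)
    B<β : fromℕℚ (2 ℕ.^ (r ℕ.+ r ℕ.+ 8)) < β
    B<β = subst (fromℕℚ (2 ℕ.^ (r ℕ.+ r ℕ.+ 8)) <_) (sym β≡)
      (fromℕℚ-< {2 ℕ.^ (r ℕ.+ r ℕ.+ 8)} {2 ℕ.^ k} (ℕ.^-monoʳ-< 2 (s≤s (s≤s z≤n)) large))
    9≤β : fromℕℚ 9 ≤ β
    9≤β = ≤-trans (fromℕℚ-≤ {9} {2 ℕ.^ (r ℕ.+ r ℕ.+ 8)}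
        (ℕ.≤-trans (ℕ.m≤m+n 9 247) (ℕ.^-monoʳ-≤ 2 (ℕ.m≤n+m 8 (r ℕ.+ r))))) (<⇒≤ B<β)

    Outcome : Str → Set
    Outcome w = ∃₂ λ v k → Run (Strategy.op-algorithm S eval) (oracle (λ _ → [])) [] v k × ∣ dyadic v - F β
        (dyadic w) ∣ ≤ fromℕℚ 4

    outcome : ∀ w → length w ≡ 3 ℕ.+ k → - 1ℚ ≤ dyadic w → dyadic w ≤ 1ℚ → Outcome w
    outcome w ∣w∣ l u =
      let ∣wb∣ = proj₁ (proj₂ 2^k-word)
          same = trans ∣wb∣ (sym ∣w∣)
          open EvalAt S {F} {t} evaluates wb w same l u
          open Inputs δ wb w same
          v , steps , run , steps≤ = proj₂ (poly (evalAt t) (real ∷ real ∷ []) real) φ vs (names-values S)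
              (evalAt-defined (defined vs)) []
          name-long = long r β f (Good.name f-good) B<β f-matches (Good.valid f-good)
          steps′ , run′ = blind-run name-long run (ℕ.≤-<-trans steps≤ (cheap wb w ∣wb∣ ∣w∣))
      in v , steps′ , run′ , evalAt-value run

    at₀ : Outcome w₀
    at₀ = outcome w₀ (proj₁ (proj₂ 0-word)) (subst (- 1ℚ ≤_) (sym w₀≡) (≤ᵇ⇒≤ tt)) (subst (_≤ 1ℚ) (sym w₀≡) (≤ᵇ⇒≤ tt))

    at₁ : Outcome w₁
    at₁ = outcome w₁ (proj₁ (proj₂ 1-word)) (subst (- 1ℚ ≤_) (sym w₁≡) (≤ᵇ⇒≤ tt)) (subst (_≤ 1ℚ) (sym w₁≡) ≤-refl)

    same-output : proj₁ at₀ ≡ proj₁ at₁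
    same-output = exec-unique (Strategy.op-algorithm S eval) (λ _ _ _ (e , _) → e) (proj₁ (proj₂ (proj₂ at₀)))
        (proj₁ (proj₂ (proj₂ at₁)))

    apart≤8 : ∣ F β 0ℚ - F β 1ℚ ∣ ≤ fromℕℚ 8
    apart≤8 = ≤-trans (∣-∣-triangle (F β 0ℚ) (dyadic (proj₁ at₀)) (F β 1ℚ)) (+-mono-≤
      (subst (_≤ fromℕℚ 4) (∣p-q∣≡∣q-p∣ (dyadic (proj₁ at₀)) (F β 0ℚ))
          (subst (λ q → ∣ dyadic (proj₁ at₀) - F β q ∣ ≤ fromℕℚ 4) w₀≡ (proj₂ (proj₂ (proj₂ at₀)))))
      (subst (λ v → ∣ dyadic v - F β 1ℚ ∣ ≤ fromℕℚ 4) (sym same-output)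
          (subst (λ q → ∣ dyadic (proj₁ at₁) - F β q ∣ ≤ fromℕℚ 4) w₁≡ (proj₂ (proj₂ (proj₂ at₁))))))

ramp-varies : ∀ β → fromℕℚ 9 ≤ β → fromℕℚ 8 < ∣ ramp β 0ℚ - ramp β 1ℚ ∣
ramp-varies β 9≤β = <-≤-trans (fromℕℚ-< {8} {9} ℕ.≤-refl) (≤-trans 9≤β (≤-trans β≤ (-p≤∣p∣ (ramp β 0ℚ - ramp β 1ℚ))))
  where
  ramp0≤β : ramp β 0ℚ ≤ β
  ramp0≤β = ⊔-lub (≤-reflexive (l β)) ≤-refl
    where
    l : ∀ β → β * (0ℚ - - 1ℚ) ≡ β
    l = solve 1 (λ β → β :* (con 0ℚ :- con (- 1ℚ)) := β) refl
  β≤ : β ≤ - (ramp β 0ℚ - ramp β 1ℚ)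
  β≤ = ≤-by (+-mono-≤ ramp0≤β (p≤p⊔q (β * (1ℚ - - 1ℚ)) β)) (l β (ramp β 0ℚ) (ramp β 1ℚ))
    where
    l : ∀ β x y → (x + β * (1ℚ - - 1ℚ)) + - (x - y) ≡ (β + y) + β
    l = solve 3 (λ β x y → (x :+ β :* (con 1ℚ :- con (- 1ℚ))) :+ :- (x :- y) := (β :+ y) :+ β) refl

parabola-varies : ∀ β → fromℕℚ 9 ≤ β → fromℕℚ 8 < ∣ parabola β 0ℚ - parabola β 1ℚ ∣
parabola-varies β 9≤β = <-≤-trans (fromℕℚ-< {8} {9 ℕ.* 3} (ℕ.m≤m+n 9 18))
    (≤-trans (*-monoʳ-≤-nonNeg (fromℕℚ 3) 9≤β)
    (≤-trans 3β≤ (≤-trans (≤-reflexive (l β)) (-p≤∣p∣ (parabola β 0ℚ - parabola β 1ℚ)))))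
  where
  1≤β : 1ℚ ≤ β
  1≤β = ≤-trans (fromℕℚ-≤ {1} {9} (s≤s z≤n)) 9≤β
  0≤β : NonNegative β
  0≤β = nonNegative (≤-trans (0≤fromℕℚ 1) 1≤β)
  3β≤ : β * fromℕℚ 3 ≤ β * (β * fromℕℚ 3)
  3β≤ = *-monoˡ-≤-nonNeg β {{0≤β}} (*-monoʳ-≤-nonNeg (fromℕℚ 3) 1≤β)
  l : ∀ β → β * (β * fromℕℚ 3) ≡ - (parabola β 0ℚ - parabola β 1ℚ)
  l = solve 1 (λ β → β :* (β :* con (fromℕℚ 3)) := :-
      ((β :* (con 0ℚ :- con (- 1ℚ))) :* (β :* (con 0ℚ :- con (- 1ℚ))) :- (β :* (con 1ℚ :- con (- 1ℚ))) :*
      (β :* (con 1ℚ :- con (- 1ℚ))))) refl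

LongNames-weaken : ∀ {δ F K B B′} → B ℕ.≤ B′ → LongNames δ F K B → LongNames δ F K B′
LongNames-weaken {B = B} {B′} B≤B′ long β f φ B′<β = long β f φ (≤-<-trans (fromℕℚ-≤ {B} {B′} B≤B′) B′<β)

Poly-slow : ¬ Σ (Strategy Poly) EvaluatesInPolynomialTime
Poly-slow (S , poly) = blind-contradiction S {ramp} {kink} kink-defined (kink-evaluates S) ramp-varies
  (λ r → LongNames-weaken {Poly} {ramp} (ℕ.^-monoʳ-≤ 2 (bound r)) (Poly-long r)) poly
  where
  bound : ∀ r → 2 ℕ.* r ℕ.+ 4 ℕ.≤ r ℕ.+ r ℕ.+ 8
  bound r = ℕ.+-mono-≤ (ℕ.≤-reflexive (cong (r ℕ.+_) (ℕ.+-identityʳ r))) (ℕ.m≤m+n 4 4)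

PAff-slow : ¬ Σ (Strategy PAff) EvaluatesInPolynomialTime
PAff-slow (S , poly) = blind-contradiction S {parabola} {square} square-defined (square-evaluates S) parabola-varies
  (λ r → LongNames-weaken {PAff} {parabola} (bound r) (PAff-long (2 ℕ.^ r))) poly
  where
  bound : ∀ r → suc (2 ℕ.^ r) ℕ.≤ 2 ℕ.^ (r ℕ.+ r ℕ.+ 8)
  bound r = ℕ.^-monoʳ-< 2 (s≤s (s≤s z≤n))
      (ℕ.≤-trans (s≤s (ℕ.m≤m+n r r)) (ℕ.≤-trans (ℕ.≤-reflexive (ℕ.+-comm 1 (r ℕ.+ r))) (ℕ.+-monoʳ-≤ (r ℕ.+ r) (s≤s z≤n))))

-- Changing a name of Fun

-- If every index were hit, sending it to the position of an entry of `Q` that hits it would map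
-- `Fin M` into fewer positions; two indices would share an entry, against uniqueness. Decidability
-- turns this refutation into an actual index.
unhit : ∀ {A : Set} {M} (Hit : Fin M → A → Set) → (∀ i → Decidable (Hit i)) → (∀ a i j → Hit i a → Hit j a → i ≡ j) →
  (Q : List A) → length Q ℕ.< M → ∃[ i ] All (λ a → ¬ Hit i a) Q
unhit {M = M} Hit hit? unique Q fewer =
  let i , missed = Fin.¬∀⟶∃¬ M (λ i → Any (Hit i) Q) (λ i → Any.any? (hit? i) Q) not-all in i , All.¬Any⇒All¬ Q missed
  where
  not-all : ¬ (∀ i → Any (Hit i) Q)
  not-all h =
    let i , j , i<j , e = Fin.pigeonhole fewer (λ i → Any.index (h i))
    in Fin.<⇒≢ i<j (unique (List.lookup Q (Any.index (h i))) i j (Any.lookup-index (h i))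
         (subst (λ m → Hit j (List.lookup Q m)) (sym e) (Any.lookup-index (h j))))

∣-∣ᴿ<-rational : ∀ x y {p q r} → x ≈ fromℚ p → y ≈ fromℚ q → ∣ x -ᴿ y ∣ᴿ <ᴿ fromℚ r → ∣ p - q ∣ < r
∣-∣ᴿ<-rational x y {p} {q} {r} h k (η , η>0 , ev) =
  ev-const (ev-zip (λ n a b → bound n a (proj₁ b) (proj₂ b)) ev
      (ev-zip (λ _ a b → a , b) (h (½ * η) (half-pos η>0)) (k (½ * η) (half-pos η>0))))
  where
  bound : ∀ n → (seq x n - seq y n) ⊔ (- (seq x n - seq y n)) + η ≤ r → ∣ seq x n - p ∣ < ½ * η →
      ∣ seq y n - q ∣ < ½ * η → ∣ p - q ∣ < r
  bound n a b c = ≤-<-trans (∣-∣-triangle p (seq x n) q) (<-≤-trans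
    (+-mono-<-≤ (subst (_< ½ * η) (∣p-q∣≡∣q-p∣ (seq x n) p) b)
        (≤-trans (∣-∣-triangle (seq x n) (seq y n) q) (+-monoʳ-≤ ∣ seq x n - seq y n ∣ (<⇒≤ c))))
    (≤-trans (≤-reflexive (trans (l ∣ seq x n - seq y n ∣ (½ * η)) (cong (λ z → ∣ seq x n - seq y n ∣ + z) (half+half η))))
      (subst (λ z → z + η ≤ r) (p⊔-p≡∣p∣ (seq x n - seq y n)) a)))
    where
    l : ∀ a b → b + (a + b) ≡ a + (b + b)
    l = solve 2 (λ a b → b :+ (a :+ b) := a :+ (b :+ b)) refl

∣-∣ᴿ<-intro : ∀ {p q r} → ∣ p - q ∣ < r → ∣ fromℚ p -ᴿ fromℚ q ∣ᴿ <ᴿ fromℚ r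
∣-∣ᴿ<-intro {p} {q} {r} h = r - ∣ p - q ∣ , <-by h (l₁ ∣ p - q ∣ r) , always λ _ → ≤-reflexive
    (trans (cong (_+ (r - ∣ p - q ∣)) (p⊔-p≡∣p∣ (p - q))) (l₂ ∣ p - q ∣ r))
  where
  l₁ : ∀ d r → d + (r - d) ≡ r + 0ℚ
  l₁ = solve 2 (λ d r → d :+ (r :- d) := r :+ con 0ℚ) refl
  l₂ : ∀ d r → d + (r - d) ≡ r
  l₂ = solve 2 (λ d r → d :+ (r :- d) := r) refl

ρ-upper : ∀ φ y {r} → ρ φ y → y ≤ᴿ fromℚ r → dyadic (fn φ []) ≤ r + fromℕℚ 4
ρ-upper φ y {r} h k = ev-const (ev-zip (λ n a b → ≤-by (+-mono-≤ (≤-trans (p≤∣p∣ _) a) b) (l (dyadic (fn φ [])) (seq y n) r))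
  (ρ-near φ y h) (k 1ℚ (positive⁻¹ 1ℚ)))
  where
  l : ∀ d y r → ((d - y) + y) + (r + fromℕℚ 4) ≡ (fromℕℚ 3 + (r + 1ℚ)) + d
  l = solve 3 (λ d y r → ((d :- y) :+ y) :+ (r :+ con (fromℕℚ 4)) := (con (fromℕℚ 3) :+ (r :+ con 1ℚ)) :+ d) refl

-- As reals are sequences of rationals, a Lipschitz function on the rationals acts on them
-- entrywise, so a point of `C` is obtained by rational arithmetic alone. The inverse of the slope
-- is a parameter because for 2^k it is available as `2^- k`.
module Lipschitz (β β⁻¹ : ℚ) (0<β : 0ℚ < β) (0<β⁻¹ : 0ℚ < β⁻¹) (β*β⁻¹ : β * β⁻¹ ≡ 1ℚ)
                 (F : ℚ → ℚ) (lipschitz : ∀ p q → ∣ F p - F q ∣ ≤ β * ∣ p - q ∣) where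

  δ : ℚ → ℚ
  δ ε = β⁻¹ * ε

  δ-pos : ∀ {ε} → 0ℚ < ε → 0ℚ < δ ε
  δ-pos {ε} ε>0 = subst (_< δ ε) (*-zeroʳ β⁻¹) (*-monoʳ-<-pos β⁻¹ {{positive 0<β⁻¹}} ε>0)

  βδ : ∀ ε → β * δ ε ≡ ε
  βδ ε = trans (sym (*-assoc β β⁻¹ ε)) (trans (cong (_* ε) β*β⁻¹) (*-identityˡ ε))

  F-< : ∀ {p q ε} → ∣ p - q ∣ < δ ε → ∣ F p - F q ∣ < ε
  F-< {p} {q} {ε} h = ≤-<-trans (lipschitz p q) (subst (β * ∣ p - q ∣ <_) (βδ ε) (*-monoʳ-<-pos β {{positive 0<β}} h))

  lift : ℝ → ℝ
  lift x = mkℝ (λ n → F (seq x n)) λ ε ε>0 →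
    let N , h = cauchy x (δ ε) (δ-pos ε>0) in N , λ m n i j → F-< (h m n i j)

  lift-rational : ∀ x {q} → x ≈ fromℚ q → lift x ≈ fromℚ (F q)
  lift-rational x h ε ε>0 = ev-map (λ n → F-<) (h (δ ε) (δ-pos ε>0))

  lift-< : ∀ x y {d ε} → β * d ≤ ε → ∣ x -ᴿ y ∣ᴿ <ᴿ fromℚ d → ∣ lift x -ᴿ lift y ∣ᴿ <ᴿ fromℚ ε
  lift-< x y {d} {ε} βd≤ε (η , η>0 , ev) = β * η , subst (_< β * η) (*-zeroʳ β)
      (*-monoʳ-<-pos β {{positive 0<β}} η>0) , ev-map bound ev
    where
    bound : ∀ n → (seq x n - seq y n) ⊔ (- (seq x n - seq y n)) + η ≤ d →
      (F (seq x n) - F (seq y n)) ⊔ (- (F (seq x n) - F (seq y n))) + β * η ≤ ε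
    bound n a = ≤-trans (≤-trans
      (+-monoˡ-≤ (β * η) (subst (_≤ β * ∣ seq x n - seq y n ∣) (sym (p⊔-p≡∣p∣ (F (seq x n) - F (seq y n))))
          (lipschitz (seq x n) (seq y n))))
      (subst (_≤ β * d) (*-distribˡ-+ β ∣ seq x n - seq y n ∣ η) (*-monoˡ-≤-nonNeg β {{nonNegative (<⇒≤ 0<β)}}
        (subst (λ z → z + η ≤ d) (p⊔-p≡∣p∣ (seq x n - seq y n)) a)))) βd≤ε

  liftC : C
  liftC = record
    { fun        = λ x → lift (val x)
    ; continuous = λ x ε ε>0 → δ ε , δ-pos ε>0 , λ y → lift-< (val x) (val y) (≤-reflexive (βδ ε))
    }

unblock : Str → Str
unblock (true ∷ b ∷ w) = b ∷ unblock w
unblock _              = []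

unblock-⟨⟩ : ∀ u v → unblock ⟨ u , v ⟩ ≡ u
unblock-⟨⟩ []      v = refl
unblock-⟨⟩ (b ∷ u) v = cong (b ∷_) (unblock-⟨⟩ u v)

-- Pairing spends two bits on each bit of the first component. The factor 2 later makes room for
-- both the unary exponent and the digits of an exact value.
length-unblock : ∀ w → 2 ℕ.* length (unblock w) ℕ.≤ length w
length-unblock []              = z≤n
length-unblock (false ∷ w)     = z≤n
length-unblock (true ∷ [])     = z≤n
length-unblock (true ∷ b ∷ w)  = subst (ℕ._≤ 2 ℕ.+ length w) (sym (ℕ.*-suc 2 (length (unblock w))))
    (s≤s (s≤s (length-unblock w)))

-- Dyadic numbers as integers over powers of two

Integral : ℚ → Set
Integral q = ∃[ z ] q ≡ fromℤ z

integral-+ : ∀ {p q} → Integral p → Integral q → Integral (p + q)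
integral-+ (y , refl) (z , refl) = y ℤ.+ z , fromℤ-+ y z

integral-neg : ∀ {p} → Integral p → Integral (- p)
integral-neg (z , refl) = ℤ.- z , fromℤ-neg z

integral-* : ∀ {p q} → Integral p → Integral q → Integral (p * q)
integral-* (y , refl) (z , refl) = y ℤ.* z , fromℤ-* y z

integral-ℕ : ∀ n → Integral (fromℕℚ n)
integral-ℕ n = ℤ.+ n , refl

integral-abs : ∀ {p} → Integral p → ∃[ n ] ∣ p ∣ ≡ fromℕℚ n
integral-abs (ℤ.+ n , refl)      = n , 0≤p⇒∣p∣≡p (0≤fromℕℚ n)
integral-abs (ℤ.-[1+ n ] , refl) = suc n , trans (sym (∣-p∣≡∣p∣ (fromℤ ℤ.-[1+ n ])))
    (trans (cong ∣_∣ (fromℤ-neg ℤ.-[1+ n ])) (0≤p⇒∣p∣≡p (0≤fromℕℚ (suc n))))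

pow-+ : ∀ m n → pow m * pow n ≡ pow (m ℕ.+ n)
pow-+ m n = trans (fromℕℚ-* (2 ℕ.^ m) (2 ℕ.^ n)) (cong fromℕℚ (sym (ℕ.^-distribˡ-+-* 2 m n)))

magnitude-integral : ∀ w → Integral (pow (length w) * dyadic (false ∷ w))
magnitude-integral []          = ℤ.+ 0 , refl
magnitude-integral (true ∷ w)  = subst Integral
    (trans (l (pow (length w)) (dyadic (false ∷ w))) (cong (_* (½ * dyadic (false ∷ w))) (pow-+ 1 (length w))))
    (magnitude-integral w)
  where
  l : ∀ p d → p * d ≡ fromℕℚ 2 * p * (½ * d)
  l = solve 2 (λ p d → p :* d := con (fromℕℚ 2) :* p :* (con ½ :* d)) refl
magnitude-integral (false ∷ m) = integral-* (integral-ℕ (2 ℕ.^ suc (length m))) (integral-ℕ (binary m))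

dyadic-integral : ∀ u → Integral (pow (length u) * dyadic u)
dyadic-integral []          = ℤ.+ 0 , refl
dyadic-integral (false ∷ w) = subst Integral
    (trans (sym (*-assoc (fromℕℚ 2) (pow (length w)) (dyadic (false ∷ w))))
    (cong (_* dyadic (false ∷ w)) (pow-+ 1 (length w))))
  (integral-* (integral-ℕ 2) (magnitude-integral w))
dyadic-integral (true ∷ w)  = subst Integral (neg-distribʳ-* (pow (suc (length w))) (dyadic (false ∷ w)))
    (integral-neg (dyadic-integral (false ∷ w)))

-- A sign alone denotes 0. The two letters guaranteed here pay for the constant terms in `room`.
dyadic-short : ∀ u → dyadic u ≢ 0ℚ → 2 ℕ.≤ length u
dyadic-short []              h = ⊥-elim (h refl)
dyadic-short (false ∷ [])    h = ⊥-elim (h refl)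
dyadic-short (true ∷ [])     h = ⊥-elim (h refl)
dyadic-short (_ ∷ _ ∷ u)     h = s≤s (s≤s z≤n)

0<pow : ∀ n → 0ℚ < pow n
0<pow n = fromℕℚ-< {0} {2 ℕ.^ n} (ℕ.m^n>0 2 n)

sub-cong : ∀ x x′ y y′ → x ≡ x′ → y ≡ y′ → x - y ≡ x′ - y′
sub-cong _ _ _ _ refl refl = refl

difference-value : ∀ m a n t → n ℕ.≤ a → fromℕℚ a - fromℕℚ n ≡ pow m * t → 2^- m * fromℕℚ (a ℕ.∸ n) ≡ t
difference-value m a n t n≤a e = begin
  2^- m * fromℕℚ (a ℕ.∸ n)        ≡⟨ cong (2^- m *_) (trans subtract e) ⟩
  2^- m * (pow m * t)             ≡⟨ *-assoc (2^- m) (pow m) t ⟨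
  2^- m * pow m * t               ≡⟨ cong (_* t) (trans (*-comm (2^- m) (pow m)) (2^n*2^-n m)) ⟩
  1ℚ * t                          ≡⟨ *-identityˡ t ⟩
  t                               ∎
  where
  open ≡-Reasoning
  cancel : ∀ x y → x ≡ x + y - y
  cancel = solve 2 (λ x y → x := x :+ y :- y) refl
  subtract : fromℕℚ (a ℕ.∸ n) ≡ fromℕℚ a - fromℕℚ n
  subtract = trans (cancel (fromℕℚ (a ℕ.∸ n)) (fromℕℚ n))
    (sub-cong (fromℕℚ (a ℕ.∸ n) + fromℕℚ n) (fromℕℚ a) (fromℕℚ n) (fromℕℚ n)
        (trans (fromℕℚ-+ (a ℕ.∸ n) n) (cong fromℕℚ (ℕ.m∸n+n≡m n≤a))) refl)

-- A tent of height 16 and slope β = 2ᵏ centred at -e/β, on top of the flat part of the kink.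
module Bump (k e : ℕ) (16<2^k : 16 ℕ.< 2 ℕ.^ k) (16≤e : 16 ℕ.≤ e) where

  β H c : ℚ
  β = pow k
  H = fromℕℚ 16
  c = fromℕℚ e

  0≤β : NonNegative β
  0≤β = nonNegative (0≤fromℕℚ (2 ℕ.^ k))

  tent G : ℚ → ℚ
  tent q = (β + H) - ∣ β * q + c ∣
  G q    = ramp β q ⊔ tent q

  Hit : ℚ → Set
  Hit q = ∣ β * q + c ∣ < H

  β*-lipschitz : ∀ p q d → ∣ (β * (p + d)) - (β * (q + d)) ∣ ≡ β * ∣ p - q ∣
  β*-lipschitz p q d = trans (cong ∣_∣ (l β p q d))
      (trans (∣p*q∣≡∣p∣*∣q∣ β (p - q)) (cong (_* ∣ p - q ∣) (0≤p⇒∣p∣≡p (0≤fromℕℚ (2 ℕ.^ k)))))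
    where
    l : ∀ β p q d → (β * (p + d)) - (β * (q + d)) ≡ β * (p - q)
    l = solve 4 (λ β p q d → (β :* (p :+ d)) :- (β :* (q :+ d)) := β :* (p :- q)) refl

  0≤β∣∣ : ∀ d → 0ℚ ≤ β * ∣ d ∣
  0≤β∣∣ d = subst (_≤ β * ∣ d ∣) (*-zeroʳ β) (*-monoˡ-≤-nonNeg β {{0≤β}} (0≤∣p∣ d))

  G-lipschitz : ∀ p q → ∣ G p - G q ∣ ≤ β * ∣ p - q ∣
  G-lipschitz p q = ⊔-nonexpansive (ramp β p) (tent p) (ramp β q) (tent q)
    (⊔-nonexpansive (β * (p - - 1ℚ)) β (β * (q - - 1ℚ)) β (≤-reflexive (β*-lipschitz p q (- (- 1ℚ))))
      (subst (_≤ β * ∣ p - q ∣) (sym (cong ∣_∣ (+-inverseʳ β))) (0≤β∣∣ (p - q))))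
    (∣-∣≤ (half p q) (subst (λ d → tent q ≤ tent p + β * d) (∣p-q∣≡∣q-p∣ q p) (half q p)))
    where
    half : ∀ p q → tent p ≤ tent q + β * ∣ p - q ∣
    half p q = ≤-by (∣p+q∣≤∣p∣+∣q∣ (β * p + c) (β * q + c - (β * p + c)))
      (trans (cong (_+ (tent q + β * ∣ p - q ∣)) (cong ∣_∣ (l₁ (β * p + c) (β * q + c))))
        (trans (l₂ (∣ β * q + c ∣) (β + H) (β * ∣ p - q ∣) (∣ β * p + c ∣))
            (cong (λ d → ∣ β * p + c ∣ + d + tent p) (sym shift))))
      where
      l₁ : ∀ a b → a + (b - a) ≡ b
      l₁ = solve 2 (λ a b → a :+ (b :- a) := b) refl
      l₂ : ∀ b t d a → b + ((t - b) + d) ≡ (a + d) + (t - a)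
      l₂ = solve 4 (λ b t d a → b :+ ((t :- b) :+ d) := (a :+ d) :+ (t :- a)) refl
      l₃ : ∀ β p q c → β * q + c - (β * p + c) ≡ β * (q + 0ℚ) - β * (p + 0ℚ)
      l₃ = solve 4 (λ β p q c → β :* q :+ c :- (β :* p :+ c) := β :* (q :+ con 0ℚ) :- β :* (p :+ con 0ℚ)) refl
      shift : ∣ β * q + c - (β * p + c) ∣ ≡ β * ∣ p - q ∣
      shift = trans (cong ∣_∣ (l₃ β p q c)) (trans (β*-lipschitz q p 0ℚ) (cong (β *_) (∣p-q∣≡∣q-p∣ q p)))

  G-miss : ∀ q → ¬ Hit q → G q ≡ ramp β q
  G-miss q miss = p≥q⇒p⊔q≡p (≤-trans (≤-by (≮⇒≥ miss) (l H β ∣ β * q + c ∣)) (p≤q⊔p (β * (q - - 1ℚ)) β))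
    where
    l : ∀ H β d → H + β ≡ d + ((β + H) - d)
    l = solve 3 (λ H β d → H :+ β := d :+ ((β :+ H) :- d)) refl

  -- Since e ≥ 16, the open support of the tent lies left of 0, where the ramp does not exceed β,
  -- while the tent is above β there.
  G-hit : ∀ q → Hit q → G q ≡ tent q
  G-hit q hit = p≤q⇒p⊔q≡q (≤-trans ramp≤β (≤-by (<⇒≤ hit) (l ∣ β * q + c ∣ β H)))
    where
    l : ∀ d β H → d + ((β + H) - d) ≡ H + β
    l = solve 3 (λ d β H → d :+ ((β :+ H) :- d) := H :+ β) refl
    ramp≤β : ramp β q ≤ β
    ramp≤β = ⊔-lub (≤-by (+-mono-≤ (≤-trans (p≤∣p∣ (β * q + c)) (<⇒≤ hit)) (fromℕℚ-≤ {16} {e} 16≤e)) (l″ β q c H)) ≤-refl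
      where
      l″ : ∀ β q c H → (β * q + c + H) + β ≡ (H + c) + β * (q - - 1ℚ)
      l″ = solve 4 (λ β q c H → (β :* q :+ c :+ H) :+ β := (H :+ c) :+ β :* (q :- con (- 1ℚ))) refl

  hit⇒≢0 : ∀ {q} → Hit q → q ≢ 0ℚ
  hit⇒≢0 hit refl = <-irrefl refl (<-≤-trans hit (≤-trans (fromℕℚ-≤ {16} {e} 16≤e)
    (subst (_≤ ∣ β * 0ℚ + c ∣) (trans (cong (_+ c) (*-zeroʳ β)) (+-identityˡ c)) (p≤∣p∣ (β * 0ℚ + c)))))

  -- A word of L letters denotes a multiple of 2^-L, so the tent, having slope 2^k, takes there a
  -- multiple of 2^-m with m = L ∸ k. Its code has 2 + m letters for sign and exponent and m + k + 1
  -- digits, as the value is below 2^(k+1). Because m + 2 ≤ L, this fits into 2L + k.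
  module BumpWord (u : Str) (hit : Hit (dyadic u)) where

    q : ℚ
    q = dyadic u

    m a : ℕ
    m = length u ℕ.∸ k
    a = 2 ℕ.^ m ℕ.* (2 ℕ.^ k ℕ.+ 16)

    scaled-integral : Integral (pow m * (β * q + c))
    scaled-integral = subst Integral regroup (integral-+
        (integral-* (integral-ℕ (2 ℕ.^ extra)) (dyadic-integral u)) (integral-* (integral-ℕ (2 ℕ.^ m)) (integral-ℕ e)))
      where
      -- This is positive when `u` is shorter than `k`, since the subtraction in `m` is then cut off
      -- at 0.
      extra = (m ℕ.+ k) ℕ.∸ length u
      u≤ : length u ℕ.≤ m ℕ.+ k
      u≤ = ℕ.≤-trans (ℕ.m≤n+m∸n (length u) k) (ℕ.≤-reflexive (ℕ.+-comm k m))
      l : ∀ p b q c → p * b * q + p * c ≡ p * (b * q + c)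
      l = solve 4 (λ p b q c → p :* b :* q :+ p :* c := p :* (b :* q :+ c)) refl
      regroup : pow extra * (pow (length u) * q) + pow m * c ≡ pow m * (β * q + c)
      regroup = trans (cong (_+ pow m * c) (trans (sym (*-assoc (pow extra) (pow (length u)) q)) (cong (_* q)
        (trans (pow-+ extra (length u)) (trans (cong pow (ℕ.m∸n+n≡m u≤)) (sym (pow-+ m k))))))) (l (pow m) β q c)

    n₀ : ℕ
    n₀ = proj₁ (integral-abs scaled-integral)

    n₀≡ : pow m * ∣ β * q + c ∣ ≡ fromℕℚ n₀
    n₀≡ = trans (trans (cong (_* ∣ β * q + c ∣) (sym (0≤p⇒∣p∣≡p (0≤fromℕℚ (2 ℕ.^ m)))))
        (sym (∣p*q∣≡∣p∣*∣q∣ (pow m) (β * q + c))))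
      (proj₂ (integral-abs scaled-integral))

    a≡ : fromℕℚ a ≡ pow m * (β + H)
    a≡ = trans (sym (fromℕℚ-* (2 ℕ.^ m) (2 ℕ.^ k ℕ.+ 16))) (cong (pow m *_) (sym (fromℕℚ-+ (2 ℕ.^ k) 16)))

    n₀≤a : n₀ ℕ.≤ a
    n₀≤a = fromℕℚ-cancel-≤ {n₀} {a} (subst₂ _≤_ n₀≡ (sym a≡) (*-monoˡ-≤-nonNeg (pow m) {{nonNegative (0≤fromℕℚ (2 ℕ.^ m))}}
      (≤-trans (<⇒≤ hit) (≤-by (0≤fromℕℚ (2 ℕ.^ k)) (+-identityˡ (β + H))))))

    difference : fromℕℚ a - fromℕℚ n₀ ≡ pow m * tent q
    difference = trans (sub-cong (fromℕℚ a) (pow m * (β + H)) (fromℕℚ n₀) (pow m * ∣ β * q + c ∣) a≡ (sym n₀≡))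
        (l (pow m) (β + H) (∣ β * q + c ∣))
      where
      l : ∀ p t d → p * t - p * d ≡ p * (t - d)
      l = solve 3 (λ p t d → p :* t :- p :* d := p :* (t :- d)) refl

    A<2^ : a ℕ.∸ n₀ ℕ.< 2 ℕ.^ (m ℕ.+ suc k)
    A<2^ = ℕ.≤-<-trans (ℕ.m∸n≤m a n₀) (subst (a ℕ.<_) (sym (ℕ.^-distribˡ-+-* 2 m (suc k)))
      (ℕ.*-monoʳ-< (2 ℕ.^ m) {{ℕ.m^n≢0 2 m}} (ℕ.+-monoʳ-< (2 ℕ.^ k) (ℕ.<-≤-trans 16<2^k (ℕ.m≤m+n (2 ℕ.^ k) 0)))))

    room : 2 ℕ.+ m ℕ.+ (m ℕ.+ suc k) ℕ.≤ 2 ℕ.* length u ℕ.+ k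
    room = subst (ℕ._≤ 2 ℕ.* length u ℕ.+ k) (l m k) (ℕ.+-monoˡ-≤ k (ℕ.≤-trans (ℕ.n≤1+n _)
        (ℕ.≤-trans (ℕ.≤-reflexive (l′ m)) (ℕ.*-monoʳ-≤ 2 {2 ℕ.+ m} {length u} 2+m≤))))
      where
      l : ∀ m k → 3 ℕ.+ 2 ℕ.* m ℕ.+ k ≡ 2 ℕ.+ m ℕ.+ (m ℕ.+ suc k)
      l = solveℕ 2 (λ m k → conℕ 3 :+ℕ conℕ 2 :*ℕ m :+ℕ k :=ℕ conℕ 2 :+ℕ m :+ℕ (m :+ℕ (conℕ 1 :+ℕ k))) refl
      l′ : ∀ m → suc (3 ℕ.+ 2 ℕ.* m) ≡ 2 ℕ.* (2 ℕ.+ m)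
      l′ = solveℕ 1 (λ m → conℕ 4 :+ℕ conℕ 2 :*ℕ m :=ℕ conℕ 2 :*ℕ (conℕ 2 :+ℕ m)) refl
      2≤k : 2 ℕ.≤ k
      2≤k = ℕ.≮⇒≥ λ k<2 → ℕ.<-irrefl refl (ℕ.<-≤-trans 16<2^k (ℕ.≤-trans (ℕ.^-monoʳ-≤ 2 (ℕ.<⇒≤ k<2)) (ℕ.m≤m+n 4 12)))
      2≤u : 2 ℕ.≤ length u
      2≤u = dyadic-short u (hit⇒≢0 hit)
      2+m≤ : 2 ℕ.+ m ℕ.≤ length u
      2+m≤ = ℕ.≤-trans (ℕ.+-monoʳ-≤ 2 (ℕ.∸-monoʳ-≤ (length u) 2≤k)) (ℕ.≤-reflexive (ℕ.m+[n∸m]≡n 2≤u))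

    bump-word : ∀ n → 2 ℕ.* length u ℕ.+ k ℕ.≤ n → ∃[ v ] length v ≡ n × dyadic v ≡ G (dyadic u)
    bump-word n ≤n =
      let v , ∣v∣ , v≡ = represent n m (a ℕ.∸ n₀) (ℕ.m+n≤o⇒m≤o (2 ℕ.+ m) enough)
            (ℕ.<-≤-trans A<2^ (ℕ.^-monoʳ-≤ 2
                (ℕ.m+n≤o⇒m≤o∸n (m ℕ.+ suc k) (subst (ℕ._≤ n) (ℕ.+-comm (2 ℕ.+ m) (m ℕ.+ suc k)) enough))))
      in v , ∣v∣ , trans v≡ (trans (difference-value m a n₀ (tent q) n₀≤a difference) (sym (G-hit q hit)))
      where
      enough : 2 ℕ.+ m ℕ.+ (m ℕ.+ suc k) ℕ.≤ n
      enough = ℕ.≤-trans room ≤n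

  open Lipschitz β (2^- k) (0<pow k) (2^-pos k) (2^n*2^-n k) G G-lipschitz public

pow*2^-≤ : ∀ n k s → n ℕ.+ k ℕ.≤ s → pow k * 2^- s ≤ 2^- n
pow*2^-≤ n k s h = *-cancelˡ-≤-pos (pow n) {{positive (0<pow n)}} (begin
  pow n * (pow k * 2^- s) ≡⟨ *-assoc (pow n) (pow k) (2^- s) ⟨
  pow n * pow k * 2^- s   ≡⟨ cong (_* 2^- s) (pow-+ n k) ⟩
  pow (n ℕ.+ k) * 2^- s   ≤⟨ *-monoʳ-≤-nonNeg (2^- s) {{nonNegative (<⇒≤ (2^-pos s))}}
      (fromℕℚ-≤ {2 ℕ.^ (n ℕ.+ k)} {2 ℕ.^ s} (ℕ.^-monoʳ-≤ 2 h)) ⟩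
  pow s * 2^- s           ≡⟨ 2^n*2^-n s ⟩
  1ℚ                      ≡⟨ 2^n*2^-n n ⟨
  pow n * 2^- n           ∎)
  where open ≤-Reasoning

2^-≤pow* : ∀ n k s → s ℕ.≤ n ℕ.+ k → 2^- n ≤ pow k * 2^- s
2^-≤pow* n k s h = *-cancelˡ-≤-pos (pow n) {{positive (0<pow n)}} (begin
  pow n * 2^- n           ≡⟨ 2^n*2^-n n ⟩
  1ℚ                      ≡⟨ 2^n*2^-n s ⟨
  pow s * 2^- s           ≤⟨ *-monoʳ-≤-nonNeg (2^- s) {{nonNegative (<⇒≤ (2^-pos s))}}
      (fromℕℚ-≤ {2 ℕ.^ s} {2 ℕ.^ (n ℕ.+ k)} (ℕ.^-monoʳ-≤ 2 h)) ⟩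
  pow (n ℕ.+ k) * 2^- s   ≡⟨ cong (_* 2^- s) (pow-+ n k) ⟨
  pow n * pow k * 2^- s   ≡⟨ *-assoc (pow n) (pow k) (2^- s) ⟩
  pow n * (pow k * 2^- s) ∎)
  where open ≤-Reasoning

dec-elim : ∀ {A B : Set} → Dec A → (A → B) → (¬ A → B) → B
dec-elim (yes a) f g = f a
dec-elim (no ¬a) f g = g ¬a

∣-∣ᴿ-respʳ : ∀ x y y′ r → y ≈ y′ → ∣ x -ᴿ y ∣ᴿ ≤ᴿ r → ∣ x -ᴿ y′ ∣ᴿ ≤ᴿ r
∣-∣ᴿ-respʳ x y y′ r e = ≤ᴿ-trans (∣ x -ᴿ y′ ∣ᴿ) (∣ x -ᴿ y ∣ᴿ) r (≈⇒≤ᴿ (∣ x -ᴿ y′ ∣ᴿ) (∣ x -ᴿ y ∣ᴿ)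
    (⊔ᴿ-cong (x -ᴿ y′) (x -ᴿ y) (-ᴿ (x -ᴿ y′)) (-ᴿ (x -ᴿ y)) d (-ᴿ-cong (x -ᴿ y′) (x -ᴿ y) d)))
  where
  d : x -ᴿ y′ ≈ x -ᴿ y
  d = +ᴿ-cong x x (-ᴿ y′) (-ᴿ y) (≈-refl x) (-ᴿ-cong y′ y (≈-sym y y′ e))

ramp-at : ∀ β f → (∀ t → fun f t ≈ rampᴿ (fromℚ β) (val t)) → ∀ x {q} → val x ≈ fromℚ q → fun f x ≈ fromℚ (ramp β q)
ramp-at β f f≈ x {q} e = ≈-trans (fun f x) (rampᴿ (fromℚ β) (val x)) (fromℚ (ramp β q)) (f≈ x)
  (≈-trans (rampᴿ (fromℚ β) (val x)) (rampᴿ (fromℚ β) (fromℚ q)) (fromℚ (ramp β q))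
    (⊔ᴿ-cong (fromℚ β *ᴿ (val x -ᴿ -1ᴿ)) (fromℚ β *ᴿ (fromℚ q -ᴿ -1ᴿ)) (fromℚ β) (fromℚ β)
      (*ᴿ-cong (fromℚ β) (fromℚ β) (val x -ᴿ -1ᴿ) (fromℚ q -ᴿ -1ᴿ) (≈-refl (fromℚ β))
        (+ᴿ-cong (val x) (fromℚ q) (-ᴿ -1ᴿ) (-ᴿ -1ᴿ) e (≈-refl (-ᴿ -1ᴿ)))) (≈-refl (fromℚ β)))
    (rampᴿ-rational β q))

-- The kink has slope 2ᵏ, so the modulus in its name also admits the tent, and the answers
-- are long enough to hold the exact values of the tent.
module Modulus (k : ℕ) (f : C) (f≈ : ∀ t → fun f t ≈ rampᴿ (fromℚ (pow k)) (val t)) (φ : 𝓜) (named : Fun φ f) where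

  size-large : ∀ n → n ℕ.+ k ℕ.≤ size φ n
  size-large n = ℕ.≮⇒≥ λ m< → <-irrefl refl
      (≤-<-trans (2^-≤pow* n k (suc m) m<) (≤-<-trans rise (∣-∣ᴿ<-rational (fun f x) (fun f y) {ramp β 0ℚ} {ramp β h}
      (ramp-at β f f≈ x {0ℚ} (≈-refl (fromℚ 0ℚ))) (ramp-at β f f≈ y {h} (≈-refl (fromℚ h))) (proj₂ named x y n near))))
    where
    m = size φ n
    β = pow k
    -- Half of the radius `2^- m`, so that 0 and `h` lie strictly within it; m + 1 ≤ n + k then
    -- makes the rise 2^k·h at least `2^- n`.
    h = 2^- suc m
    -1≤0 : - 1ℚ ≤ 0ℚ
    -1≤0 = ≤ᵇ⇒≤ tt
    0≤h : 0ℚ ≤ h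
    0≤h = <⇒≤ (2^-pos (suc m))
    x = rational 0ℚ -1≤0 (≤ᵇ⇒≤ tt)
    y = rational h (≤-trans -1≤0 0≤h) (2^-≤1 (suc m))
    near : ∣ val x -ᴿ val y ∣ᴿ <ᴿ fromℚ (2^- m)
    near = ∣-∣ᴿ<-intro {0ℚ} {h} {2^- m}
        (≤-<-trans (≤-reflexive (trans (∣p-q∣≡∣q-p∣ 0ℚ h) (trans (cong ∣_∣ (+-identityʳ h)) (0≤p⇒∣p∣≡p 0≤h))))
      (<-by (2^-pos (suc m)) (trans (+-identityˡ (2^- m)) (sym (half+half (2^- m))))))
    rise : β * h ≤ ∣ ramp β 0ℚ - ramp β h ∣
    rise = ≤-trans (≤-by (+-mono-≤ ramp0≤ (p≤p⊔q (β * (h - - 1ℚ)) β)) (l β h (ramp β 0ℚ) (ramp β h)))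
        (-p≤∣p∣ (ramp β 0ℚ - ramp β h))
      where
      ramp0≤ : ramp β 0ℚ ≤ β
      ramp0≤ = ⊔-lub (≤-reflexive (l₀ β)) ≤-refl
        where
        l₀ : ∀ β → β * (0ℚ - - 1ℚ) ≡ β
        l₀ = solve 1 (λ β → β :* (con 0ℚ :- con (- 1ℚ)) := β) refl
      l : ∀ β h x y → (x + β * (h - - 1ℚ)) + - (x - y) ≡ (β + y) + β * h
      l = solve 4 (λ β h x y → (x :+ β :* (h :- con (- 1ℚ))) :+ :- (x :- y) := (β :+ y) :+ β :* h) refl

-- The name φ changed, without changing any length, at the strings that ask for values inside the tent.
module Adversary (k e : ℕ) (16<2^k : 16 ℕ.< 2 ℕ.^ k) (16≤e : 16 ℕ.≤ e)
                 (f : C) (f≈ : ∀ t → fun f t ≈ rampᴿ (fromℚ (pow k)) (val t)) (φ : 𝓜) (named : Fun φ f) where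
  open Bump k e 16<2^k 16≤e
  open Modulus k f f≈ φ named

  Answer : Str → Set
  Answer w = Σ[ v ∈ Str ] length v ≡ size φ (length w) ×
      (Hit (dyadic (unblock w)) → dyadic v ≡ G (dyadic (unblock w))) × (¬ Hit (dyadic (unblock w)) → v ≡ fn φ w)

  answer-hit : ∀ w → Hit (dyadic (unblock w)) → Answer w
  answer-hit w hit = proj₁ bumped , proj₁ (proj₂ bumped) , (λ _ → proj₂ (proj₂ bumped)) , (λ miss → ⊥-elim (miss hit))
    where
    bumped : ∃[ v ] length v ≡ size φ (length w) × dyadic v ≡ G (dyadic (unblock w))
    bumped = BumpWord.bump-word (unblock w) hit (size φ (length w))
        (ℕ.≤-trans (ℕ.+-monoˡ-≤ k (length-unblock w)) (size-large (length w)))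

  answer-miss : ∀ w → ¬ Hit (dyadic (unblock w)) → Answer w
  answer-miss w miss = fn φ w , fn-length φ w , (λ hit → ⊥-elim (miss hit)) , (λ _ → refl)

  answer : ∀ w → Answer w
  answer w = dec-elim {Hit (dyadic (unblock w))} {Answer w} (∣ β * dyadic (unblock w) + c ∣ <? H) (answer-hit w)
      (answer-miss w)

  φ′ : 𝓜
  φ′ = mk𝓜 (λ w → proj₁ (answer w)) λ u v u≤v →
      subst₂ ℕ._≤_ (sym (proj₁ (proj₂ (answer u)))) (sym (proj₁ (proj₂ (answer v)))) (size-mono φ u≤v)

  size-φ′ : ∀ n → size φ′ n ≡ size φ n
  size-φ′ n = trans (proj₁ (proj₂ (answer (zeros n)))) (cong (size φ) (length-zeros n))

  unchanged : ∀ w → ¬ Hit (dyadic (unblock w)) → fn φ′ w ≡ fn φ w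
  unchanged w = proj₂ (proj₂ (proj₂ (answer w)))

  -- Inside the tent the new answers are exact; outside, the raised function agrees with the kink
  -- and the answers are the old ones. Lengths are kept, so the modulus is the old one too, and n +
  -- k ≤ |φ|(n) makes it valid for any function of slope 2^k.
  φ′-named : Fun φ′ liftC
  φ′-named = values , modulus
    where
    values : ∀ u v x → val x ≈ fromℚ (dyadic u) →
        ∣ fromℚ (dyadic (fn φ′ ⟨ u , v ⟩)) -ᴿ fun liftC x ∣ᴿ ≤ᴿ fromℚ (2^- length v)
    values u v x x≈ = ∣-∣ᴿ-respʳ d (fromℚ (G q)) (fun liftC x) (fromℚ (2^- length v))
        (≈-sym (lift (val x)) (fromℚ (G q)) (lift-rational (val x) {q} x≈))
        (dec-elim (∣ β * q + c ∣ <? H) hit-case miss-case)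
      where
      q = dyadic u
      q≡ : dyadic (unblock ⟨ u , v ⟩) ≡ q
      q≡ = cong dyadic (unblock-⟨⟩ u v)
      d = fromℚ (dyadic (fn φ′ ⟨ u , v ⟩))
      hit-case : Hit q → ∣ d -ᴿ fromℚ (G q) ∣ᴿ ≤ᴿ fromℚ (2^- length v)
      hit-case hit = ≤ᴿ-pointwise (∣ d -ᴿ fromℚ (G q) ∣ᴿ) (fromℚ (2^- length v)) λ _ →
        subst (λ z → z ⊔ (- z) ≤ 2^- length v) (sym (trans (cong (_- G q) v≡) (+-inverseʳ (G q)))) (<⇒≤ (2^-pos (length v)))
        where
        v≡ : dyadic (fn φ′ ⟨ u , v ⟩) ≡ G q
        v≡ = trans (proj₁ (proj₂ (proj₂ (answer ⟨ u , v ⟩))) (subst Hit (sym q≡) hit)) (cong G q≡)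
      miss-case : ¬ Hit q → ∣ d -ᴿ fromℚ (G q) ∣ᴿ ≤ᴿ fromℚ (2^- length v)
      miss-case miss = ∣-∣ᴿ-respʳ d (fun f x) (fromℚ (G q)) (fromℚ (2^- length v))
        (≈-trans (fun f x) (fromℚ (ramp β q)) (fromℚ (G q)) (ramp-at β f f≈ x {q} x≈) (fromℚ-cong (sym (G-miss q miss))))
        (subst (λ w → ∣ fromℚ (dyadic w) -ᴿ fun f x ∣ᴿ ≤ᴿ fromℚ (2^- length v))
            (sym (unchanged ⟨ u , v ⟩ (λ hit → miss (subst Hit q≡ hit))))
          (proj₁ named u v x x≈))
    modulus : ∀ x y n → ∣ val x -ᴿ val y ∣ᴿ <ᴿ fromℚ (2^- size φ′ n) → ∣ fun liftC x -ᴿ fun liftC y ∣ᴿ <ᴿ fromℚ (2^- n)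
    modulus x y n = lift-< (val x) (val y)
        (subst (λ s → β * 2^- s ≤ 2^- n) (sym (size-φ′ n)) (pow*2^-≤ n k (size φ n) (size-large n)))

  module _ (c≤β : e ℕ.≤ 2 ℕ.^ k) where

    centre : ℚ
    centre = - (c * 2^- k)

    centre≤0 : centre ≤ 0ℚ
    centre≤0 = neg-antimono-≤ (subst (_≤ c * 2^- k) (*-zeroˡ (2^- k))
        (*-monoʳ-≤-nonNeg (2^- k) {{nonNegative (<⇒≤ (2^-pos k))}} (0≤fromℕℚ e)))

    -1≤centre : - 1ℚ ≤ centre
    -1≤centre = neg-antimono-≤ (subst (c * 2^- k ≤_) (2^n*2^-n k)
        (*-monoʳ-≤-nonNeg (2^- k) {{nonNegative (<⇒≤ (2^-pos k))}} (fromℕℚ-≤ {e} {2 ℕ.^ k} c≤β)))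

    peakI : I
    peakI = rational centre -1≤centre (≤-trans centre≤0 (≤ᵇ⇒≤ tt))

    peak-high : fromℚ (β + H) ≤ᴿ fun liftC peakI
    peak-high = ≤ᴿ-trans (fromℚ (β + H)) (fromℚ (G centre)) (lift (fromℚ centre)) (fromℚ-mono tent≤)
      (≈⇒≤ᴿ (fromℚ (G centre)) (lift (fromℚ centre))
          (≈-sym (lift (fromℚ centre)) (fromℚ (G centre)) (lift-rational (fromℚ centre) {centre} (≈-refl (fromℚ centre)))))
      where
      zero-at : β * centre + c ≡ 0ℚ
      zero-at = trans (l β c (2^- k)) (trans (cong (λ z → c * (1ℚ - z)) (2^n*2^-n k)) (*-zeroʳ c))
        where
        l : ∀ β c h → β * (- (c * h)) + c ≡ c * (1ℚ - β * h)
        l = solve 3 (λ β c h → β :* (:- (c :* h)) :+ c := c :* (con 1ℚ :- β :* h)) refl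
      tent≤ : β + H ≤ G centre
      tent≤ = ≤-trans (≤-reflexive (sym (trans (cong (λ z → (β + H) - ∣ z ∣) zero-at) (+-identityʳ (β + H)))))
          (p≤q⊔p (ramp β centre) (tent centre))

-- Running maxima of the kink and of the raised kink

tent-index : ℕ → ℕ
tent-index i = 32 ℕ.* i ℕ.+ 16

-- The tents are centred at -(32i+16)/β with half-width 16/β, so their open supports are adjacent. A
-- common point would bring two numbers at least 32 apart to a distance below 16 + 16.
tent-disjoint : ∀ k (16<2^k : 16 ℕ.< 2 ℕ.^ k) q i j → let Hit i = Bump.Hit k (tent-index i) 16<2^k (ℕ.m≤n+m 16 (32 ℕ.* i)) q in
  Hit i → Hit j → ¬ (i ℕ.< j)
tent-disjoint k 16<2^k q i j hit-i hit-j i<j = <-irrefl refl (<-≤-trans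
    (+-mono-< (≤-<-trans (-p≤∣p∣ (x + fromℕℚ (tent-index i))) hit-i) (≤-<-trans (p≤∣p∣ (x + fromℕℚ (tent-index j))) hit-j))
    (≤-by apart (l (fromℕℚ (tent-index i)) (fromℕℚ (tent-index j)) x)))
  where
  x = pow k * q
  far : 32 ℕ.+ tent-index i ℕ.≤ tent-index j
  far = subst (ℕ._≤ tent-index j) (sym (ℕ.+-assoc 32 (32 ℕ.* i) 16))
      (ℕ.+-monoˡ-≤ 16 (subst (ℕ._≤ 32 ℕ.* j) (ℕ.*-suc 32 i) (ℕ.*-monoʳ-≤ 32 i<j)))
  apart : fromℕℚ 32 + fromℕℚ (tent-index i) ≤ fromℕℚ (tent-index j)
  apart = subst (_≤ fromℕℚ (tent-index j)) (sym (fromℕℚ-+ 32 (tent-index i)))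
      (fromℕℚ-≤ {32 ℕ.+ tent-index i} {tent-index j} far)
  l : ∀ a b x → (fromℕℚ 32 + a) + (- (x + a) + (x + b)) ≡ b + (fromℕℚ 16 + fromℕℚ 16)
  l = solve 3 (λ a b x → (con (fromℕℚ 32) :+ a) :+ (:- (x :+ a) :+ (x :+ b)) := b :+
      (con (fromℕℚ 16) :+ con (fromℕℚ 16))) refl

local-weaken : ∀ {ψ p F} → Local ψ 0 p F → Local ψ 1 p F
local-weaken loc u v k r = let Q , Q≤ , f = loc u v k r in Q , ℕ.m≤n⇒m≤1+n Q≤ , f

-- The hypothesis bounds the entries of `x` only up to a tolerance; the tolerance `2^- k * ε`
-- compensates for the slope 2^k.
rampᴿ-nonpositive : ∀ k x → x ≤ᴿ fromℚ 0ℚ → rampᴿ (fromℚ (pow k)) x ≤ᴿ fromℚ (pow k)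
rampᴿ-nonpositive k x x≤0 ε ε>0 = ev-map bound
    (x≤0 (2^- k * ε) (subst (_< 2^- k * ε) (*-zeroʳ (2^- k)) (*-monoʳ-<-pos (2^- k) {{positive (2^-pos k)}} ε>0)))
  where
  β = pow k
  bound : ∀ n → seq x n ≤ 0ℚ + 2^- k * ε → β * (seq x n - - 1ℚ) ⊔ β ≤ β + ε
  bound n h = ⊔-lub (≤-by (*-monoˡ-≤-nonNeg β {{nonNegative (0≤fromℕℚ (2 ℕ.^ k))}} h)
      (trans (l β (seq x n) (2^- k) ε)
          (trans (cong (λ z → β * (0ℚ + 2^- k * ε) + β * (seq x n - - 1ℚ) + (1ℚ - z) * ε) (2^n*2^-n k))
        (l₀ (β * (0ℚ + 2^- k * ε) + β * (seq x n - - 1ℚ)) ε))))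
    (≤-by (<⇒≤ ε>0) (l₁ β ε))
    where
    l : ∀ β x h ε → β * x + (β + ε) ≡ β * (0ℚ + h * ε) + β * (x - - 1ℚ) + (1ℚ - β * h) * ε
    l = solve 4 (λ β x h ε → β :* x :+ (β :+ ε) := β :* (con 0ℚ :+ h :* ε) :+ β :* (x :- con (- 1ℚ)) :+
        (con 1ℚ :- β :* h) :* ε) refl
    l₀ : ∀ a ε → a + (1ℚ - 1ℚ) * ε ≡ a
    l₀ = solve 2 (λ a ε → a :+ (con 1ℚ :- con 1ℚ) :* ε := a) refl
    l₁ : ∀ β ε → 0ℚ + (β + ε) ≡ ε + β
    l₁ = solve 2 (λ β ε → con 0ℚ :+ (β :+ ε) := ε :+ β) refl

0I : I
0I = rational 0ℚ (≤ᵇ⇒≤ tt) (≤ᵇ⇒≤ tt)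

module _ (S : Strategy Fun) where
  open Strategy S
  open Evaluation S

  -- The evaluation of `evalAt (app paramax kink)` with the process for the kink left open, so that
  -- an altered name can take its place.
  maxBefore : Process → Process → Process
  maxBefore p x = Run (op-algorithm eval) (Bundle (finite 2) (pair (Run (op-algorithm paramax) p) x))

  maxBefore-good : ∀ {p x f} → Good Fun p cont f → Good Fun x real (fromℚ 0ℚ) →
    Σ[ h ∈ C ] rel ⟦ paramax ⟧op f h × Σ[ y ∈ ℝ ] y ≈ fun h 0I × Good Fun (maxBefore p x) real y
  maxBefore-good {f = f} f-good x-good =
    let h , h-max , h-good = apply-good paramax {f} f-good tt
        y , y≈ , y-good = apply-good eval {h , fromℚ 0ℚ} (pair-good h-good x-good) (-1≤ 0I , ≤1 0I)
    in h , h-max , y , y≈ (-1≤ 0I , ≤1 0I) , y-good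

  -- Locality is carried outwards through `paramax`, the bundle and `eval`. The component `x` is the
  -- same for every name of the kink and contributes no strings.
  maxBefore-local : ∀ {p x ψ} → Sound p ψ → Local ψ 0 (maxBefore p x) (λ ψ′ → maxBefore (oracle ψ′) x)
  maxBefore-local {p} {x} {ψ} sound = run-local (op-algorithm eval)
      (local-weaken {F = λ ψ′ → Bundle (finite 2) (pair (Run (op-algorithm paramax) (oracle ψ′)) x)}
    (bundle-local (finite 2) {Fs = λ ψ′ → pair (Run (op-algorithm paramax) (oracle ψ′)) x}
      λ { 0F → run-local (op-algorithm paramax) (sound⇒local sound) ; 1F → unrelated-local }))

  kink-output : ∀ k {p x f} → (∀ t → fun f t ≈ rampᴿ (fromℚ (pow k)) (val t)) → Good Fun p cont f →
      Good Fun x real (fromℚ 0ℚ) →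
    ∀ {v steps} → maxBefore p x [] v steps → dyadic v ≤ pow k + fromℕℚ 4
  kink-output k {f = f} f≈ f-good x-good {v} {steps} run =
    let h , h-max , y , y≈ , good ψ name sound = maxBefore-good f-good x-good
        s , s≤0 , fs≈ = proj₂ (h-max 0I)
        b = fromℚ (pow k)
        y≤ = ≤ᴿ-trans y (fun f s) b (≈⇒≤ᴿ y (fun f s) (≈-trans y (fun h 0I) (fun f s) y≈ (≈-sym (fun f s) (fun h 0I) fs≈)))
               (≤ᴿ-trans (fun f s) (rampᴿ b (val s)) b (≈⇒≤ᴿ (fun f s) (rampᴿ b (val s)) (f≈ s))
                   (rampᴿ-nonpositive k (val s) s≤0))
    in subst (λ w → dyadic w ≤ pow k + fromℕℚ 4) (sym (sound [] v steps run)) (ρ-upper ψ y {pow k} name y≤)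

  peak-output : ∀ {p x g r} (s : I) → val s ≤ᴿ fromℚ 0ℚ → fromℚ r ≤ᴿ fun g s → Good Fun p cont g →
      Good Fun x real (fromℚ 0ℚ) →
    ∀ {v steps} → maxBefore p x [] v steps → r ≤ dyadic v + fromℕℚ 4
  peak-output {g = g} {r} s s≤0 r≤ g-good x-good {v} {steps} run =
    let h , h-max , y , y≈ , good ψ name sound = maxBefore-good g-good x-good
        ≤y = ≤ᴿ-trans (fromℚ r) (fun g s) y r≤
            (≤ᴿ-trans (fun g s) (fun h 0I) y (proj₁ (h-max 0I) s s≤0) (≈⇒≤ᴿ (fun h 0I) y (≈-sym y (fun h 0I) y≈)))
    in subst (λ w → r ≤ dyadic w + fromℕℚ 4) (sym (sound [] v steps run)) (ρ-lower ψ y {r} name ≤y)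

  -- The run depends on fewer than 2^r strings of the name, while 2^r disjoint tents fit between -1
  -- and 0, so some tent is met by none of them. With the name altered at that tent the run can be
  -- replayed with the same output, which is at most β + 4 for the kink but at least β + 12 for the
  -- raised function. The replay may take a different number of steps; its output alone matters.
  overlooked : ∀ k r → 32 ℕ.* 2 ℕ.^ r ℕ.≤ 2 ℕ.^ k → ∀ {p x f} → (∀ t → fun f t ≈ rampᴿ (fromℚ (pow k)) (val t)) →
      Good Fun p cont f → Good Fun x real (fromℚ 0ℚ) →
    ∀ {v steps} → maxBefore p x [] v steps → ¬ (steps ℕ.< 2 ℕ.^ r)
  overlooked k r tents≤ {p} {x} {f} f≈ f-good x-good {v} {steps} run fast =
      <-irrefl refl (<-≤-trans (≤-<-trans (+-monoˡ-≤ (fromℕℚ 4) (kink-output k f≈ f-good x-good run)) gap)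
        (peak-output {g = liftC} (peakI e≤) (fromℚ-mono (centre≤0 e≤)) (peak-high e≤) g-good x-good (proj₂ replayed)))
    where
    φ = Good.name f-good
    local = maxBefore-local {p} {x} (Good.sound f-good) [] v steps run
    Q = proj₁ local
    16<2^k : 16 ℕ.< 2 ℕ.^ k
    16<2^k = ℕ.<-≤-trans (ℕ.m≤m+n 17 15) (ℕ.≤-trans (ℕ.*-monoʳ-≤ 32 (ℕ.m^n>0 2 r)) tents≤)
    Hit : Fin (2 ℕ.^ r) → Str → Set
    Hit i w = Bump.Hit k (tent-index (toℕ i)) 16<2^k (ℕ.m≤n+m 16 (32 ℕ.* toℕ i)) (dyadic (unblock w))
    unique : ∀ w i j → Hit i w → Hit j w → i ≡ j
    unique w i j hit-i hit-j = Fin.toℕ-injective (ℕ.≤-antisym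
      (ℕ.≮⇒≥ (tent-disjoint k 16<2^k (dyadic (unblock w)) (toℕ j) (toℕ i) hit-j hit-i))
      (ℕ.≮⇒≥ (tent-disjoint k 16<2^k (dyadic (unblock w)) (toℕ i) (toℕ j) hit-i hit-j)))
    choice : ∃[ i ] All (λ w → ¬ Hit i w) Q
    choice = unhit Hit (λ i w → ∣ pow k * dyadic (unblock w) + fromℕℚ (tent-index (toℕ i)) ∣ <? fromℕℚ 16) unique Q
        (ℕ.≤-<-trans (proj₁ (proj₂ local)) fast)
    i = toℕ (proj₁ choice)
    e≤ : tent-index i ℕ.≤ 2 ℕ.^ k
    e≤ = ℕ.≤-trans (ℕ.+-monoʳ-≤ (32 ℕ.* i) (ℕ.m≤m+n 16 16))
        (ℕ.≤-trans (ℕ.≤-reflexive (trans (ℕ.+-comm (32 ℕ.* i) 32) (sym (ℕ.*-suc 32 i))))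
      (ℕ.≤-trans (ℕ.*-monoʳ-≤ 32 (Fin.toℕ<n (proj₁ choice))) tents≤))
    open Adversary k (tent-index i) 16<2^k (ℕ.m≤n+m 16 (32 ℕ.* i)) f f≈ φ (Good.valid f-good)
    open Bump k (tent-index i) 16<2^k (ℕ.m≤n+m 16 (32 ℕ.* i)) using (liftC)
    replayed : ∃[ steps′ ] maxBefore (oracle (fn φ′)) x [] v steps′
    replayed = proj₂ (proj₂ local) (fn φ′) (All.map (λ {w} → unchanged w) (proj₂ choice))
    g-good : Good Fun (oracle (fn φ′)) cont liftC
    g-good = good φ′ φ′-named λ { _ _ _ (e , _) → e }
    -- Two errors of 4 explain the height of the tents: 16 exceeds their sum.
    gap : pow k + fromℕℚ 4 + fromℕℚ 4 < pow k + fromℕℚ 16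
    gap = ≤-<-trans (≤-reflexive (+-assoc (pow k) (fromℕℚ 4) (fromℕℚ 4)))
        (+-monoʳ-< (pow k) (fromℕℚ-< {8} {16} (ℕ.m≤m+n 9 7)))

Fun-slow : ¬ Σ (Strategy Fun) EvaluatesInPolynomialTime
Fun-slow (S , poly) = at-scale k r large cheap
  where
  t : Term Γ₂ real
  t = evalAt (app paramax kink)
  P : Poly₂
  P = proj₁ (poly t (real ∷ real ∷ []) real)
  open Scale (scale P)
  -- Stated for arbitrary `k` and `r`, which are thus variables here instead of the powers chosen by
  -- `scale`.
  at-scale : ∀ k r → r ℕ.+ r ℕ.+ 8 ℕ.< k →
    (∀ v w → length v ≡ 3 ℕ.+ k → length w ≡ 3 ℕ.+ k → ⟦ P ⟧₂ (size (constant𝓜 v ⊗𝓜 constant𝓜 w)) 0 ℕ.< 2 ℕ.^ r) → ⊥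
  at-scale k r large cheap = overlooked S k r tents≤ f≈ f-good x₀-good (proj₁ (proj₂ (proj₂ output)))
      (ℕ.≤-<-trans (proj₂ (proj₂ (proj₂ output))) (cheap wb w₀ ∣wb∣ ∣w₀∣))
    where
    open Words k
    wb w₀ : Str
    wb = proj₁ 2^k-word
    w₀ = proj₁ 0-word
    ∣wb∣ : length wb ≡ 3 ℕ.+ k
    ∣wb∣ = proj₁ (proj₂ 2^k-word)
    ∣w₀∣ : length w₀ ≡ 3 ℕ.+ k
    ∣w₀∣ = proj₁ (proj₂ 0-word)
    wb≡ : dyadic wb ≡ pow k
    wb≡ = proj₂ (proj₂ 2^k-word)
    w₀≡ : dyadic w₀ ≡ 0ℚ
    w₀≡ = proj₂ (proj₂ 0-word)
    open Inputs Fun wb w₀ (trans ∣wb∣ (sym ∣w₀∣))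
    b₀-good : Good Fun (env (here refl)) real (fromℚ (pow k))
    b₀-good = subst (λ q → Good Fun (env (here refl)) real (fromℚ q)) wb≡ b-good
    x₀-good : Good Fun (env (there (here refl))) real (fromℚ 0ℚ)
    x₀-good = subst (λ q → Good Fun (env (there (here refl))) real (fromℚ q)) w₀≡ x-good
    kinked : Σ[ f ∈ C ] (∀ t → fun f t ≈ rampᴿ (fromℚ (pow k)) (val t)) × Good Fun (evaluate S kink env) cont f
    kinked = Evaluation.kink-good S {env} {fromℚ (pow k)} b₀-good
    f : C
    f = proj₁ kinked
    f≈ : ∀ t → fun f t ≈ rampᴿ (fromℚ (pow k)) (val t)
    f≈ = proj₁ (proj₂ kinked)
    f-good : Good Fun (evaluate S kink env) cont f
    f-good = proj₂ (proj₂ kinked)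
    defined : Defined t vs
    defined = ((kink-defined vs , λ _ _ → tt) , tt) ,
      λ (_ , x) (_ , x≈) → x-InI (subst (- 1ℚ ≤_) (sym w₀≡) (≤ᵇ⇒≤ tt)) (subst (_≤ 1ℚ) (sym w₀≡) (≤ᵇ⇒≤ tt)) x x≈
    output : ∃₂ λ v steps → evalₛ S t φ [] v steps × steps ℕ.≤ ⟦ P ⟧₂ (size φ) 0
    output = proj₂ (poly t (real ∷ real ∷ []) real) φ vs (names-values S) defined []
    -- The 5 comes from 32 = 2^5, the spacing of the tents in units of 1/β.
    5+r≤k : 5 ℕ.+ r ℕ.≤ k
    5+r≤k = ℕ.≤-trans (ℕ.≤-reflexive (ℕ.+-comm 5 r)) (ℕ.≤-trans (ℕ.+-mono-≤ (ℕ.m≤m+n r r) (ℕ.m≤m+n 5 3)) (ℕ.<⇒≤ large))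
    tents≤ : 32 ℕ.* 2 ℕ.^ r ℕ.≤ 2 ℕ.^ k
    tents≤ = ℕ.≤-trans (ℕ.≤-reflexive (sym (ℕ.^-distribˡ-+-* 2 5 r))) (ℕ.^-monoʳ-≤ 2 {5 ℕ.+ r} {k} 5+r≤k)

theorem25 : ¬ Σ (Strategy Poly) EvaluatesInPolynomialTime ×
    ¬ Σ (Strategy PAff) EvaluatesInPolynomialTime ×
    ¬ Σ (Strategy Fun) EvaluatesInPolynomialTime
theorem25 = Poly-slow , PAff-slow , Fun-slow
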